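{- There exist a constant $c$ and an algorithm that solves the Dual Feedback Vertex Set problem (DFVS) in time $O^*(c^k)$: given an edge-bicolored graph $G$ and an integer $k\ge 0$ (the parameter), the algorithm finds a dual feedback vertex set of $G$ of size at most $k$, or correctly reports that none exists, in time $O^*(c^k)$.
   Context: An edge-bicolored graph $G=(V,E_b\cup E_r)$ is a finite simple undirected graph in which each edge is colored either blue (the edges in $E_b$) or red (the edges in $E_r$). Its blue graph is $G_b=(V,E_b)$ and its red graph is $G_r=(V,E_r)$. A vertex set $S\subseteq V$ is a dual feedback vertex set of $G$ if both $G_b-S$ and $G_r-S$ are acyclic, i.e. $S$ hits every cycle all of whose edges are blue and every cycle all of whose edges are red. Dual Feedback Vertex Set (DFVS): the input is an edge-bicolored graph $G$ and a parameter $k$; the task is to find a vertex set $S$ of size at most $k$ that is a dual feedback vertex set of $G$ (or to report that none exists). The $O^*$-notation suppresses factors polynomial in the input size. -}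

module Defs where

open import Data.Bool using (Bool; true; false)
open import Data.Fin using (Fin)
open import Data.Fin.Subset using (Subset; _∉_; ∣_∣)
open import Data.List using (List; _∷_; _∷ʳ_; length)
open import Data.List.Relation.Unary.Linked using (Linked)
open import Data.List.Relation.Unary.Unique.Propositional using (Unique)
open import Data.Maybe using (Maybe; just; nothing)
open import Data.Nat using (ℕ; zero; suc; _+_; _≤_)
open import Data.Product using (_×_; _,_; ∃-syntax)
open import Data.Vec using (Vec; []; _∷_; lookup; tabulate)
open import Level using (0ℓ)
open import Relation.Binary.Core using (Rel)
open import Relation.Binary.PropositionalEquality using (_≡_; refl)
open import Relation.Nullary using (¬_)

------------------------------------------------------------------------
-- Edge-bicolored graphs and dual feedback vertex sets

data Colour : Set where
  blue red : Colour

-- colour u v is nothing when uv is not an edge; so every edge has exactly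
-- one colour.
record BicolouredGraph (n : ℕ) : Set where
  field
    colour  : Fin n → Fin n → Maybe Colour
    symm    : ∀ u v → colour u v ≡ colour v u
    irrefl  : ∀ v → colour v v ≡ nothing

open BicolouredGraph public

Adj : ∀ {n} → BicolouredGraph n → Colour → Rel (Fin n) 0ℓ
Adj G c u v = colour G u v ≡ just c

-- The vertices of S become isolated instead of being removed from the
-- vertex type; a cycle has no isolated vertices.
_─_ : ∀ {n} → Rel (Fin n) 0ℓ → Subset n → Rel (Fin n) 0ℓ
(_~_ ─ S) u v = u ∉ S × v ∉ S × u ~ v

record Cycle {n} (_~_ : Rel (Fin n) 0ℓ) : Set where
  field
    start    : Fin n
    rest     : List (Fin n)
    long     : 3 ≤ length (start ∷ rest)
    distinct : Unique (start ∷ rest)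
    closed   : Linked _~_ (start ∷ rest ∷ʳ start)

Acyclic : ∀ {n} → Rel (Fin n) 0ℓ → Set
Acyclic _~_ = ¬ Cycle _~_

DualFVS : ∀ {n} → BicolouredGraph n → Subset n → Set
DualFVS G S = Acyclic (Adj G blue ─ S) × Acyclic (Adj G red ─ S)

-- What a correct answer to the instance (G , k) is.
Answers : ∀ {n} → BicolouredGraph n → ℕ → Maybe (Subset n) → Set
Answers G k (just S) = DualFVS G S × ∣ S ∣ ≤ k
Answers G k nothing  = ¬ (∃[ S ] (DualFVS G S × ∣ S ∣ ≤ k))

------------------------------------------------------------------------
-- The model of computation: first-order, call-by-value recursive functions
-- on binary trees, after the languages WHILE and F of N. D. Jones,
-- "Computability and Complexity from a Programming Perspective".  A program
-- is a finite piece of syntax that does not depend on the input; its data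
-- can only be built, tested and taken apart one node at a time.  Since
-- trees can be shared, every evaluation rule takes constant time on a
-- pointer machine, so time here and time on a Turing machine are
-- polynomially related.

data Tree : Set where
  nil  : Tree
  cons : Tree → Tree → Tree

size : Tree → ℕ
size nil        = 1
size (cons x y) = suc (size x + size y)

-- Expressions over m function symbols, with n variables (de Bruijn indices).
data Expr {m : ℕ} (arity : Fin m → ℕ) (n : ℕ) : Set where
  var   : Fin n → Expr arity n
  nil   : Expr arity n
  cons  : Expr arity n → Expr arity n → Expr arity n
  -- The last branch binds the left subtree as variable 0 and the right
  -- subtree as variable 1.
  case  : Expr arity n → Expr arity n → Expr arity (2 + n) → Expr arity n
  lett  : Expr arity n → Expr arity (1 + n) → Expr arity n
  call  : (f : Fin m) → Vec (Expr arity n) (arity f) → Expr arity n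

record Program : Set where
  field
    {functions} : ℕ
    arity       : Fin functions → ℕ
    body        : (f : Fin functions) → Expr arity (arity f)
    main        : Expr arity 1

-- ρ ⊢ e ⇓ v [ t ]: in the environment ρ the expression e evaluates to v,
-- in a derivation with t applications of rules other than [] and _∷_.
module Semantics (P : Program) where
  open Program P

  infix 4 _⊢_⇓_[_] _⊢_⇓*_[_]

  mutual
    data _⊢_⇓_[_] {n} (ρ : Vec Tree n) : Expr arity n → Tree → ℕ → Set where
      ⇓var  : ∀ {x} → ρ ⊢ var x ⇓ lookup ρ x [ 1 ]
      ⇓nil  : ρ ⊢ nil ⇓ nil [ 1 ]
      ⇓cons : ∀ {e₁ e₂ v₁ v₂ s t} →
              ρ ⊢ e₁ ⇓ v₁ [ s ] → ρ ⊢ e₂ ⇓ v₂ [ t ] →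
              ρ ⊢ cons e₁ e₂ ⇓ cons v₁ v₂ [ suc (s + t) ]
      ⇓case-nil  : ∀ {e e₁ e₂ v s t} →
              ρ ⊢ e ⇓ nil [ s ] → ρ ⊢ e₁ ⇓ v [ t ] →
              ρ ⊢ case e e₁ e₂ ⇓ v [ suc (s + t) ]
      ⇓case-cons : ∀ {e e₁ e₂ x y v s t} →
              ρ ⊢ e ⇓ cons x y [ s ] → (x ∷ y ∷ ρ) ⊢ e₂ ⇓ v [ t ] →
              ρ ⊢ case e e₁ e₂ ⇓ v [ suc (s + t) ]
      ⇓lett : ∀ {e₁ e₂ x v s t} →
              ρ ⊢ e₁ ⇓ x [ s ] → (x ∷ ρ) ⊢ e₂ ⇓ v [ t ] →
              ρ ⊢ lett e₁ e₂ ⇓ v [ suc (s + t) ]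
      ⇓call : ∀ {f es vs v s t} →
              ρ ⊢ es ⇓* vs [ s ] → vs ⊢ body f ⇓ v [ t ] →
              ρ ⊢ call f es ⇓ v [ suc (s + t) ]

    data _⊢_⇓*_[_] {n} (ρ : Vec Tree n) :
         ∀ {l} → Vec (Expr arity n) l → Vec Tree l → ℕ → Set where
      []  : ρ ⊢ [] ⇓* [] [ 0 ]
      _∷_ : ∀ {l e v s t} {es : Vec (Expr arity n) l} {vs} →
            ρ ⊢ e ⇓ v [ s ] → ρ ⊢ es ⇓* vs [ t ] →
            ρ ⊢ (e ∷ es) ⇓* (v ∷ vs) [ s + t ]

  -- Evaluation is deterministic: both the value and the time are functions
  -- of the environment and the expression.
  mutual
    deterministic : ∀ {n} {ρ : Vec Tree n} {e v w s t} →
                    ρ ⊢ e ⇓ v [ s ] → ρ ⊢ e ⇓ w [ t ] → v ≡ w × s ≡ t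
    deterministic ⇓var ⇓var = refl , refl
    deterministic ⇓nil ⇓nil = refl , refl
    deterministic (⇓cons p q) (⇓cons p′ q′)
      with refl , refl ← deterministic p p′
         | refl , refl ← deterministic q q′ = refl , refl
    deterministic (⇓case-nil p q) (⇓case-nil p′ q′)
      with refl , refl ← deterministic p p′
         | refl , refl ← deterministic q q′ = refl , refl
    deterministic (⇓case-nil p q) (⇓case-cons p′ q′)
      with () , _ ← deterministic p p′
    deterministic (⇓case-cons p q) (⇓case-nil p′ q′)
      with () , _ ← deterministic p p′
    deterministic (⇓case-cons p q) (⇓case-cons p′ q′)
      with refl , refl ← deterministic p p′
      with refl , refl ← deterministic q q′ = refl , refl
    deterministic (⇓lett p q) (⇓lett p′ q′)
      with refl , refl ← deterministic p p′
      with refl , refl ← deterministic q q′ = refl , refl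
    deterministic (⇓call p q) (⇓call p′ q′)
      with refl , refl ← deterministic* p p′
      with refl , refl ← deterministic q q′ = refl , refl

    deterministic* : ∀ {n l} {ρ : Vec Tree n} {es : Vec _ l} {vs ws s t} →
                     ρ ⊢ es ⇓* vs [ s ] → ρ ⊢ es ⇓* ws [ t ] →
                     vs ≡ ws × s ≡ t
    deterministic* [] [] = refl , refl
    deterministic* (p ∷ q) (p′ ∷ q′)
      with refl , refl ← deterministic p p′
         | refl , refl ← deterministic* q q′ = refl , refl

-- On input x, the program P halts with output y after t steps.
Runs : Program → Tree → Tree → ℕ → Set
Runs P x y t = (x ∷ []) ⊢ Program.main P ⇓ y [ t ]
  where open Semantics P

------------------------------------------------------------------------
-- Encoding of instances and answers as trees

encodeℕ : ℕ → Tree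
encodeℕ zero    = nil
encodeℕ (suc n) = cons nil (encodeℕ n)

encodeBool : Bool → Tree
encodeBool false = nil
encodeBool true  = cons nil nil

encodeColour : Colour → Tree
encodeColour blue = nil
encodeColour red  = cons nil nil

encodeMaybe : ∀ {A : Set} → (A → Tree) → Maybe A → Tree
encodeMaybe ⌜_⌝ nothing  = nil
encodeMaybe ⌜_⌝ (just x) = cons ⌜ x ⌝ nil

encodeVec : ∀ {A : Set} {n} → (A → Tree) → Vec A n → Tree
encodeVec ⌜_⌝ []       = nil
encodeVec ⌜_⌝ (x ∷ xs) = cons ⌜ x ⌝ (encodeVec ⌜_⌝ xs)

-- The matrix of colours, row by row.
encodeGraph : ∀ {n} → BicolouredGraph n → Tree
encodeGraph G =
  encodeVec (encodeVec (encodeMaybe encodeColour))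
            (tabulate λ u → tabulate λ v → colour G u v)

-- The parameter is in unary.  This cannot make a time bound weaker as long
-- as the bound is in terms of k and the size of encodeGraph G alone.
encodeInstance : ∀ {n} → BicolouredGraph n → ℕ → Tree
encodeInstance G k = cons (encodeGraph G) (encodeℕ k)

encodeAnswer : ∀ {n} → Maybe (Subset n) → Tree
encodeAnswer = encodeMaybe (encodeVec encodeBool)

{-# OPTIONS --safe #-}
module Submission where

-- Iterative compression: vertices are added one at a time, and a solution T of
-- size at most k + 1 is compressed to size k.
--
-- For one colour, a run of the algorithm consumes a string of O(k) guesses and
-- returns O(k) clauses (sets of vertices), such that S is a feedback vertex set
-- iff it hits every clause of some run.  The vertices outside T induce a forest.
-- A forest vertex of degree at most two is smoothed out, its name being added to
-- the label of the edge that replaces it.  A vertex of higher degree with at most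
-- one neighbour in the forest, or a vertex of T, is either cut, which yields the
-- clause {v}, or promoted to a terminal; an edge between terminals is either cut,
-- its label being the clause, or contracted.
--
-- The colours thus become independent, and O(k) clauses have to be hit by k
-- vertices, which is dynamic programming over sets of clauses.  Once all strings
-- of O(k) guesses have been written down, everything takes time polynomial in the
-- size of that list and of the graph.

-- A vertex of degree two in one colour cannot simply be bypassed, because it may be the one that
-- serves the other colour. Labels keep it available, and this is why a run returns clauses instead
-- of deleting vertices: which vertex of a label is used is decided only when both colours are
-- known, on the concatenation of the clauses of a blue and of a red run. Soundness holds for every
-- string of guesses. Completeness concerns only the string dictated by a given solution; the
-- difficulty there is that 10 (k + 1) guesses suffice. This rests on a potential in which settled
-- edges count as credit: they are few, since those that survive the solution form a forest on the
-- terminals. A blue and a red run together yield at most 4 k + 2 clauses, fewer than there are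
-- guesses, so the same strings also enumerate the sets of clauses. Only this pool of strings is
-- exponentially large; its size is at most 3 D^(k+1) with D = 10^10, and a polynomial of degree d
-- in it gives the base D^d.

open import Defs
open import Data.Fin.Subset using (Subset)
open import Data.Maybe using (Maybe)
open import Data.Nat using (ℕ; _*_; _^_; _≤_)
open import Data.Product using (Σ-syntax; ∃-syntax; _×_)

open import Data.Bool using (Bool; true; false; if_then_else_; not; _∧_; _∨_; T?)
open import Data.Bool.ListAction using (any; all)
open import Data.Bool.Properties using (T-≡; ∧-comm)
open import Data.Empty using (⊥)
open import Data.Fin as Fin using (Fin; zero; suc; toℕ; fromℕ<; splitAt)
open import Data.Fin.Properties using (splitAt-join; toℕ<n; toℕ-fromℕ<; toℕ-injective)
import Data.Fin.Subset as Sub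
open import Data.List using (List; []; _∷_; length; _++_; map; concatMap; filterᵇ; replicate; downFrom; upTo; applyUpTo; drop; tabulate)
open import Data.List.Properties using (length-map; length-++; length-replicate; length-tabulate; map-id-local; upTo-∷ʳ)
import Data.List.Membership.DecPropositional
open import Data.List.Membership.Propositional using (_∈_; _∉_)
open import Data.List.Membership.Propositional.Properties using (∈-filter⁺; ∈-filter⁻; ∈-map⁺; ∈-map⁻; ∈-++⁺ˡ; ∈-++⁺ʳ; ∈-++⁻; ∈-downFrom⁺; ∈-downFrom⁻; ∈-∃++)
open import Data.List.Relation.Binary.Permutation.Propositional using (_↭_; refl; prep; swap; ↭-sym) renaming (trans to trans↭)
open import Data.List.Relation.Binary.Permutation.Propositional.Properties using (∈-resp-↭; ↭-length; filter-↭) renaming (shift to ↭-shift)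
open import Data.List.Relation.Binary.Sublist.Propositional using ([]; _∷_; _∷ʳ_; ⊆-refl; ⊆-reflexive; ⊆-trans) renaming (_⊆_ to _⊑_; lookup to ⊑-lookup)
open import Data.List.Relation.Unary.All as All using (All; []; _∷_)
open import Data.List.Relation.Unary.All.Properties using (¬Any⇒All¬)
open import Data.List.Relation.Unary.AllPairs using ([]; _∷_)
open import Data.List.Relation.Unary.Any using (Any; here; there)
open import Data.List.Relation.Unary.Linked using (Linked; [-]; _∷_)
open import Data.List.Relation.Unary.Unique.Propositional using (Unique)
import Data.List.Relation.Unary.Unique.Propositional.Properties as Unique
open import Data.Maybe using (just; nothing)
open import Data.Nat using (zero; suc; _+_; _∸_; _<_; _≤ᵇ_; _≡ᵇ_; z≤n; s≤s; s≤s⁻¹; >-nonZero)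
open import Data.Nat.Properties
open import Data.Nat.Tactic.RingSolver using (solve-∀)
open import Data.Product using (_,_; proj₁; proj₂)
open import Data.Sum as Sum using (_⊎_; inj₁; inj₂)
open import Data.Unit using (⊤; tt)
open import Data.Vec as Vec using (Vec; []; _∷_)
open import Data.Vec.Properties using (tabulate∘lookup; lookup∘tabulate; []=⇒lookup; lookup⇒[]=)
open import Function using (_∘_; id; Equivalence)
open import Relation.Binary.Construct.Closure.ReflexiveTransitive using (Star; ε; _◅_; _◅◅_; reverse)
import Relation.Binary.Construct.Closure.ReflexiveTransitive as Star
open import Relation.Binary.Definitions using (tri<; tri≈; tri>)
open import Relation.Binary.PropositionalEquality using (_≡_; _≢_; refl; sym; trans; cong; cong₂; subst; subst₂; _≗_; module ≡-Reasoning)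
open import Relation.Nullary using (¬_; Reflects; ofʸ; ofⁿ; proof; yes; no)
open import Relation.Nullary.Negation using (contradiction)
open import Relation.Nullary.Reflects using (¬-reflects; _×-reflects_; _⊎-reflects_)

-- Linear arithmetic by certificate: L ≤ R is the sum of the hypotheses used, s the slack.
≤-by : ∀ {L R} a b s → L ≤ R → b + L ≡ a + R + s → a ≤ b
≤-by {L} {R} a b s h eq = +-cancelʳ-≤ R a b (begin
  a + R      ≤⟨ m≤m+n (a + R) s ⟩
  a + R + s  ≡⟨ eq ⟨
  b + L      ≤⟨ +-monoʳ-≤ b h ⟩
  b + R      ∎)
  where open ≤-Reasoning

-- Polynomials

infixl 6 _⊕_
infixl 7 _⊛_
infixr 9 _⊚_

-- Bounds are kept as syntax, so that monotonicity and the bound by one monomial are inductions.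
-- Composition is a constructor because the output of one piece of code is the input of the next.
data Poly : Set where
  con     : ℕ → Poly
  X       : Poly
  _⊕_ _⊛_ : Poly → Poly → Poly
  _⊚_     : Poly → Poly → Poly

eval : Poly → ℕ → ℕ
eval (con c) n = c
eval X       n = n
eval (p ⊕ q) n = eval p n + eval q n
eval (p ⊛ q) n = eval p n * eval q n
eval (p ⊚ q) n = eval p (eval q n)

eval-mono : ∀ p {m n} → m ≤ n → eval p m ≤ eval p n
eval-mono (con c) h = ≤-refl
eval-mono X       h = h
eval-mono (p ⊕ q) h = +-mono-≤ (eval-mono p h) (eval-mono q h)
eval-mono (p ⊛ q) h = *-mono-≤ (eval-mono p h) (eval-mono q h)
eval-mono (p ⊚ q) h = eval-mono p (eval-mono q h)

*-^-distrib : ∀ m n d → (m * n) ^ d ≡ m ^ d * n ^ d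
*-^-distrib m n zero    = refl
*-^-distrib m n (suc d) = trans (cong (m * n *_) (*-^-distrib m n d)) (lemma m n (m ^ d) (n ^ d))
  where
  lemma : ∀ a b c d → a * b * (c * d) ≡ a * c * (b * d)
  lemma = solve-∀

-- The base is n + 1 rather than n: being positive, it allows both degrees of a sum to be raised to
-- a common one. In a composition the successor of the inner value is absorbed by raising the inner
-- coefficient by one.
eval-bound : ∀ p → ∃[ a ] ∃[ d ] (∀ n → eval p n ≤ a * suc n ^ d)
eval-bound (con c) = c , 0 , λ n → ≤-reflexive (sym (*-identityʳ c))
eval-bound X = 1 , 1 , λ n → ≤-trans (n≤1+n n) (≤-reflexive (lemma n))
  where
  lemma : ∀ n → suc n ≡ 1 * (suc n * 1)
  lemma = solve-∀
eval-bound (p ⊕ q) with eval-bound p | eval-bound q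
... | a , d , f | b , e , g = a + b , d + e , λ n →
  ≤-trans (+-mono-≤ (≤-trans (f n) (*-monoʳ-≤ a (^-monoʳ-≤ (suc n) (m≤m+n d e))))
                    (≤-trans (g n) (*-monoʳ-≤ b (^-monoʳ-≤ (suc n) (m≤n+m e d)))))
          (≤-reflexive (sym (*-distribʳ-+ (suc n ^ (d + e)) a b)))
eval-bound (p ⊛ q) with eval-bound p | eval-bound q
... | a , d , f | b , e , g = a * b , d + e , λ n →
  ≤-trans (*-mono-≤ (f n) (g n)) (≤-reflexive
    (trans (lemma a b (suc n ^ d) (suc n ^ e)) (cong (a * b *_) (sym (^-distribˡ-+-* (suc n) d e)))))
  where
  lemma : ∀ a b c d → a * c * (b * d) ≡ a * b * (c * d)
  lemma = solve-∀
eval-bound (p ⊚ q) with eval-bound p | eval-bound q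
... | a , d , f | b , e , g = a * suc b ^ d , e * d , λ n → ≤-trans (f (eval q n)) (begin
  a * suc (eval q n) ^ d            ≤⟨ *-monoʳ-≤ a (^-monoˡ-≤ d (step n)) ⟩
  a * (suc b * suc n ^ e) ^ d       ≡⟨ cong (a *_) (*-^-distrib (suc b) (suc n ^ e) d) ⟩
  a * (suc b ^ d * (suc n ^ e) ^ d) ≡⟨ cong (λ z → a * (suc b ^ d * z)) (^-*-assoc (suc n) e d) ⟩
  a * (suc b ^ d * suc n ^ (e * d)) ≡⟨ *-assoc a (suc b ^ d) _ ⟨
  a * suc b ^ d * suc n ^ (e * d)   ∎)
  where
  open ≤-Reasoning
  step : ∀ n → suc (eval q n) ≤ suc b * suc n ^ e
  step n = +-mono-≤ (m^n>0 (suc n) e) (g n)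

-- Typed data and its encoding

infixr 5 _⊗_

data Ty : Set where
  unit bool nat : Ty
  list          : Ty → Ty
  _⊗_           : Ty → Ty → Ty

⟦_⟧ : Ty → Set
⟦ unit ⟧   = ⊤
⟦ bool ⟧   = Bool
⟦ nat ⟧    = ℕ
⟦ list a ⟧ = List ⟦ a ⟧
⟦ a ⊗ b ⟧  = ⟦ a ⟧ × ⟦ b ⟧

enc : ∀ a → ⟦ a ⟧ → Tree
enc unit     _        = nil
enc bool     b        = encodeBool b
enc nat      n        = encodeℕ n
enc (list a) []       = nil
enc (list a) (x ∷ xs) = cons (enc a x) (enc (list a) xs)
enc (a ⊗ b)  (x , y)  = cons (enc a x) (enc b y)

sz : ∀ a → ⟦ a ⟧ → ℕ
sz a x = size (enc a x)

Ctx : Set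
Ctx = List Ty

Env : Ctx → Set
Env []      = ⊤
Env (a ∷ Γ) = ⟦ a ⟧ × Env Γ

encs : ∀ Γ → Env Γ → Vec Tree (length Γ)
encs []      _       = []
encs (a ∷ Γ) (x , ρ) = enc a x ∷ encs Γ ρ

szs : ∀ Γ → Env Γ → ℕ
szs []      _       = 0
szs (a ∷ Γ) (x , ρ) = sz a x + szs Γ ρ

-- Linking: a piece of code owns the function symbols Ix; the whole program
-- decides which numbers they get.

record Finite (I : Set) : Set where
  field
    card    : ℕ
    to      : I → Fin card
    from    : Fin card → I
    from-to : ∀ i → from (to i) ≡ i

fin⊥ : Finite ⊥
fin⊥ = record { card = 0 ; to = λ () ; from = λ () ; from-to = λ () }

fin⊤ : Finite ⊤
fin⊤ = record { card = 1 ; to = λ _ → zero ; from = λ _ → tt ; from-to = λ _ → refl }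

fin⊎ : ∀ {I J} → Finite I → Finite J → Finite (I ⊎ J)
fin⊎ F G = record
  { card    = F.card + G.card
  ; to      = λ i → Fin.join F.card G.card (Sum.map F.to G.to i)
  ; from    = λ k → Sum.map F.from G.from (splitAt F.card k)
  ; from-to = λ i → trans (cong (Sum.map F.from G.from) (splitAt-join F.card G.card (Sum.map F.to G.to i))) (lemma i)
  }
  where
  module F = Finite F
  module G = Finite G
  lemma : ∀ i → Sum.map F.from G.from (Sum.map F.to G.to i) ≡ i
  lemma (inj₁ i) = cong inj₁ (F.from-to i)
  lemma (inj₂ i) = cong inj₂ (G.from-to i)

Link : {I : Set} → (I → ℕ) → ∀ {m} → (Fin m → ℕ) → Set
Link {I} ar {m} arity = (i : I) → Σ[ f ∈ Fin m ] arity f ≡ ar i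

Bodies : {I : Set} → (I → ℕ) → Set
Bodies {I} ar = ∀ {m} {arity : Fin m → ℕ} → Link ar arity → (i : I) → Expr arity (ar i)

Fits : ∀ {I} {ar : I → ℕ} (P : Program) → Link ar (Program.arity P) → Bodies ar → Set
Fits P ι bs = ∀ i → subst (Expr (Program.arity P)) (proj₂ (ι i)) (Program.body P (proj₁ (ι i))) ≡ bs ι i

Within : (P : Program) {n : ℕ} → Vec Tree n → Expr (Program.arity P) n → Tree → ℕ → Set
Within P ρ e v b = ∃[ t ] (Semantics._⊢_⇓_[_] P ρ e v t × t ≤ b)

callAt : ∀ {m n a} {arity : Fin m → ℕ} → Σ[ f ∈ Fin m ] arity f ≡ a → Vec (Expr arity n) a → Expr arity n
callAt (f , eq) es = call f (subst (Vec _) (sym eq) es)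

run-callAt : ∀ P {n a} {ρ : Vec Tree n} (l : Σ[ f ∈ _ ] Program.arity P f ≡ a) {es vs e v s b} →
             subst (Expr (Program.arity P)) (proj₂ l) (Program.body P (proj₁ l)) ≡ e →
             Semantics._⊢_⇓*_[_] P ρ es vs s → Within P vs e v b → Within P ρ (callAt l es) v (suc (s + b))
run-callAt P (f , refl) refl args (t , d , t≤b) =
  suc (_ + t) , Semantics.⇓call args d , s≤s (+-monoʳ-≤ _ t≤b)

-- `run` speaks about every program into which the piece has been linked, so pieces are combined
-- without being verified again. `cost` is an upper bound for the time, not the time itself.
record Code (Γ : Ctx) (f : Env Γ → Tree) : Set₁ where
  field
    Ix     : Set
    finite : Finite Ix
    ar     : Ix → ℕ
    expr   : ∀ {m} {arity : Fin m → ℕ} → Link ar arity → Expr arity (length Γ)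
    bodies : Bodies ar
    cost   : Env Γ → ℕ
    run    : ∀ P (ι : Link ar (Program.arity P)) → Fits P ι bodies →
             ∀ ρ → Within P (encs Γ ρ) (expr ι) (f ρ) (cost ρ)

open Code

_⊎ᵃ_ : {I J : Set} → (I → ℕ) → (J → ℕ) → I ⊎ J → ℕ
(f ⊎ᵃ g) = Sum.[ f , g ]

⊎-bodies : ∀ {I J} {ar : I → ℕ} {ar′ : J → ℕ} → Bodies ar → Bodies ar′ → Bodies (ar ⊎ᵃ ar′)
⊎-bodies b b′ ι (inj₁ i) = b (ι ∘ inj₁) i
⊎-bodies b b′ ι (inj₂ j) = b′ (ι ∘ inj₂) j

vars : ∀ {m n k} {arity : Fin m → ℕ} → (Fin k → Fin n) → Vec (Expr arity n) k
vars f = Vec.tabulate (var ∘ f)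

run-vars : ∀ P {n} {ρ : Vec Tree n} {k} (f : Fin k → Fin n) {vs} → Vec.tabulate (Vec.lookup ρ ∘ f) ≡ vs →
           Semantics._⊢_⇓*_[_] P ρ (vars f) vs k
run-vars P {k = zero}  f refl = Semantics.[]
run-vars P {k = suc k} f refl = Semantics._∷_ Semantics.⇓var (run-vars P (f ∘ suc) refl)

-- Code combinators

infix 4 _∋_

data _∋_ : Ctx → Ty → Set where
  here  : ∀ {Γ a} → a ∷ Γ ∋ a
  there : ∀ {Γ a b} → Γ ∋ a → b ∷ Γ ∋ a

get : ∀ {Γ a} → Γ ∋ a → Env Γ → ⟦ a ⟧
get here      ρ = proj₁ ρ
get (there i) ρ = get i (proj₂ ρ)

index : ∀ {Γ a} → Γ ∋ a → Fin (length Γ)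
index here      = zero
index (there i) = suc (index i)

lookup-index : ∀ {Γ a} (i : Γ ∋ a) ρ → Vec.lookup (encs Γ ρ) (index i) ≡ enc a (get i ρ)
lookup-index here      ρ = refl
lookup-index (there i) ρ = lookup-index i (proj₂ ρ)

codeCong : ∀ {Γ f g} → f ≗ g → Code Γ f → Code Γ g
codeCong eq c = record
  { Ix = Ix c ; finite = finite c ; ar = ar c ; expr = expr c ; bodies = bodies c ; cost = cost c
  ; run = λ P ι fit ρ → subst (λ v → Within P _ _ v _) (eq ρ) (run c P ι fit ρ) }

codeVar : ∀ {Γ a} (i : Γ ∋ a) → Code Γ (enc a ∘ get i)
codeVar i = codeCong (lookup-index i) (record
  { Ix = ⊥ ; finite = fin⊥ ; ar = λ () ; expr = λ _ → var (index i) ; bodies = λ _ () ; cost = λ _ → 1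
  ; run = λ P ι fit ρ → 1 , Semantics.⇓var , ≤-refl })

codeNil : ∀ {Γ} → Code Γ (λ _ → nil)
codeNil = record
  { Ix = ⊥ ; finite = fin⊥ ; ar = λ () ; expr = λ _ → nil ; bodies = λ _ () ; cost = λ _ → 1
  ; run = λ P ι fit ρ → 1 , Semantics.⇓nil , ≤-refl }

codeCons : ∀ {Γ f g} → Code Γ f → Code Γ g → Code Γ (λ ρ → cons (f ρ) (g ρ))
codeCons c d = record
  { Ix = Ix c ⊎ Ix d ; finite = fin⊎ (finite c) (finite d) ; ar = ar c ⊎ᵃ ar d
  ; expr = λ ι → cons (expr c (ι ∘ inj₁)) (expr d (ι ∘ inj₂))
  ; bodies = ⊎-bodies (bodies c) (bodies d)
  ; cost = λ ρ → suc (cost c ρ + cost d ρ)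
  ; run = λ P ι fit ρ →
      let s , p , s≤ = run c P (ι ∘ inj₁) (fit ∘ inj₁) ρ
          t , q , t≤ = run d P (ι ∘ inj₂) (fit ∘ inj₂) ρ
      in suc (s + t) , Semantics.⇓cons p q , s≤s (+-mono-≤ s≤ t≤) }

codeLet : ∀ {Γ a} {x : Env Γ → ⟦ a ⟧} {f} → Code Γ (enc a ∘ x) → Code (a ∷ Γ) f → Code Γ (λ ρ → f (x ρ , ρ))
codeLet {x = x} c d = record
  { Ix = Ix c ⊎ Ix d ; finite = fin⊎ (finite c) (finite d) ; ar = ar c ⊎ᵃ ar d
  ; expr = λ ι → lett (expr c (ι ∘ inj₁)) (expr d (ι ∘ inj₂))
  ; bodies = ⊎-bodies (bodies c) (bodies d)
  ; cost = λ ρ → suc (cost c ρ + cost d (x ρ , ρ))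
  ; run = λ P ι fit ρ →
      let s , p , s≤ = run c P (ι ∘ inj₁) (fit ∘ inj₁) ρ
          t , q , t≤ = run d P (ι ∘ inj₂) (fit ∘ inj₂) (x ρ , ρ)
      in suc (s + t) , Semantics.⇓lett p q , s≤s (+-mono-≤ s≤ t≤) }

codePair : ∀ {Γ a b} {x : Env Γ → ⟦ a ⊗ b ⟧} {f} → Code Γ (enc (a ⊗ b) ∘ x) → Code (a ∷ b ∷ Γ) f →
           Code Γ (λ ρ → f (proj₁ (x ρ) , proj₂ (x ρ) , ρ))
codePair {x = x} c d = record
  { Ix = Ix c ⊎ Ix d ; finite = fin⊎ (finite c) (finite d) ; ar = ar c ⊎ᵃ ar d
  ; expr = λ ι → case (expr c (ι ∘ inj₁)) nil (expr d (ι ∘ inj₂))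
  ; bodies = ⊎-bodies (bodies c) (bodies d)
  ; cost = λ ρ → suc (cost c ρ + cost d (proj₁ (x ρ) , proj₂ (x ρ) , ρ))
  ; run = λ P ι fit ρ →
      let s , p , s≤ = run c P (ι ∘ inj₁) (fit ∘ inj₁) ρ
          t , q , t≤ = run d P (ι ∘ inj₂) (fit ∘ inj₂) (proj₁ (x ρ) , proj₂ (x ρ) , ρ)
      in suc (s + t) , Semantics.⇓case-cons p q , s≤s (+-mono-≤ s≤ t≤) }

caseList : ∀ {A B : Set} → List A → B → (A → List A → B) → B
caseList []       n c = n
caseList (x ∷ xs) n c = c x xs

codeCase : ∀ {Γ a} {x : Env Γ → ⟦ list a ⟧} {f g} → Code Γ (enc (list a) ∘ x) → Code Γ f →
           Code (a ∷ list a ∷ Γ) g → Code Γ (λ ρ → caseList (x ρ) (f ρ) (λ y ys → g (y , ys , ρ)))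
codeCase {Γ} {a} {x} {f} {g} c d e = record
  { Ix = Ix c ⊎ (Ix d ⊎ Ix e) ; finite = fin⊎ (finite c) (fin⊎ (finite d) (finite e))
  ; ar = ar c ⊎ᵃ (ar d ⊎ᵃ ar e)
  ; expr = λ ι → case (expr c (ι ∘ inj₁)) (expr d (ι ∘ inj₂ ∘ inj₁)) (expr e (ι ∘ inj₂ ∘ inj₂))
  ; bodies = ⊎-bodies (bodies c) (⊎-bodies (bodies d) (bodies e))
  ; cost = λ ρ → suc (cost c ρ + caseList (x ρ) (cost d ρ) (λ y ys → cost e (y , ys , ρ)))
  ; run = λ P ι fit ρ → branch P ι fit ρ (x ρ) (run c P (ι ∘ inj₁) (fit ∘ inj₁) ρ) }
  where
  branch : ∀ P (ι : Link (ar c ⊎ᵃ (ar d ⊎ᵃ ar e)) (Program.arity P)) →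
           Fits P ι (⊎-bodies (bodies c) (⊎-bodies (bodies d) (bodies e))) → ∀ ρ (l : ⟦ list a ⟧) →
           Within P (encs Γ ρ) (expr c (ι ∘ inj₁)) (enc (list a) l) (cost c ρ) →
           Within P (encs Γ ρ) (case (expr c (ι ∘ inj₁)) (expr d (ι ∘ inj₂ ∘ inj₁)) (expr e (ι ∘ inj₂ ∘ inj₂)))
                  (caseList l (f ρ) (λ y ys → g (y , ys , ρ)))
                  (suc (cost c ρ + caseList l (cost d ρ) (λ y ys → cost e (y , ys , ρ))))
  branch P ι fit ρ [] (s , p , s≤) =
    let t , q , t≤ = run d P (ι ∘ inj₂ ∘ inj₁) (fit ∘ inj₂ ∘ inj₁) ρ
    in suc (s + t) , Semantics.⇓case-nil p q , s≤s (+-mono-≤ s≤ t≤)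
  branch P ι fit ρ (y ∷ ys) (s , p , s≤) =
    let t , q , t≤ = run e P (ι ∘ inj₂ ∘ inj₂) (fit ∘ inj₂ ∘ inj₂) (y , ys , ρ)
    in suc (s + t) , Semantics.⇓case-cons p q , s≤s (+-mono-≤ s≤ t≤)

infixr 5 _∷_

data Vars (Γ : Ctx) : Ctx → Set where
  []  : Vars Γ []
  _∷_ : ∀ {a Δ} → Γ ∋ a → Vars Γ Δ → Vars Γ (a ∷ Δ)

gets : ∀ {Γ Δ} → Vars Γ Δ → Env Γ → Env Δ
gets []       ρ = tt
gets (i ∷ is) ρ = get i ρ , gets is ρ

indices : ∀ {Γ Δ} → Vars Γ Δ → Fin (length Δ) → Fin (length Γ)
indices (i ∷ is) zero    = index i
indices (i ∷ is) (suc k) = indices is k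

tabulate-indices : ∀ {Γ Δ} (is : Vars Γ Δ) ρ → Vec.tabulate (Vec.lookup (encs Γ ρ) ∘ indices is) ≡ encs Δ (gets is ρ)
tabulate-indices []       ρ = refl
tabulate-indices (i ∷ is) ρ = cong₂ _∷_ (lookup-index i ρ) (tabulate-indices is ρ)

Own : {I : Set} → ℕ → (I → ℕ) → ⊤ ⊎ I → ℕ
Own n ar = (λ _ → n) ⊎ᵃ ar

own-bodies : ∀ {I n} {ar : I → ℕ} → (∀ {m} {arity : Fin m → ℕ} → Link (Own n ar) arity → Expr arity n) →
             Bodies ar → Bodies (Own n ar)
own-bodies e b ι (inj₁ _) = e ι
own-bodies e b ι (inj₂ j) = b (ι ∘ inj₂) j

-- A change of context is a call: the old code becomes the body of a new function, and the selected
-- variables are its arguments. This replaces any renaming of expressions, at the price of one step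
-- per variable and one for the call.
codeRename : ∀ {Γ Δ f} → Code Δ f → (is : Vars Γ Δ) → Code Γ (f ∘ gets is)
codeRename {Γ} {Δ} c is = record
  { Ix = ⊤ ⊎ Ix c ; finite = fin⊎ fin⊤ (finite c) ; ar = Own (length Δ) (ar c)
  ; expr = λ ι → callAt (ι (inj₁ tt)) (vars (indices is))
  ; bodies = own-bodies (λ ι → expr c (ι ∘ inj₂)) (bodies c)
  ; cost = λ ρ → suc (length Δ + cost c (gets is ρ))
  ; run = λ P ι fit ρ → run-callAt P (ι (inj₁ tt)) (fit (inj₁ tt))
      (run-vars P (indices is) (tabulate-indices is ρ)) (run c P (ι ∘ inj₂) (fit ∘ inj₂) (gets is ρ)) }

para : ∀ {A B : Set} → (B → A → List A → B) → B → List A → B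
para s z []       = z
para s z (x ∷ xs) = s (para s z xs) x xs

-- The steps taken by the loop that codePara produces, where c counts those of
-- one evaluation of the step.
loopCost : ∀ {A B : Set} → ℕ → (List A → B) → (B → A → List A → ℕ) → List A → ℕ
loopCost n rec c []       = 3
loopCost n rec c (x ∷ xs) = suc (1 + suc (suc (1 + (1 + n) + loopCost n rec c xs) + c (rec xs) x xs))

codePara : ∀ {Γ a b} {l : Env Γ → ⟦ list a ⟧} {z : Env Γ → ⟦ b ⟧} {s : Env (b ∷ a ∷ list a ∷ Γ) → ⟦ b ⟧} →
           Code Γ (enc (list a) ∘ l) → Code Γ (enc b ∘ z) →
           Code (b ∷ a ∷ list a ∷ list a ∷ b ∷ Γ) (λ (r , x , xs , _ , _ , ρ) → enc b (s (r , x , xs , ρ))) →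
           Code Γ (λ ρ → enc b (para (λ r x xs → s (r , x , xs , ρ)) (z ρ) (l ρ)))
codePara {Γ} {a} {b} {l} {z} {s} cl cz cs = record
  { Ix = ⊤ ⊎ (Ix cl ⊎ (Ix cz ⊎ Ix cs)) ; finite = fin⊎ fin⊤ (fin⊎ (finite cl) (fin⊎ (finite cz) (finite cs)))
  ; ar = Own (2 + length Γ) (ar cl ⊎ᵃ (ar cz ⊎ᵃ ar cs))
  ; expr = λ ι → callAt (ι (inj₁ tt)) (expr cl (ι ∘ inj₂ ∘ inj₁) ∷ expr cz (ι ∘ inj₂ ∘ inj₂ ∘ inj₁) ∷ vars id)
  ; bodies = loop-bodies
  ; cost = λ ρ → suc (cost cl ρ + (cost cz ρ + length Γ) + loop-cost ρ (l ρ))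
  ; run = λ P ι fit ρ →
      let s , p , s≤ = run cl P (ι ∘ inj₂ ∘ inj₁) (fit ∘ inj₂ ∘ inj₁) ρ
          t , q , t≤ = run cz P (ι ∘ inj₂ ∘ inj₂ ∘ inj₁) (fit ∘ inj₂ ∘ inj₂ ∘ inj₁) ρ
          u , d , u≤ = run-callAt P (ι (inj₁ tt)) (fit (inj₁ tt))
                         (Semantics._∷_ p (Semantics._∷_ q (run-vars P id (tabulate∘lookup (encs Γ ρ)))))
                         (loop P ι fit ρ (l ρ))
      in u , d , ≤-trans u≤ (s≤s (+-monoˡ-≤ _ (+-mono-≤ s≤ (+-monoˡ-≤ _ t≤)))) }
  where
  outer : Fin (length Γ) → Fin (4 + length Γ)
  outer i = suc (suc (suc (suc i)))
  loop-bodies : Bodies (Own (2 + length Γ) (ar cl ⊎ᵃ (ar cz ⊎ᵃ ar cs)))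
  loop-bodies = own-bodies
    (λ ι → case (var zero) (var (suc zero))
      (lett (callAt (ι (inj₁ tt)) (var (suc zero) ∷ var (suc (suc (suc zero))) ∷ vars outer))
            (expr cs (ι ∘ inj₂ ∘ inj₂ ∘ inj₂))))
    (⊎-bodies (bodies cl) (⊎-bodies (bodies cz) (bodies cs)))
  rec : Env Γ → List ⟦ a ⟧ → ⟦ b ⟧
  rec ρ = para (λ r x xs → s (r , x , xs , ρ)) (z ρ)
  loop-cost : Env Γ → List ⟦ a ⟧ → ℕ
  loop-cost ρ = loopCost (length Γ) (rec ρ) (λ r x xs → cost cs (r , x , xs , x ∷ xs , z ρ , ρ))
  loop : ∀ P ι → Fits P ι loop-bodies → ∀ ρ xs →
         Within P (enc (list a) xs ∷ enc b (z ρ) ∷ encs Γ ρ) (loop-bodies ι (inj₁ tt)) (enc b (rec ρ xs))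
             (loop-cost ρ xs)
  loop P ι fit ρ []       = 3 , Semantics.⇓case-nil Semantics.⇓var Semantics.⇓var , ≤-refl
  loop P ι fit ρ (x ∷ xs) =
    let s , p , s≤ = run-callAt P (ι (inj₁ tt)) (fit (inj₁ tt))
                       (Semantics._∷_ Semantics.⇓var (Semantics._∷_ Semantics.⇓var
                         (run-vars P outer (tabulate∘lookup (encs Γ ρ)))))
                       (loop P ι fit ρ xs)
        t , q , t≤ = run cs P (ι ∘ inj₂ ∘ inj₂ ∘ inj₂) (fit ∘ inj₂ ∘ inj₂ ∘ inj₂)
                       (rec ρ xs , x , xs , x ∷ xs , z ρ , ρ)
    in suc (1 + suc (s + t)) , Semantics.⇓case-cons Semantics.⇓var (Semantics.⇓lett p q)
     , s≤s (s≤s (s≤s (+-mono-≤ s≤ t≤)))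

program : ∀ {a f} → Code (a ∷ []) f → Program
program c = record { arity = ar c ∘ from ; body = λ k → bodies c own (from k) ; main = expr c own }
  where
  open Finite (finite c)
  own : Link (ar c) (ar c ∘ from)
  own i = to i , cong (ar c) (from-to i)

program-runs : ∀ {a f} (c : Code (a ∷ []) f) (x : ⟦ a ⟧) →
               ∃[ t ] (Runs (program c) (enc a x) (f (x , tt)) t × t ≤ cost c (x , tt))
program-runs c x = run c (program c) _ (λ i → lemma (from-to i)) (x , tt)
  where
  open Finite (finite c)
  own : Link (ar c) (ar c ∘ from)
  own i = to i , cong (ar c) (from-to i)
  lemma : ∀ {i j} (eq : i ≡ j) → subst (Expr _) (cong (ar c) eq) (bodies c own i) ≡ bodies c own j
  lemma refl = refl

-- PT stands for polynomial time; bounding the output as well makes PT closed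
-- under composition.
record PT (Γ : Ctx) (a : Ty) (f : Env Γ → ⟦ a ⟧) : Set₁ where
  field
    code  : Code Γ (enc a ∘ f)
    bound : Poly
    time≤ : ∀ ρ → cost code ρ ≤ eval bound (szs Γ ρ)
    size≤ : ∀ ρ → sz a (f ρ) ≤ eval bound (szs Γ ρ)

open PT

-- Types with a common encoding are interchangeable at no cost. In this way Booleans and numbers are
-- handled as lists of units, so that case distinction and recursion are needed for lists only.
castP : ∀ {Γ a b f g} → PT Γ a f → (∀ ρ → enc a (f ρ) ≡ enc b (g ρ)) → PT Γ b g
castP p eq = record
  { code = codeCong eq (code p) ; bound = bound p ; time≤ = time≤ p
  ; size≤ = λ ρ → subst (λ t → size t ≤ _) (eq ρ) (size≤ p ρ) }

congP : ∀ {Γ a f g} → PT Γ a f → f ≗ g → PT Γ a g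
congP {a = a} p eq = castP p (λ ρ → cong (enc a) (eq ρ))

1≤size : ∀ t → 1 ≤ size t
1≤size nil        = s≤s z≤n
1≤size (cons _ _) = s≤s z≤n

sz-get : ∀ {Γ a} (i : Γ ∋ a) ρ → sz a (get i ρ) ≤ szs Γ ρ
sz-get here      ρ = m≤m+n _ _
sz-get (there i) ρ = ≤-trans (sz-get i (proj₂ ρ)) (m≤n+m _ _)

sz-gets : ∀ {Γ Δ} (is : Vars Γ Δ) ρ → szs Δ (gets is ρ) ≤ length Δ * szs Γ ρ
sz-gets []       ρ = z≤n
sz-gets (i ∷ is) ρ = +-mono-≤ (sz-get i ρ) (sz-gets is ρ)

varP : ∀ {Γ a} (i : Γ ∋ a) → PT Γ a (get i)
varP {Γ} {a} i = record
  { code = codeVar i ; bound = X ; time≤ = λ ρ → ≤-trans (1≤size (enc a (get i ρ))) (sz-get i ρ)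
  ; size≤ = sz-get i }

ttP : ∀ {Γ} → PT Γ unit (λ _ → tt)
ttP = record { code = codeNil ; bound = con 1 ; time≤ = λ _ → ≤-refl ; size≤ = λ _ → ≤-refl }

nilP : ∀ {Γ a} → PT Γ (list a) (λ _ → [])
nilP = record { code = codeNil ; bound = con 1 ; time≤ = λ _ → ≤-refl ; size≤ = λ _ → ≤-refl }

consP : ∀ {Γ a f g} → PT Γ a f → PT Γ (list a) g → PT Γ (list a) (λ ρ → f ρ ∷ g ρ)
consP p q = record
  { code = codeCons (code p) (code q) ; bound = con 1 ⊕ (bound p ⊕ bound q)
  ; time≤ = λ ρ → s≤s (+-mono-≤ (time≤ p ρ) (time≤ q ρ))
  ; size≤ = λ ρ → s≤s (+-mono-≤ (size≤ p ρ) (size≤ q ρ)) }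

infixr 4 _,P_

_,P_ : ∀ {Γ a b f g} → PT Γ a f → PT Γ b g → PT Γ (a ⊗ b) (λ ρ → f ρ , g ρ)
p ,P q = record
  { code = codeCons (code p) (code q) ; bound = con 1 ⊕ (bound p ⊕ bound q)
  ; time≤ = λ ρ → s≤s (+-mono-≤ (time≤ p ρ) (time≤ q ρ))
  ; size≤ = λ ρ → s≤s (+-mono-≤ (size≤ p ρ) (size≤ q ρ)) }

letP : ∀ {Γ a b x f} → PT Γ a x → PT (a ∷ Γ) b f → PT Γ b (λ ρ → f (x ρ , ρ))
letP p q = record
  { code = codeLet (code p) (code q) ; bound = con 1 ⊕ (bound p ⊕ bound q ⊚ (bound p ⊕ X))
  ; time≤ = λ ρ → s≤s (+-mono-≤ (time≤ p ρ) (≤-trans (time≤ q _) (inner ρ)))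
  ; size≤ = λ ρ → m≤n⇒m≤1+n (≤-trans (≤-trans (size≤ q _) (inner ρ)) (m≤n+m _ _)) }
  where
  inner = λ ρ → eval-mono (bound q) (+-monoˡ-≤ (szs _ ρ) (size≤ p ρ))

splitP : ∀ {Γ a b c x f} → PT Γ (a ⊗ b) x → PT (a ∷ b ∷ Γ) c f → PT Γ c (λ ρ → f (proj₁ (x ρ) , proj₂ (x ρ) , ρ))
splitP {Γ} {a} {b} {x = x} p q = record
  { code = codePair (code p) (code q) ; bound = con 1 ⊕ (bound p ⊕ bound q ⊚ (bound p ⊕ X))
  ; time≤ = λ ρ → s≤s (+-mono-≤ (time≤ p ρ) (≤-trans (time≤ q _) (inner ρ)))
  ; size≤ = λ ρ → m≤n⇒m≤1+n (≤-trans (≤-trans (size≤ q _) (inner ρ)) (m≤n+m _ _)) }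
  where
  inner : ∀ ρ → eval (bound q) (szs (a ∷ b ∷ Γ) (proj₁ (x ρ) , proj₂ (x ρ) , ρ)) ≤ eval (bound q ⊚ (bound p ⊕ X))
      (szs Γ ρ)
  inner ρ = eval-mono (bound q) (≤-trans (≤-reflexive (sym (+-assoc (sz a (proj₁ (x ρ))) _ _)))
              (+-monoˡ-≤ (szs Γ ρ) (≤-trans (n≤1+n _) (size≤ p ρ))))

caseP : ∀ {Γ a b x f g} → PT Γ (list a) x → PT Γ b f → PT (a ∷ list a ∷ Γ) b g →
        PT Γ b (λ ρ → caseList (x ρ) (f ρ) (λ y ys → g (y , ys , ρ)))
caseP {Γ} {a} {b} {x} {f} {g} p q r = record
  { code = codeCong (λ ρ → enc-case (x ρ)) (codeCase {x = x} (code p) (code q) (code r))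
  ; bound = con 1 ⊕ (bound p ⊕ (bound q ⊕ bound r ⊚ (bound p ⊕ X)))
  ; time≤ = λ ρ → s≤s (+-mono-≤ (time≤ p ρ) (time-branch ρ (x ρ) (size≤ p ρ)))
  ; size≤ = λ ρ → m≤n⇒m≤1+n (≤-trans (size-branch ρ (x ρ) (size≤ p ρ)) (m≤n+m _ (eval (bound p) (szs Γ ρ)))) }
  where
  enc-case : ∀ {A : Set} {n : ⟦ b ⟧} {c} (l : List A) → caseList l (enc b n) (λ y ys → enc b (c y ys)) ≡ enc b
      (caseList l n c)
  enc-case []       = refl
  enc-case (y ∷ ys) = refl
  inner : ∀ ρ y ys → sz (list a) (y ∷ ys) ≤ eval (bound p) (szs Γ ρ) →
          eval (bound r) (szs (a ∷ list a ∷ Γ) (y , ys , ρ)) ≤ eval (bound r ⊚ (bound p ⊕ X)) (szs Γ ρ)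
  inner ρ y ys h = eval-mono (bound r) (≤-trans (≤-reflexive (sym (+-assoc (sz a y) _ _)))
                     (+-monoˡ-≤ (szs Γ ρ) (≤-trans (n≤1+n _) h)))
  time-branch : ∀ ρ l → sz (list a) l ≤ eval (bound p) (szs Γ ρ) →
                caseList l (cost (code q) ρ) (λ y ys → cost (code r) (y , ys , ρ)) ≤
                eval (bound q ⊕ bound r ⊚ (bound p ⊕ X)) (szs Γ ρ)
  time-branch ρ []       h = ≤-trans (time≤ q ρ) (m≤m+n _ _)
  time-branch ρ (y ∷ ys) h = ≤-trans (≤-trans (time≤ r _) (inner ρ y ys h)) (m≤n+m _ _)
  size-branch : ∀ ρ l → sz (list a) l ≤ eval (bound p) (szs Γ ρ) →
                sz b (caseList l (f ρ) (λ y ys → g (y , ys , ρ))) ≤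
                eval (bound q ⊕ bound r ⊚ (bound p ⊕ X)) (szs Γ ρ)
  size-branch ρ []       h = ≤-trans (size≤ q ρ) (m≤m+n _ _)
  size-branch ρ (y ∷ ys) h = ≤-trans (≤-trans (size≤ r _) (inner ρ y ys h)) (m≤n+m _ _)

renameP : ∀ {Γ Δ a f} → PT Δ a f → (is : Vars Γ Δ) → PT Γ a (f ∘ gets is)
renameP {Γ} {Δ} p is = record
  { code = codeRename (code p) is
  ; bound = con 1 ⊕ (con (length Δ) ⊕ bound p ⊚ (con (length Δ) ⊛ X))
  ; time≤ = λ ρ → s≤s (+-monoʳ-≤ (length Δ) (≤-trans (time≤ p _) (eval-mono (bound p) (sz-gets is ρ))))
  ; size≤ = λ ρ → m≤n⇒m≤1+n (≤-trans (≤-trans (size≤ p _) (eval-mono (bound p) (sz-gets is ρ))) (m≤n+m _ _)) }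

shift : ∀ {Γ Δ b} → Vars Γ Δ → Vars (b ∷ Γ) Δ
shift []       = []
shift (i ∷ is) = there i ∷ shift is

gets-shift : ∀ {Γ Δ b} (is : Vars Γ Δ) (ρ : Env (b ∷ Γ)) → gets (shift is) ρ ≡ gets is (proj₂ ρ)
gets-shift []       ρ = refl
gets-shift (i ∷ is) ρ = cong (_ ,_) (gets-shift is ρ)

allVars : ∀ Γ → Vars Γ Γ
allVars []      = []
allVars (a ∷ Γ) = here ∷ shift (allVars Γ)

gets-all : ∀ Γ ρ → gets (allVars Γ) ρ ≡ ρ
gets-all []      ρ       = refl
gets-all (a ∷ Γ) (x , ρ) = cong (x ,_) (trans (gets-shift (allVars Γ) _) (gets-all Γ ρ))

wk : ∀ {Γ a b f} → PT Γ a f → PT (b ∷ Γ) a (f ∘ proj₂)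
wk {Γ} {f = f} p = congP (renameP p (shift (allVars Γ)))
  (λ ρ → cong f (trans (gets-shift (allVars Γ) ρ) (gets-all Γ (proj₂ ρ))))

wk₁ : ∀ {Γ a c b f} → PT (c ∷ Γ) a f → PT (c ∷ b ∷ Γ) a (λ (x , _ , ρ) → f (x , ρ))
wk₁ {Γ} {f = f} p = congP (renameP p (here ∷ shift (shift (allVars Γ))))
  (λ (x , y , ρ) → cong (λ σ → f (x , σ)) (trans (gets-shift (shift (allVars Γ)) _)
    (trans (gets-shift (allVars Γ) _) (gets-all Γ ρ))))

wk₃ : ∀ {Γ a c d e b f} → PT (c ∷ d ∷ e ∷ Γ) a f → PT (c ∷ d ∷ e ∷ b ∷ Γ) a (λ (x , y , z , _ , ρ) → f (x , y , z , ρ))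
wk₃ {Γ} {f = f} p = congP (renameP p (here ∷ there here ∷ there (there here) ∷ shift
    (shift (shift (shift (allVars Γ))))))
  (λ (x , y , z , w , ρ) → cong (λ σ → f (x , y , z , σ))
    (trans (gets-shift (shift (shift (shift (allVars Γ)))) _) (trans (gets-shift (shift (shift (allVars Γ))) _)
      (trans (gets-shift (shift (allVars Γ)) _) (trans (gets-shift (allVars Γ) _) (gets-all Γ ρ))))))

-- A round costs n + 6 steps besides the step proper, and there are fewer rounds than nodes in the
-- encoding of the list.
loopCost≤ : ∀ {a} {B : Set} n (rec : List ⟦ a ⟧ → B) c M C →
            (∀ x xs → sz (list a) (x ∷ xs) ≤ M → c (rec xs) x xs ≤ C) →
            ∀ xs → sz (list a) xs ≤ M → loopCost n rec c xs ≤ 3 + sz (list a) xs * (n + C + 6)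
loopCost≤ n rec c M C h [] _ = m≤m+n 3 _
loopCost≤ {a} n rec c M C h (x ∷ xs) xs≤M =
  ≤-by (loopCost n rec c (x ∷ xs)) (3 + sz (list a) (x ∷ xs) * (n + C + 6)) (sz a x * (n + C + 6))
    (+-mono-≤ (h x xs xs≤M) (loopCost≤ n rec c M C h xs (≤-trans (≤-trans (m≤n+m _ (sz a x)) (n≤1+n _)) xs≤M)))
    (lemma n C (c (rec xs) x xs) (loopCost n rec c xs) (sz a x) (sz (list a) xs))
  where
  lemma : ∀ n C d l x xs → 3 + suc (x + xs) * (n + C + 6) + (d + l) ≡
          suc (1 + suc (suc (1 + (1 + n) + l) + d)) + (C + (3 + xs * (n + C + 6))) + x * (n + C + 6)
  lemma = solve-∀

-- Polynomial time is not closed under recursion: a step that doubles its accumulator is cheap, but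
-- its iteration is not. The last hypothesis therefore bounds every intermediate result, and with it
-- the cost of each round.
paraP : ∀ {Γ a b l z} {s : Env (b ∷ a ∷ list a ∷ Γ) → ⟦ b ⟧} → PT Γ (list a) l → PT Γ b z →
        PT (b ∷ a ∷ list a ∷ Γ) b s → (q : Poly) →
        (∀ ρ xs → sz b (para (λ r x xs → s (r , x , xs , ρ)) (z ρ) xs) ≤ eval q (sz (list a) xs + szs Γ ρ)) →
        PT Γ b (λ ρ → para (λ r x xs → s (r , x , xs , ρ)) (z ρ) (l ρ))
paraP {Γ} {a} {b} {l} {z} {s} pl pz ps q hq = record
  { code = codePara {l = l} {z} {s} (code pl) (code pz) (code ps′)
  ; bound = con 1 ⊕ (bound pl ⊕ (bound pz ⊕ con (length Γ)) ⊕
              (con 3 ⊕ bound pl ⊛ (con (length Γ) ⊕ step ⊕ con 6))) ⊕ acc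
  ; time≤ = λ ρ → ≤-trans (s≤s (+-mono-≤ (+-mono-≤ (time≤ pl ρ) (+-monoˡ-≤ _ (time≤ pz ρ)))
      (≤-trans (loopCost≤ {a} (length Γ) (para (λ r x xs → s (r , x , xs , ρ)) (z ρ))
          (λ r x xs → cost (code ps′) (r , x , xs , x ∷ xs , z ρ , ρ)) (eval (bound pl) (szs Γ ρ))
          (eval step (szs Γ ρ)) (step≤ ρ) (l ρ) (size≤ pl ρ)) (+-monoʳ-≤ 3 (*-monoˡ-≤ _ (size≤ pl ρ))))))
      (m≤m+n _ _)
  ; size≤ = λ ρ → ≤-trans (≤-trans (hq ρ (l ρ)) (eval-mono q (+-monoˡ-≤ _ (size≤ pl ρ)))) (m≤n+m _ _) }
  where
  ps′ = wk₃ {b = list a} (wk₃ {b = b} ps)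
  acc = q ⊚ (bound pl ⊕ X)
  step = bound ps′ ⊚ (acc ⊕ (bound pl ⊕ (bound pl ⊕ (bound pl ⊕ (bound pz ⊕ X)))))
  step≤ : ∀ ρ x xs → sz (list a) (x ∷ xs) ≤ eval (bound pl) (szs Γ ρ) →
          cost (code ps′) (para (λ r x xs → s (r , x , xs , ρ)) (z ρ) xs , x , xs , x ∷ xs , z ρ , ρ) ≤
          eval step (szs Γ ρ)
  step≤ ρ x xs h = ≤-trans (time≤ ps′ _) (eval-mono (bound ps′)
    (+-mono-≤ (≤-trans (hq ρ xs) (eval-mono q (+-monoˡ-≤ (szs Γ ρ) xs≤)))
    (+-mono-≤ x≤ (+-mono-≤ xs≤ (+-mono-≤ h (+-monoˡ-≤ (szs Γ ρ) (size≤ pz ρ)))))))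
    where
    xs≤ : sz (list a) xs ≤ eval (bound pl) (szs Γ ρ)
    xs≤ = ≤-trans (≤-trans (m≤n+m _ (sz a x)) (n≤1+n _)) h
    x≤ : sz a x ≤ eval (bound pl) (szs Γ ρ)
    x≤ = ≤-trans (≤-trans (m≤m+n _ (sz (list a) xs)) (n≤1+n _)) h

ifP : ∀ {Γ a c f g} → PT Γ bool c → PT Γ a f → PT Γ a g → PT Γ a (λ ρ → if c ρ then f ρ else g ρ)
ifP {Γ} {a} {c} {f} {g} pc pf pg = congP (caseP (castP {b = list unit} {g = list-of ∘ c} pc (λ ρ → enc-bool (c ρ)))
    pg (wk (wk pf))) (λ ρ → branch (c ρ))
  where
  list-of : Bool → List ⊤
  list-of b = if b then tt ∷ [] else []
  enc-bool : ∀ b → enc bool b ≡ enc (list unit) (list-of b)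
  enc-bool true  = refl
  enc-bool false = refl
  branch : ∀ {A : Set} {x y : A} b → caseList (list-of b) y (λ _ _ → x) ≡ (if b then x else y)
  branch true  = refl
  branch false = refl

falseP : ∀ {Γ} → PT Γ bool (λ _ → false)
falseP = castP {a = unit} ttP (λ _ → refl)

trueP : ∀ {Γ} → PT Γ bool (λ _ → true)
trueP = castP {a = list unit} (consP ttP nilP) (λ _ → refl)

notP : ∀ {Γ f} → PT Γ bool f → PT Γ bool (not ∘ f)
notP {f = f} p = congP (ifP p falseP trueP) (λ ρ → lemma (f ρ))
  where
  lemma : ∀ b → (if b then false else true) ≡ not b
  lemma true  = refl
  lemma false = refl

infixr 6 _∧P_
infixr 5 _∨P_

_∧P_ : ∀ {Γ f g} → PT Γ bool f → PT Γ bool g → PT Γ bool (λ ρ → f ρ ∧ g ρ)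
_∧P_ {f = f} {g} p q = congP (ifP p q falseP) (λ ρ → lemma (f ρ))
  where
  lemma : ∀ a {b} → (if a then b else false) ≡ a ∧ b
  lemma true  = refl
  lemma false = refl

_∨P_ : ∀ {Γ f g} → PT Γ bool f → PT Γ bool g → PT Γ bool (λ ρ → f ρ ∨ g ρ)
_∨P_ {f = f} {g} p q = congP (ifP p trueP q) (λ ρ → lemma (f ρ))
  where
  lemma : ∀ a {b} → (if a then true else b) ≡ a ∨ b
  lemma true  = refl
  lemma false = refl

para-cong : ∀ {A B : Set} {s : B → A → List A → B} {f : List A → B} →
            (∀ x xs → s (f xs) x xs ≡ f (x ∷ xs)) → ∀ xs → para s (f []) xs ≡ f xs
para-cong h []       = refl
para-cong {s = s} {f} h (x ∷ xs) = trans (cong (λ r → s r x xs) (para-cong {s = s} {f} h xs)) (h x xs)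

sz-bool : ∀ b → sz bool b ≤ 3
sz-bool true  = ≤-refl
sz-bool false = s≤s z≤n

paraBool : ∀ {Γ a l z} {s : Env (bool ∷ a ∷ list a ∷ Γ) → Bool} → PT Γ (list a) l → PT Γ bool z →
           PT (bool ∷ a ∷ list a ∷ Γ) bool s →
           PT Γ bool (λ ρ → para (λ r x xs → s (r , x , xs , ρ)) (z ρ) (l ρ))
paraBool pl pz ps = paraP pl pz ps (con 3) (λ ρ xs → sz-bool _)

sz-tail : ∀ {a} (x : ⟦ a ⟧) xs → sz (list a) xs ≤ sz (list a) (x ∷ xs)
sz-tail {a} x xs = ≤-trans (m≤n+m _ (sz a x)) (n≤1+n _)

para-growth : ∀ {a b N} {s : ⟦ b ⟧ → ⟦ a ⟧ → List ⟦ a ⟧ → ⟦ b ⟧} {z} (q : Poly) xs →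
              (∀ r x ys → sz (list a) (x ∷ ys) ≤ sz (list a) xs → sz b (s r x ys) ≤ sz b r + eval q N) →
              sz b (para s z xs) ≤ sz b z + sz (list a) xs * eval q N
para-growth q []       h = m≤m+n _ _
para-growth {a} {b} {N} {s} {z} q (x ∷ xs) h =
  ≤-by (sz b (para s z (x ∷ xs))) (sz b z + sz (list a) (x ∷ xs) * eval q N) (sz a x * eval q N)
    (+-mono-≤ (h (para s z xs) x xs ≤-refl)
              (para-growth {a} {b} {N} {s} {z} q xs (λ r y ys le → h r y ys (≤-trans le (sz-tail {a} x xs)))))
    (lemma (sz b z) (sz a x) (sz (list a) xs) (eval q N) (sz b (para s z (x ∷ xs))) (sz b (para s z xs)))
  where
  lemma : ∀ z x l e p r → z + suc (x + l) * e + (p + r) ≡ p + (r + e + (z + l * e)) + x * e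
  lemma = solve-∀

-- If a round enlarges the accumulator by an amount that depends on the input only, the intermediate
-- results are bounded by the number of rounds times that amount, so the growth condition of `paraP`
-- is met.
paraAdd : ∀ {Γ a b l z} {s : Env (b ∷ a ∷ list a ∷ Γ) → ⟦ b ⟧} → PT Γ (list a) l → PT Γ b z →
          PT (b ∷ a ∷ list a ∷ Γ) b s → (q : Poly) →
          (∀ r x xs ρ → sz b (s (r , x , xs , ρ)) ≤ sz b r + eval q (sz (list a) (x ∷ xs) + szs Γ ρ)) →
          PT Γ b (λ ρ → para (λ r x xs → s (r , x , xs , ρ)) (z ρ) (l ρ))
paraAdd {Γ} {a} {b} {l} {z} pl pz ps q h = paraP pl pz ps (bound pz ⊕ X ⊛ q) λ ρ xs →
  ≤-trans (para-growth {a} {b} {sz (list a) xs + szs Γ ρ} q xs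
            (λ r x ys le → ≤-trans (h r x ys ρ) (+-monoʳ-≤ _ (eval-mono q (+-monoˡ-≤ _ le)))))
          (+-mono-≤ (≤-trans (size≤ pz ρ) (eval-mono (bound pz) (m≤n+m _ _)))
                    (*-monoˡ-≤ (eval q (sz (list a) xs + szs Γ ρ)) (m≤m+n (sz (list a) xs) (szs Γ ρ))))

sz-head : ∀ {a} (x : ⟦ a ⟧) xs n → sz a x + n ≤ sz (list a) (x ∷ xs) + n
sz-head {a} x xs n = +-monoˡ-≤ n (≤-trans (m≤m+n _ (sz (list a) xs)) (n≤1+n _))

-- Lists

under : ∀ {Γ a b c f} → PT (a ∷ Γ) b f → PT (c ∷ a ∷ list a ∷ Γ) b (λ (_ , x , _ , ρ) → f (x , ρ))
under p = wk (wk₁ p)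

anyP : ∀ {Γ a f l} → PT (a ∷ Γ) bool f → PT Γ (list a) l → PT Γ bool (λ ρ → any (λ x → f (x , ρ)) (l ρ))
anyP {f = f} {l} pf pl = congP (paraBool pl falseP (under pf ∨P varP here))
  (λ ρ → para-cong {f = any (λ x → f (x , ρ))} (λ _ _ → refl) (l ρ))

allP : ∀ {Γ a f l} → PT (a ∷ Γ) bool f → PT Γ (list a) l → PT Γ bool (λ ρ → all (λ x → f (x , ρ)) (l ρ))
allP {f = f} {l} pf pl = congP (paraBool pl trueP (under pf ∧P varP here))
  (λ ρ → para-cong {f = all (λ x → f (x , ρ))} (λ _ _ → refl) (l ρ))

filterᵇ-∷ : ∀ {A : Set} (p : A → Bool) x xs → filterᵇ p (x ∷ xs) ≡ (if p x then x ∷ filterᵇ p xs else filterᵇ p xs)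
filterᵇ-∷ p x xs with p x
... | true  = refl
... | false = refl

filterP : ∀ {Γ a f l} → PT (a ∷ Γ) bool f → PT Γ (list a) l → PT Γ (list a) (λ ρ → filterᵇ (λ x → f (x , ρ)) (l ρ))
filterP {Γ} {a} {f} {l} pf pl = congP
  (paraAdd pl nilP (ifP (under pf) (consP (varP (there here)) (varP here)) (varP here)) (con 1 ⊕ X)
    (λ r x xs ρ → growth r x xs ρ (f (x , ρ))))
  (λ ρ → para-cong {f = filterᵇ (λ x → f (x , ρ))} (λ x xs → sym (filterᵇ-∷ (λ y → f (y , ρ)) x xs)) (l ρ))
  where
  growth : ∀ r x xs ρ b → sz (list a) (if b then x ∷ r else r) ≤ sz (list a) r + suc (sz (list a) (x ∷ xs) + szs Γ ρ)
  growth r x xs ρ true  = ≤-trans (≤-reflexive (+-comm (suc (sz a x)) _))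
    (+-monoʳ-≤ (sz (list a) r) (s≤s (≤-trans (m≤m+n _ _) (sz-head {a} x xs (szs Γ ρ)))))
  growth r x xs ρ false = m≤m+n _ _

mapP : ∀ {Γ a b f l} → PT (a ∷ Γ) b f → PT Γ (list a) l → PT Γ (list b) (λ ρ → map (λ x → f (x , ρ)) (l ρ))
mapP {Γ} {a} {b} {f} {l} pf pl = congP
  (paraAdd pl nilP (consP (under pf) (varP here)) (con 1 ⊕ bound pf)
    (λ r x xs ρ → ≤-trans (≤-reflexive (+-comm (suc (sz b (f (x , ρ)))) _))
        (+-monoʳ-≤ (sz (list b) r) (s≤s (≤-trans (size≤ pf (x , ρ))
        (eval-mono (bound pf) (sz-head {a} x xs (szs Γ ρ))))))))
  (λ ρ → para-cong {f = map (λ x → f (x , ρ))} (λ _ _ → refl) (l ρ))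

sz-++ : ∀ {a} (xs ys : List ⟦ a ⟧) → sz (list a) (xs ++ ys) ≤ sz (list a) xs + sz (list a) ys
sz-++ []       ys = n≤1+n _
sz-++ {a} (x ∷ xs) ys = s≤s (≤-trans (+-monoʳ-≤ (sz a x) (sz-++ {a} xs ys)) (≤-reflexive (sym (+-assoc (sz a x) _ _))))

infixr 5 _++P_

_++P_ : ∀ {Γ a f g} → PT Γ (list a) f → PT Γ (list a) g → PT Γ (list a) (λ ρ → f ρ ++ g ρ)
_++P_ {Γ} {a} {f} {g} pf pg = congP
  (paraAdd pf pg (consP (varP (there here)) (varP here)) (con 1 ⊕ X)
    (λ r x xs ρ → ≤-trans (≤-reflexive (+-comm (suc (sz a x)) _))
      (+-monoʳ-≤ (sz (list a) r) (s≤s (≤-trans (m≤m+n _ _) (sz-head {a} x xs (szs Γ ρ)))))))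
  (λ ρ → para-cong {f = _++ g ρ} (λ _ _ → refl) (f ρ))

concatMapP : ∀ {Γ a b f l} → PT (a ∷ Γ) (list b) f → PT Γ (list a) l →
             PT Γ (list b) (λ ρ → concatMap (λ x → f (x , ρ)) (l ρ))
concatMapP {Γ} {a} {b} {f} {l} pf pl = congP
  (paraAdd pl nilP (under pf ++P varP here) (bound pf)
    (λ r x xs ρ → ≤-trans (sz-++ {b} (f (x , ρ)) r) (≤-trans (≤-reflexive (+-comm (sz (list b) (f (x , ρ))) _))
      (+-monoʳ-≤ (sz (list b) r) (≤-trans (size≤ pf (x , ρ)) (eval-mono (bound pf) (sz-head {a} x xs (szs Γ ρ))))))))
  (λ ρ → para-cong {f = concatMap (λ x → f (x , ρ))} (λ _ _ → refl) (l ρ))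

-- Naturals

units : ℕ → List ⊤
units n = replicate n tt

unitsP : ∀ {Γ f} → PT Γ nat f → PT Γ (list unit) (units ∘ f)
unitsP {f = f} p = castP p (λ ρ → lemma (f ρ))
  where
  lemma : ∀ n → enc nat n ≡ enc (list unit) (units n)
  lemma zero    = refl
  lemma (suc n) = cong (cons nil) (lemma n)

lengthP : ∀ {Γ a f} → PT Γ (list a) f → PT Γ nat (length ∘ f)
lengthP {f = f} p = castP (mapP (ttP {_}) p) (λ ρ → trans (lemma (map (λ _ → tt) (f ρ)))
    (cong encodeℕ (length-map _ (f ρ))))
  where
  lemma : ∀ xs → enc (list unit) xs ≡ encodeℕ (length xs)
  lemma []       = refl
  lemma (x ∷ xs) = cong (cons nil) (lemma xs)

tail : ∀ {A : Set} → List A → List A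
tail xs = caseList xs [] (λ _ ys → ys)

tailP : ∀ {Γ a f} → PT Γ (list a) f → PT Γ (list a) (tail ∘ f)
tailP p = caseP p nilP (varP (there here))

head : ∀ {A : Set} → A → List A → A
head d xs = caseList xs d (λ x _ → x)

headP : ∀ {Γ a d f} → PT Γ a d → PT Γ (list a) f → PT Γ a (λ ρ → head (d ρ) (f ρ))
headP pd p = caseP p pd (varP here)

sz-tail≤ : ∀ {a} (xs : List ⟦ a ⟧) → sz (list a) (tail xs) ≤ sz (list a) xs
sz-tail≤ []       = ≤-refl
sz-tail≤ {a} (x ∷ xs) = sz-tail {a} x xs

dropP : ∀ {Γ a n f} → PT Γ nat n → PT Γ (list a) f → PT Γ (list a) (λ ρ → drop (n ρ) (f ρ))
dropP {Γ} {a} {n} {f} pn pf = congP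
  (paraAdd (unitsP pn) pf (tailP (varP here)) (con 0) (λ r _ _ _ → ≤-trans (sz-tail≤ {a} r) (m≤m+n _ _)))
  (λ ρ → lemma (n ρ) (f ρ))
  where
  tail-drop : ∀ {A : Set} n (xs : List A) → tail (drop n xs) ≡ drop (suc n) xs
  tail-drop zero    []       = refl
  tail-drop zero    (x ∷ xs) = refl
  tail-drop (suc n) []       = refl
  tail-drop (suc n) (x ∷ xs) = tail-drop n xs
  lemma : ∀ n xs → para (λ r _ _ → tail r) xs (units n) ≡ drop n xs
  lemma zero    xs = refl
  lemma (suc n) xs = trans (cong tail (lemma n xs)) (tail-drop n xs)

infix 7 _≤P_ _≡P_

-- In unary, m ≤ n exactly when something is left after dropping m out of n + 1 units.
_≤P_ : ∀ {Γ f g} → PT Γ nat f → PT Γ nat g → PT Γ bool (λ ρ → f ρ ≤ᵇ g ρ)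
_≤P_ {f = f} {g} pf pg = congP (caseP (dropP pf (consP ttP (unitsP pg))) falseP trueP) (λ ρ → lemma (f ρ) (g ρ))
  where
  lemma : ∀ m n → caseList (drop m (tt ∷ units n)) false (λ _ _ → true) ≡ (m ≤ᵇ n)
  lemma zero          n       = refl
  lemma (suc zero)    zero    = refl
  lemma (suc (suc m)) zero    = refl
  lemma (suc zero)    (suc n) = refl
  lemma (suc (suc m)) (suc n) = lemma (suc m) n

_≡P_ : ∀ {Γ f g} → PT Γ nat f → PT Γ nat g → PT Γ bool (λ ρ → f ρ ≡ᵇ g ρ)
_≡P_ {f = f} {g} pf pg = congP ((pf ≤P pg) ∧P (pg ≤P pf)) (λ ρ → lemma (f ρ) (g ρ))
  where
  shift-≤ : ∀ m n → (suc m ≤ᵇ suc n) ≡ (m ≤ᵇ n)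
  shift-≤ zero    n = refl
  shift-≤ (suc m) n = refl
  lemma : ∀ m n → (m ≤ᵇ n) ∧ (n ≤ᵇ m) ≡ (m ≡ᵇ n)
  lemma zero    zero    = refl
  lemma zero    (suc n) = refl
  lemma (suc m) zero    = refl
  lemma (suc m) (suc n) = trans (cong₂ _∧_ (shift-≤ m n) (shift-≤ n m)) (lemma m n)

size-length : ∀ {a} (xs : List ⟦ a ⟧) → sz nat (length xs) ≤ 2 * sz (list a) xs
size-length []       = s≤s z≤n
size-length {a} (x ∷ xs) = ≤-by _ _ (2 * sz a x) (size-length {a} xs)
    (lemma (sz a x) (sz (list a) xs) (sz nat (length xs)))
  where
  lemma : ∀ x l n → 2 * suc (x + l) + n ≡ suc (suc n) + 2 * l + 2 * x
  lemma = solve-∀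

size-lengths : ∀ {a} x xs n → suc (sz nat (length xs)) ≤ 2 * (sz (list a) (x ∷ xs) + n)
size-lengths {a} x xs n = ≤-by _ _ (2 * sz a x + 1 + 2 * n) (size-length {a} xs)
    (lemma (sz a x) (sz (list a) xs) (sz nat (length xs)) n)
  where
  lemma : ∀ x l m n → 2 * (suc (x + l) + n) + m ≡ suc m + 2 * l + (2 * x + 1 + 2 * n)
  lemma = solve-∀

downFromP : ∀ {Γ a f} → PT Γ (list a) f → PT Γ (list nat) (λ ρ → downFrom (length (f ρ)))
downFromP {Γ} {a} {f} p = congP
  (paraAdd p nilP (consP (lengthP (varP (there (there here)))) (varP here)) (con 2 ⊛ X)
    (λ r x xs ρ → ≤-trans (≤-reflexive (+-comm (suc (sz nat (length xs))) _))
      (+-monoʳ-≤ (sz (list nat) r) (size-lengths {a} x xs (szs Γ ρ)))))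
  (λ ρ → para-cong {f = downFrom ∘ length} (λ _ _ → refl) (f ρ))

upToP : ∀ {Γ a f} → PT Γ (list a) f → PT Γ (list nat) (λ ρ → upTo (length (f ρ)))
upToP {Γ} {a} {f} p = congP
  (paraAdd p nilP (varP here ++P consP (lengthP (varP (there (there here)))) nilP) (con 2 ⊛ X ⊕ con 1)
    (λ r x xs ρ → ≤-trans (sz-++ {nat} r (length xs ∷ [])) (+-monoʳ-≤ (sz (list nat) r)
      (≤-trans (≤-reflexive (sym (+-assoc 1 (sz nat (length xs)) 1)))
          (+-monoˡ-≤ 1 (size-lengths {a} x xs (szs Γ ρ)))))))
  (λ ρ → para-cong {f = upTo ∘ length} (λ _ xs → upTo-∷ʳ (length xs)) (f ρ))

-- The algorithm

mem : ℕ → List ℕ → Bool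
mem x = any (x ≡ᵇ_)

-- The two ends and the label. Edges are collected in lists because contraction and smoothing may
-- create loops and parallel edges with different labels.
Edge : Set
Edge = ℕ × ℕ × List ℕ

touches : ℕ → Edge → Bool
touches v (x , y , _) = (v ≡ᵇ x) ∨ (v ≡ᵇ y)

rename : ℕ → ℕ → ℕ → ℕ
rename x y z = if z ≡ᵇ x then y else z

renameEdge : ℕ → ℕ → Edge → Edge
renameEdge x y (p , q , A) = rename x y p , rename x y q , A

-- Renaming the larger end keeps the encoding from growing.
contract : ℕ → ℕ → List Edge → List Edge
contract x y M = if x ≤ᵇ y then map (renameEdge y x) M else map (renameEdge x y) M

other : ℕ → Edge → ℕ
other v (x , y , _) = if v ≡ᵇ x then y else x

join : ℕ → Edge → Edge → Edge
join v e₁ e₂ = other v e₁ , other v e₂ , proj₂ (proj₂ e₁) ++ v ∷ proj₂ (proj₂ e₂)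

settled : List ℕ → List ℕ → Edge → Bool
settled U F (x , y , _) = not (mem x U ∨ mem x F) ∧ not (mem y U ∨ mem y F)

inside : List ℕ → Edge → Bool
inside F (x , y , _) = mem x F ∧ mem y F

ends : Edge → List ℕ
ends (x , y , _) = x ∷ y ∷ []

atMostOne : ∀ {A : Set} → List A → Bool
atMostOne xs = caseList xs true (λ _ ys → caseList ys true (λ _ _ → false))

-- Ends are counted rather than edges, so a loop counts twice.
low : List ℕ → List Edge → ℕ → Bool
low F M v = atMostOne (filterᵇ (v ≡ᵇ_) (concatMap ends (filterᵇ (inside F) M)))

-- Undecided vertices, forest vertices, edges, clauses, guesses.  A vertex in
-- neither of the first two lists is a terminal, or gone.
State : Set
State = List ℕ × List ℕ × List Edge × List (List ℕ) × List Bool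

stepVertex : ℕ → List ℕ → List Edge → List (List ℕ) → List Bool → State
stepVertex v F M out g =
  let F′ = filterᵇ (λ u → not (v ≡ᵇ u)) F
      R  = filterᵇ (λ e → not (touches v e)) M
  in caseList (filterᵇ (touches v) M) ([] , F′ , R , out , g) λ e₁ es →
     caseList es ([] , F′ , R , out , g) λ e₂ es′ →
     caseList es′ ([] , F′ , join v e₁ e₂ ∷ R , out , g) λ _ _ →
     -- Promotion removes v from the forest vertices but keeps its edges, which makes it a terminal.
     -- A missing guess counts as a cut; soundness does not depend on the guesses, so any default
     -- would be correct.
     if head false g then ([] , F′ , M , out , tail g) else ([] , F′ , R , (v ∷ []) ∷ out , tail g)

-- The order of the cases matters for counting guesses: a vertex is decided only when no settled
-- edge is left, and a forest vertex only when no vertex of the old solution is undecided.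
step : State → State
step (U , F , M , out , g) =
  caseList (filterᵇ (settled U F) M)
    (caseList U
      (caseList (filterᵇ (low F M) F) ([] , F , M , out , g) (λ v _ → stepVertex v F M out g))
      (λ v U′ → if head false g then (U′ , F , M , out , tail g)
                else (U′ , F , filterᵇ (λ e → not (touches v e)) M , (v ∷ []) ∷ out , tail g)))
    (λ e es →
      let M′ = es ++ filterᵇ (λ e → not (settled U F e)) M
          x = proj₁ e
          y = proj₁ (proj₂ e)
      -- A loop at a terminal is a cycle that can only be broken through its label, so it is cut
      -- whatever the guess says.
      in if head false g ∧ not (x ≡ᵇ y) then (U , F , contract x y M′ , out , tail g)
         else (U , F , M′ , proj₂ (proj₂ e) ∷ out , tail g))

repeat : ∀ {A : Set} → List A → State → State
repeat xs σ = para (λ r _ _ → step r) σ xs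

-- Remaining edges mean that the run has not been completed. The empty clause, which no set hits,
-- invalidates it.
finish : State → List (List ℕ)
finish (U , F , M , out , g) = caseList M out (λ _ _ → [] ∷ out)

-- Every step that changes the state lowers the total length of `U`, `F` and `M`, so as many steps
-- as this total in the initial state suffice.
clauses : State → List (List ℕ)
clauses σ@(U , F , M , _) = finish (repeat M (repeat F (repeat U σ)))

-- An entry is [] for a non-edge, [ false ] for blue and [ true ] for red; its
-- encoding is that of the colour in the instance.
Matrix : Set
Matrix = List (List (List Bool))

entry : Matrix → ℕ → ℕ → List Bool
entry m x y = head [] (drop y (head [] (drop x m)))

colour? : Bool → List Bool → Bool
colour? c l = caseList l false (λ b _ → if c then b else not b)

edges : Bool → Matrix → List ℕ → List Edge
edges c m []       = []
edges c m (x ∷ xs) = map (λ y → x , y , []) (filterᵇ (λ y → colour? c (entry m x y)) xs) ++ edges c m xs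

initial : Bool → Matrix → List ℕ → List ℕ → List Bool → State
initial c m T V g = T , filterᵇ (λ v → not (mem v T)) V , edges c m V , [] , g

systems : Bool → Matrix → List ℕ → List ℕ → List (List Bool) → List (List (List ℕ))
systems c m T V pool = map (λ g → clauses (initial c m T V g)) pool

hits : List ℕ → List (List ℕ) → Bool
hits S = all (any (λ v → mem v S))

-- The bits are consumed from the end of the string. The first component holds the clauses that have
-- not received a bit, the second the selected ones; surplus bits have no effect, so strings longer
-- than the list of clauses still describe all its subsets.
pick : List Bool → List (List ℕ) → List (List ℕ) × List (List ℕ)
pick []       Cs = Cs , []
pick (b ∷ bs) Cs =
  let r = pick bs Cs
  in caseList (proj₁ r) ([] , proj₂ r) (λ C Cs′ → Cs′ , (if b then C ∷ proj₂ r else proj₂ r))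

first : ∀ {A : Set} → List A → List A
first xs = caseList xs [] (λ x _ → x ∷ [])

candidates : List ℕ → List (List ℕ) → List (List ℕ)
candidates V table = table ++ concatMap (λ v → map (v ∷_) table) V

-- Only one candidate is kept for each bit string. This prevents the table from being multiplied by
-- the number of vertices in every round.
extend : List ℕ → List (List ℕ) → List (List Bool) → List (List ℕ) → List (List ℕ)
extend V Cs pool table =
  concatMap (λ bs → first (filterᵇ (λ S → hits S (proj₂ (pick bs Cs))) (candidates V table))) pool

-- For every subset of the clauses that k vertices can hit, one such set of vertices.
represent : List ℕ → List (List ℕ) → List (List Bool) → ℕ → List (List ℕ)
represent V Cs pool zero    = [] ∷ []
represent V Cs pool (suc k) = extend V Cs pool (represent V Cs pool k)

hitting : List ℕ → List (List ℕ) → List (List Bool) → ℕ → List (List ℕ)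
hitting V Cs pool k = filterᵇ (λ S → hits S Cs) (represent V Cs pool k)

solutions : Matrix → ℕ → List (List Bool) → List ℕ → List ℕ → List (List ℕ)
solutions m k pool T V =
  concatMap (λ Bs → concatMap (λ Rs → hitting V (Bs ++ Rs) pool k) (systems true m T V pool)) (systems false m T V pool)

compress : Matrix → ℕ → List (List Bool) → List ℕ → List ℕ → List (List ℕ)
compress m k pool T V = first (solutions m k pool T V)

solve : Matrix → ℕ → List (List Bool) → List ℕ → List (List ℕ)
solve m k pool []       = [] ∷ []
solve m k pool (x ∷ xs) = caseList (solve m k pool xs) [] (λ S _ → compress m k pool (x ∷ S) (x ∷ xs))

answer : Matrix → ℕ → List (List Bool) → List (List Bool)
answer m k pool =
  caseList (solve m k pool (downFrom (length m))) [] (λ S _ → map (λ v → mem v S) (upTo (length m)) ∷ [])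

-- Boolean tests and the propositions they decide

eqR : ∀ m n → Reflects (m ≡ n) (m ≡ᵇ n)
eqR m n = proof (m ≟ n)

memR : ∀ x xs → Reflects (x ∈ xs) (mem x xs)
memR x []       = ofⁿ λ ()
memR x (y ∷ ys) with x ≡ᵇ y | eqR x y
... | true  | ofʸ eq = ofʸ (here eq)
... | false | ofⁿ ne with mem x ys | memR x ys
...   | true  | ofʸ i = ofʸ (there i)
...   | false | ofⁿ n = ofⁿ λ { (here eq) → ne eq ; (there i) → n i }

∈-filterᵇ⁺ : ∀ {A : Set} (p : A → Bool) {x xs} → x ∈ xs → p x ≡ true → x ∈ filterᵇ p xs
∈-filterᵇ⁺ p i eq = ∈-filter⁺ (T? ∘ p) i (Equivalence.from T-≡ eq)

∈-filterᵇ⁻ : ∀ {A : Set} (p : A → Bool) {x} xs → x ∈ filterᵇ p xs → x ∈ xs × p x ≡ true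
∈-filterᵇ⁻ p xs i = let j , t = ∈-filter⁻ (T? ∘ p) {xs = xs} i in j , Equivalence.to T-≡ t

pattern straight = inj₁ (refl , refl)
pattern flipped  = inj₂ (refl , refl)

-- Connectivity in a multigraph given by a list of labelled edges

Joins : Edge → ℕ → ℕ → Set
Joins (x , y , _) a b = (x ≡ a × y ≡ b) ⊎ (x ≡ b × y ≡ a)

joins-unique : ∀ e {a b x y} → Joins e a b → Joins e x y → (a ≡ x × b ≡ y) ⊎ (a ≡ y × b ≡ x)
joins-unique e straight straight = straight
joins-unique e straight flipped = flipped
joins-unique e flipped straight = flipped
joins-unique e flipped flipped = straight

joins-sym : ∀ {e a b} → Joins e a b → Joins e b a
joins-sym (inj₁ p) = inj₂ p
joins-sym (inj₂ p) = inj₁ p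

Step : List Edge → ℕ → ℕ → Set
Step es a b = ∃[ e ] (e ∈ es × Joins e a b)

Conn : List Edge → ℕ → ℕ → Set
Conn es = Star (Step es)

conn-mono : ∀ {es fs} → (∀ {e} → e ∈ es → e ∈ fs) → ∀ {a b} → Conn es a b → Conn fs a b
conn-mono h = Star.map λ (e , i , j) → e , h i , j

conn-sym : ∀ {es a b} → Conn es a b → Conn es b a
conn-sym = reverse λ (e , i , j) → e , i , joins-sym {e} j

conn-edge : ∀ {es e a b} → e ∈ es → Joins e a b → Conn es a b
conn-edge i j = (_ , i , j) ◅ ε

-- A walk that uses e several times can be short-cut to use it at most once. By induction from the
-- front: if the remainder uses e again in the opposite direction, the two uses cancel.
conn-split : ∀ {e es x y a b} → Joins e x y → Conn (e ∷ es) a b →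
             Conn es a b ⊎ (Conn es a x × Conn es y b) ⊎ (Conn es a y × Conn es x b)
conn-split j ε = inj₁ ε
conn-split j ((f , there i , k) ◅ c) with conn-split j c
... | inj₁ p              = inj₁ ((f , i , k) ◅ p)
... | inj₂ (inj₁ (p , q)) = inj₂ (inj₁ ((f , i , k) ◅ p , q))
... | inj₂ (inj₂ (p , q)) = inj₂ (inj₂ ((f , i , k) ◅ p , q))
conn-split {e} {x = x} {y} {a} j ((_ , here refl , k) ◅ c) with joins-unique e k j | conn-split j c
... | straight | inj₁ p              = inj₂ (inj₁ (ε , p))
... | straight | inj₂ (inj₁ (p , q)) = inj₂ (inj₁ (ε , q))
... | straight | inj₂ (inj₂ (p , q)) = inj₁ q
... | flipped | inj₁ p              = inj₂ (inj₂ (ε , p))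
... | flipped | inj₂ (inj₁ (p , q)) = inj₁ q
... | flipped | inj₂ (inj₂ (p , q)) = inj₂ (inj₂ (ε , q))

-- Forests

-- The criterion of Kruskal's algorithm: each edge joins two different components of the edges
-- listed after it. As `Conn` is reflexive, this excludes loops. The form suits lists from which
-- edges are filtered; independence of the order is `forest-↭`.
Forest : List Edge → Set
Forest []               = ⊤
Forest ((x , y , A) ∷ es) = ¬ Conn es x y × Forest es

forest-tail : ∀ {e es} → Forest (e ∷ es) → Forest es
forest-tail = proj₂

forest-head : ∀ {e es a b} → Joins e a b → Forest (e ∷ es) → ¬ Conn es a b
forest-head straight (n , _) c = n c
forest-head flipped (n , _) c = n (conn-sym c)

forest-cons : ∀ {e es a b} → Joins e a b → ¬ Conn es a b → Forest es → Forest (e ∷ es)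
forest-cons straight n f = n , f
forest-cons flipped n f = n ∘ conn-sym , f

joins-self : ∀ e → Joins e (proj₁ e) (proj₁ (proj₂ e))
joins-self e = straight

-- An exchange: if a walk between the ends of f uses e, then its two remaining parts together with f
-- form a walk between the ends of e.
forest-swap : ∀ {e f es} → Forest (e ∷ f ∷ es) → Forest (f ∷ e ∷ es)
forest-swap {e} {f} {es} (n , m , φ) = cyc , n ∘ conn-mono there , φ
  where
  cyc : ¬ Conn (e ∷ es) (proj₁ f) (proj₁ (proj₂ f))
  cyc c with conn-split (joins-self e) c
  ... | inj₁ p              = m p
  ... | inj₂ (inj₁ (p , q)) = n (conn-sym (conn-mono there p) ◅◅ conn-edge (here refl) (joins-self f) ◅◅ conn-sym
      (conn-mono there q))
  ... | inj₂ (inj₂ (p , q)) = n (conn-mono there q ◅◅ conn-edge (here refl) (joins-sym {f} (joins-self f)) ◅◅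
      conn-mono there p)

forest-↭ : ∀ {es fs} → es ↭ fs → Forest es → Forest fs
forest-↭ refl         φ       = φ
forest-↭ (prep e p)   (n , φ) = n ∘ conn-mono (∈-resp-↭ (↭-sym p)) , forest-↭ p φ
forest-↭ (swap {es} e f p) φ with forest-swap {e} {f} {es} φ
... | n , m , ψ = n ∘ conn-mono (∈-resp-↭ (prep e (↭-sym p))) , m ∘ conn-mono (∈-resp-↭ (↭-sym p)) , forest-↭ p ψ
forest-↭ (trans↭ p q)  φ       = forest-↭ q (forest-↭ p φ)

forest-⊑ : ∀ {es fs} → es ⊑ fs → Forest fs → Forest es
forest-⊑ []          φ       = φ
forest-⊑ (_ ∷ʳ s)    (_ , φ) = forest-⊑ s φ
forest-⊑ (refl ∷ s)  (n , φ) = n ∘ conn-mono (⊑-lookup s) , forest-⊑ s φ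

-- Contraction

rename-eq : ∀ x y → rename x y x ≡ y
rename-eq x y with x ≡ᵇ x | eqR x x
... | true  | _     = refl
... | false | ofⁿ n = contradiction refl n

rename-≢ : ∀ {x z} y → z ≢ x → rename x y z ≡ z
rename-≢ {x} {z} y ne with z ≡ᵇ x | eqR z x
... | true  | ofʸ eq = contradiction eq ne
... | false | _      = refl

joins-rename : ∀ {e a b} x y → Joins e a b → Joins (renameEdge x y e) (rename x y a) (rename x y b)
joins-rename x y straight = straight
joins-rename x y flipped = flipped

conn-contract : ∀ {e es x y a b} → Joins e x y → Conn (e ∷ es) a b →
                Conn (map (renameEdge x y) es) (rename x y a) (rename x y b)
conn-contract j ε = ε
conn-contract {x = x} {y} j ((f , there i , k) ◅ c) =
  (renameEdge x y f , ∈-map⁺ (renameEdge x y) i , joins-rename {f} x y k) ◅ conn-contract j c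
conn-contract {e} {x = x} {y} j ((_ , here refl , k) ◅ c) = subst (λ z → Conn _ z _)
    (sym (same (joins-unique e k j))) (conn-contract j c)
  where
  xy : rename x y x ≡ rename x y y
  xy with y ≟ x
  ... | yes eq = cong (rename x y) (sym eq)
  ... | no ne  = trans (rename-eq x y) (sym (rename-≢ y ne))
  same : ∀ {a b} → (a ≡ x × b ≡ y) ⊎ (a ≡ y × b ≡ x) → rename x y a ≡ rename x y b
  same straight = xy
  same flipped = sym xy

conn-rename : ∀ {e es x y} → Joins e x y → ∀ a → Conn (e ∷ es) a (rename x y a)
conn-rename {x = x} j a with a ≡ᵇ x | eqR a x
... | true  | ofʸ refl = conn-edge (here refl) j
... | false | _        = ε

conn-expand : ∀ {e es x y a b} → Joins e x y → Conn (map (renameEdge x y) es) a b → Conn (e ∷ es) a b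
conn-expand j ε = ε
conn-expand {e} {es} {x} {y} j ((f , i , k) ◅ c) with ∈-map⁻ (renameEdge x y) i
... | (p , q , A) , i′ , refl = lift k ◅◅ conn-expand j c
  where
  pq : Conn (e ∷ es) (rename x y p) (rename x y q)
  pq = conn-sym (conn-rename j p) ◅◅ conn-edge (there i′) straight ◅◅ conn-rename j q
  lift : ∀ {a b} → Joins f a b → Conn (e ∷ es) a b
  lift straight = pq
  lift flipped = conn-sym pq

-- Swaps carry e down the list, so that every other edge is judged against `e ∷ es`. There its ends
-- are connected exactly when the renamed ends are connected after the contraction. The converse,
-- `forest-expand`, proceeds in the same way.
forest-contract : ∀ {e es x y} → Joins e x y → Forest (e ∷ es) → x ≢ y × Forest (map (renameEdge x y) es)
forest-contract {e} {es} {x} {y} j φ = (λ { refl → forest-head {e} j φ ε }) , go es φ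
  where
  go : ∀ es → Forest (e ∷ es) → Forest (map (renameEdge x y) es)
  go []       φ = tt
  go (f ∷ es) φ with forest-swap {e} {f} {es} φ
  ... | n , ψ = (λ c → n (conn-rename j _ ◅◅ conn-expand j c ◅◅ conn-sym (conn-rename j _))) , go es ψ

forest-expand : ∀ {e es x y} → Joins e x y → x ≢ y → Forest (map (renameEdge x y) es) → Forest (e ∷ es)
forest-expand {e} {[]} j ne φ = forest-cons {e} j (λ { ε → ne refl ; ((_ , () , _) ◅ _) }) tt
forest-expand {e} {f ∷ es} j ne (n , φ) =
  forest-swap {f} {e} {es} ((λ c → n (conn-contract {e} j c)) , forest-expand {e} j ne φ)

-- Pendant edges and series edges

Avoids : ℕ → List Edge → Set
Avoids v es = ∀ {e a} → e ∈ es → ¬ Joins e v a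

conn-avoid : ∀ {v es x} → Avoids v es → Conn es v x → v ≡ x
conn-avoid av ε = refl
conn-avoid av ((e , i , j) ◅ _) = contradiction j (av i)

forest-pendant : ∀ {e es v x} → Joins e v x → v ≢ x → Avoids v es → Forest es → Forest (e ∷ es)
forest-pendant {e} j ne av φ = forest-cons {e} j (ne ∘ conn-avoid av) φ

-- Subdivision of e at a new vertex v. The second half is a pendant edge; a walk from v to a that
-- avoids the first half has to leave through b, and then it connects the ends of e without e.
forest-series : ∀ {e e₁ e₂ es v a b} → Joins e a b → Joins e₁ v a → Joins e₂ v b → v ≢ a → v ≢ b → Avoids v es →
                Forest (e ∷ es) → Forest (e₁ ∷ e₂ ∷ es)
forest-series {e} {e₁} {e₂} {es} {v} {a} {b} j j₁ j₂ na nb av φ =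
  forest-cons {e₁} j₁ cyc (forest-pendant {e₂} j₂ nb av (forest-tail {e} φ))
  where
  cyc : ¬ Conn (e₂ ∷ es) v a
  cyc c with conn-split j₂ c
  ... | inj₁ p              = na (conn-avoid av p)
  ... | inj₂ (inj₁ (_ , q)) = forest-head {e} j φ (conn-sym q)
  ... | inj₂ (inj₂ (p , _)) = nb (conn-avoid av p)

forest-smooth : ∀ {e e₁ e₂ es v a b} → Joins e a b → Joins e₁ v a → Joins e₂ v b →
                Forest (e₁ ∷ e₂ ∷ es) → Forest (e ∷ es)
forest-smooth {e} {e₁} {e₂} j j₁ j₂ φ =
  forest-cons {e} j (λ c → forest-head {e₁} j₁ φ (conn-edge (here refl) j₂ ◅◅ conn-sym (conn-mono there c)))
              (forest-tail {e₂} (forest-tail {e₁} φ))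

-- Counting

count : ℕ → List ℕ → ℕ
count v xs = length (filterᵇ (v ≡ᵇ_) xs)

degree : List Edge → ℕ → ℕ
degree es v = count v (concatMap ends es)

count-yes : ∀ v {x} xs → v ≡ x → count v (x ∷ xs) ≡ suc (count v xs)
count-yes v {x} xs eq rewrite filterᵇ-∷ (v ≡ᵇ_) x xs with v ≡ᵇ x | eqR v x
... | true  | _     = refl
... | false | ofⁿ n = contradiction eq n

count-no : ∀ v {x} xs → v ≢ x → count v (x ∷ xs) ≡ count v xs
count-no v {x} xs ne rewrite filterᵇ-∷ (v ≡ᵇ_) x xs with v ≡ᵇ x | eqR v x
... | true  | ofʸ eq = contradiction eq ne
... | false | _      = refl

count-rename-source : ∀ x y xs → x ≢ y → count x (map (rename x y) xs) ≡ 0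
count-rename-source x y []       ne = refl
count-rename-source x y (z ∷ xs) ne with z ≡ᵇ x | eqR z x
... | true  | _     = trans (count-no x _ ne) (count-rename-source x y xs ne)
... | false | ofⁿ n = trans (count-no x _ (n ∘ sym)) (count-rename-source x y xs ne)

count-rename-target : ∀ x y xs → x ≢ y → count y (map (rename x y) xs) ≡ count x xs + count y xs
count-rename-target x y []       ne = refl
count-rename-target x y (z ∷ xs) ne with z ≡ᵇ x | eqR z x
... | true  | ofʸ refl = trans (count-yes y _ refl) (trans (cong suc (count-rename-target x y xs ne))
                           (sym (cong₂ _+_ (count-yes x xs refl) (count-no y xs (ne ∘ sym)))))
... | false | ofⁿ n with y ≟ z
...   | yes refl = trans (count-yes y _ refl) (trans (cong suc (count-rename-target x y xs ne))
                     (trans (sym (+-suc _ _)) (sym (cong₂ _+_ (count-no x xs (n ∘ sym)) (count-yes y xs refl)))))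
...   | no  yz   = trans (count-no y _ yz) (trans (count-rename-target x y xs ne)
                     (sym (cong₂ _+_ (count-no x xs (n ∘ sym)) (count-no y xs yz))))

count-rename-other : ∀ x y v xs → v ≢ x → v ≢ y → count v (map (rename x y) xs) ≡ count v xs
count-rename-other x y v []       nx ny = refl
count-rename-other x y v (z ∷ xs) nx ny with z ≡ᵇ x | eqR z x
... | true  | ofʸ refl = trans (count-no v _ ny) (trans (count-rename-other x y v xs nx ny) (sym (count-no v xs nx)))
... | false | ofⁿ n with v ≟ z
...   | yes refl = trans (count-yes v _ refl) (trans (cong suc (count-rename-other x y v xs nx ny))
    (sym (count-yes v xs refl)))
...   | no  vz   = trans (count-no v _ vz) (trans (count-rename-other x y v xs nx ny) (sym (count-no v xs vz)))

ends-rename : ∀ x y es → concatMap ends (map (renameEdge x y) es) ≡ map (rename x y) (concatMap ends es)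
ends-rename x y []       = refl
ends-rename x y (e ∷ es) = cong (λ l → _ ∷ _ ∷ l) (ends-rename x y es)

-- Contracting an edge whose ends both have degree at least two leaves no
-- vertex of degree one.
forest-leafless : ∀ es → Forest es → (∀ v → degree es v ≢ 1) → es ≡ []
forest-leafless es = go (length es) es ≤-refl
  where
  go : ∀ n es → length es ≤ n → Forest es → (∀ v → degree es v ≢ 1) → es ≡ []
  go n       []                 _       φ h = refl
  go (suc n) (e@(x , y , A) ∷ es) (s≤s le) φ h with forest-contract {e} (joins-self e) φ
  ... | ne , ψ with go n (map (renameEdge x y) es) (subst (_≤ n) (sym (length-map _ es)) le) ψ h′
    where
    E = concatMap ends es
    deg-x : degree (e ∷ es) x ≡ suc (degree es x)
    deg-x = trans (count-yes x (y ∷ E) refl) (cong suc (count-no x E ne))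
    deg-y : degree (e ∷ es) y ≡ suc (degree es y)
    deg-y = trans (count-no y (y ∷ E) (ne ∘ sym)) (count-yes y E refl)
    h′ : ∀ v → degree (map (renameEdge x y) es) v ≢ 1
    h′ v rewrite ends-rename x y es with v ≟ x
    ... | yes refl rewrite count-rename-source x y E ne = λ ()
    ... | no vx with v ≟ y
    -- The merged vertex has degree (deg x - 1) + (deg y - 1). Neither end is a leaf, so both terms
    -- are positive and the sum is not one.
    ...   | yes refl rewrite count-rename-target x y E ne = two (h x) (h y) deg-x deg-y
      where
      two : ∀ {a b a′ b′} → a ≢ 1 → b ≢ 1 → a ≡ suc a′ → b ≡ suc b′ → a′ + b′ ≢ 1
      two {a′ = zero}  na nb refl refl _ = na refl
      two {a′ = suc a′} {b′ = zero} na nb refl refl _ = nb refl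
      two {a′ = suc a′} {b′ = suc b′} na nb refl refl eq rewrite +-suc a′ b′ with eq
      ... | ()
    ...   | no vy rewrite count-rename-other x y v E vx vy = h v ∘ trans
        (trans (count-no v (y ∷ E) vx) (count-no v E vy))
  -- The induction leaves no edge after the contraction. Then e was the only edge, and its end x a
  -- leaf after all.
  go (suc n) (e@(x , y , A) ∷ []) (s≤s le) φ h | ne , ψ | _ = contradiction
      (trans (count-yes x (y ∷ []) refl) (cong suc (count-no x [] ne))) (h x)
  go (suc n) (e@(x , y , A) ∷ (_ ∷ es)) (s≤s le) φ h | ne , ψ | ()

filterᵇ-length : ∀ {A : Set} (p : A → Bool) xs → length (filterᵇ p xs) ≤ length xs
filterᵇ-length p []       = z≤n
filterᵇ-length p (x ∷ xs) rewrite filterᵇ-∷ p x xs with p x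
... | true  = s≤s (filterᵇ-length p xs)
... | false = m≤n⇒m≤1+n (filterᵇ-length p xs)

filterᵇ-shorter : ∀ {A : Set} (p : A → Bool) {x} xs → x ∈ xs → p x ≡ false → suc (length (filterᵇ p xs)) ≤ length xs
filterᵇ-shorter p (x ∷ xs) (here refl) eq rewrite filterᵇ-∷ p x xs | eq = s≤s (filterᵇ-length p xs)
filterᵇ-shorter p (x ∷ xs) (there i) eq rewrite filterᵇ-∷ p x xs with p x
... | true  = s≤s (filterᵇ-shorter p xs i eq)
... | false = m≤n⇒m≤1+n (filterᵇ-shorter p xs i eq)

remove : ℕ → List ℕ → List ℕ
remove v = filterᵇ (λ u → not (v ≡ᵇ u))

∈-remove⁺ : ∀ {v u xs} → u ∈ xs → v ≢ u → u ∈ remove v xs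
∈-remove⁺ {v} {u} i ne = ∈-filterᵇ⁺ _ i lemma
  where
  lemma : not (v ≡ᵇ u) ≡ true
  lemma with v ≡ᵇ u | eqR v u
  ... | true  | ofʸ eq = contradiction eq ne
  ... | false | _      = refl

∈-remove⁻ : ∀ {v u} xs → u ∈ remove v xs → u ∈ xs × v ≢ u
∈-remove⁻ {v} {u} xs i with ∈-filterᵇ⁻ _ xs i
... | j , eq = j , lemma eq
  where
  lemma : not (v ≡ᵇ u) ≡ true → v ≢ u
  lemma eq with v ≡ᵇ u | eqR v u
  lemma () | true  | _
  ...      | false | ofⁿ n = n

remove-shorter : ∀ {v} xs → v ∈ xs → suc (length (remove v xs)) ≤ length xs
remove-shorter {v} xs i = filterᵇ-shorter _ xs i lemma
  where
  lemma : not (v ≡ᵇ v) ≡ false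
  lemma with v ≡ᵇ v | eqR v v
  ... | true  | _     = refl
  ... | false | ofⁿ n = contradiction refl n

EndsIn : List ℕ → List Edge → Set
EndsIn W es = ∀ {x y A} → (x , y , A) ∈ es → x ∈ W × y ∈ W

rename-∈ : ∀ {x y z W} → x ≢ y → y ∈ W → z ∈ W → rename x y z ∈ remove x W
rename-∈ {x} {y} {z} ne iy iz with z ≡ᵇ x | eqR z x
... | true  | _     = ∈-remove⁺ iy ne
... | false | ofⁿ n = ∈-remove⁺ iz (n ∘ sym)

-- A contraction removes one edge and one vertex of `W`. The recursion runs on a bound for the
-- length because the contracted list is not a sublist of the original one.
forest-length : ∀ {W} es → Forest es → EndsIn W es → length es ≤ length W
forest-length []                   φ h = z≤n
forest-length {W} es@((x , y , A) ∷ _) φ h = go (length es) es W ≤-refl φ h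
  where
  go : ∀ n es W → length es ≤ n → Forest es → EndsIn W es → length es ≤ length W
  go n       []                   W _        φ h = z≤n
  go (suc n) (e@(x , y , A) ∷ es) W (s≤s le) φ h with forest-contract {e} (joins-self e) φ
  ... | ne , ψ = ≤-trans (s≤s (subst (_≤ _) (length-map _ es)
                   (go n (map (renameEdge x y) es) (remove x W) (subst (_≤ n) (sym (length-map _ es)) le) ψ h′)))
                   (remove-shorter W (proj₁ (h (here refl))))
    where
    h′ : EndsIn (remove x W) (map (renameEdge x y) es)
    h′ i with ∈-map⁻ (renameEdge x y) i
    ... | (p , q , B) , j , refl = rename-∈ ne (proj₂ (h (here refl))) (proj₁ (h (there j))) ,
                                   rename-∈ ne (proj₂ (h (here refl))) (proj₂ (h (there j)))

true-of : ∀ {P : Set} {b} → Reflects P b → P → b ≡ true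
true-of (ofʸ _) p = refl
true-of (ofⁿ n) p = contradiction p n

false-of : ∀ {P : Set} {b} → Reflects P b → ¬ P → b ≡ false
false-of (ofʸ p) n = contradiction p n
false-of (ofⁿ _) n = refl

holds : ∀ {P : Set} {b} → Reflects P b → b ≡ true → P
holds (ofʸ p) _ = p

fails : ∀ {P : Set} {b} → Reflects P b → b ≡ false → ¬ P
fails (ofⁿ n) _ = n

bool-cong : ∀ {P Q : Set} {a b} → Reflects P a → Reflects Q b → (P → Q) → (Q → P) → a ≡ b
bool-cong (ofʸ p) q f g = sym (true-of q (f p))
bool-cong (ofⁿ n) q f g = sym (false-of q (n ∘ g))

-- Filters

filter-⊑ : ∀ {A : Set} (p q : A → Bool) M → (∀ {e} → e ∈ M → p e ≡ true → q e ≡ true) → filterᵇ p M ⊑ filterᵇ q M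
filter-⊑ p q []      h = []
filter-⊑ p q (e ∷ M) h rewrite filterᵇ-∷ p e M | filterᵇ-∷ q e M with p e in pe | q e in qe
... | true  | true  = refl ∷ filter-⊑ p q M (h ∘ there)
... | true  | false = contradiction (trans (sym (h (here refl) pe)) qe) λ ()
... | false | true  = e ∷ʳ filter-⊑ p q M (h ∘ there)
... | false | false = filter-⊑ p q M (h ∘ there)

filter-filter : ∀ {A : Set} (p q : A → Bool) M → filterᵇ p (filterᵇ q M) ≡ filterᵇ (λ e → q e ∧ p e) M
filter-filter p q []      = refl
filter-filter p q (e ∷ M) rewrite filterᵇ-∷ q e M | filterᵇ-∷ (λ e → q e ∧ p e) e M with q e
... | false = filter-filter p q M
... | true rewrite filterᵇ-∷ p e (filterᵇ q M) with p e
...   | true  = cong (e ∷_) (filter-filter p q M)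
...   | false = filter-filter p q M

filter-map : ∀ {A B : Set} (f : A → B) p q M → (∀ e → p (f e) ≡ q e) → filterᵇ p (map f M) ≡ map f (filterᵇ q M)
filter-map f p q []      h = refl
filter-map f p q (e ∷ M) h rewrite filterᵇ-∷ p (f e) (map f M) | filterᵇ-∷ q e M | h e with q e
... | true  = cong (f e ∷_) (filter-map f p q M h)
... | false = filter-map f p q M h

filter-++ : ∀ {A : Set} (p : A → Bool) xs ys → filterᵇ p (xs ++ ys) ≡ filterᵇ p xs ++ filterᵇ p ys
filter-++ p []       ys = refl
filter-++ p (x ∷ xs) ys rewrite filterᵇ-∷ p x (xs ++ ys) | filterᵇ-∷ p x xs with p x
... | true  = cong (x ∷_) (filter-++ p xs ys)
... | false = filter-++ p xs ys

filter-part : ∀ {A : Set} (p : A → Bool) M → M ↭ filterᵇ p M ++ filterᵇ (not ∘ p) M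
filter-part p []      = refl
filter-part p (e ∷ M) rewrite filterᵇ-∷ p e M | filterᵇ-∷ (not ∘ p) e M with p e
... | true  = prep e (filter-part p M)
... | false = trans↭ (prep e (filter-part p M)) (↭-sym (↭-shift e (filterᵇ p M) (filterᵇ (not ∘ p) M)))

filter-yes : ∀ {A : Set} (p : A → Bool) {e} M → p e ≡ true → filterᵇ p (e ∷ M) ≡ e ∷ filterᵇ p M
filter-yes p {e} M eq rewrite filterᵇ-∷ p e M | eq = refl

filter-no : ∀ {A : Set} (p : A → Bool) {e} M → p e ≡ false → filterᵇ p (e ∷ M) ≡ filterᵇ p M
filter-no p {e} M eq rewrite filterᵇ-∷ p e M | eq = refl

filter-cons-⊑ : ∀ {A : Set} (p : A → Bool) e M → filterᵇ p (e ∷ M) ⊑ e ∷ filterᵇ p M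
filter-cons-⊑ p e M rewrite filterᵇ-∷ p e M with p e
... | true  = ⊆-refl
... | false = e ∷ʳ ⊆-refl

filterᵇ-↭ : ∀ {A : Set} (p : A → Bool) {M N : List A} → M ↭ N → filterᵇ p M ↭ filterᵇ p N
filterᵇ-↭ p = filter-↭ (T? ∘ p)

-- Live edges: those that survive the deletion of S from the part of the graph
-- that is not yet settled.

Hit : List ℕ → List ℕ → Set
Hit S A = ∃[ v ] (v ∈ A × v ∈ S)

hit : List ℕ → List ℕ → Bool
hit S = any (λ v → mem v S)

hitR : ∀ S A → Reflects (Hit S A) (hit S A)
hitR S []      = ofⁿ λ { (_ , () , _) }
hitR S (v ∷ A) with mem v S | memR v S
... | true  | ofʸ i = ofʸ (v , here refl , i)
... | false | ofⁿ n with hit S A | hitR S A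
...   | true  | ofʸ (u , i , j) = ofʸ (u , there i , j)
...   | false | ofⁿ m = ofⁿ λ { (_ , here refl , j) → n j ; (u , there i , j) → m (u , i , j) }

Open : List ℕ → List ℕ → ℕ → Set
Open U F z = z ∈ U ⊎ z ∈ F

openR : ∀ U F z → Reflects (Open U F z) (mem z U ∨ mem z F)
openR U F z = memR z U ⊎-reflects memR z F

-- Only open vertices are deleted by `S`. A terminal counts as kept even if its name lies in `S`:
-- this leaves more edges alive, which is the safe side for soundness, and in the run dictated by
-- `S` no vertex of `S` is promoted.
Blocked : List ℕ → List ℕ → List ℕ → ℕ → Set
Blocked S U F z = z ∈ S × Open U F z

blocked : List ℕ → List ℕ → List ℕ → ℕ → Bool
blocked S U F z = mem z S ∧ (mem z U ∨ mem z F)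

blockedR : ∀ S U F z → Reflects (Blocked S U F z) (blocked S U F z)
blockedR S U F z = memR z S ×-reflects openR U F z

Alive : List ℕ → List ℕ → List ℕ → Edge → Set
Alive S U F (x , y , A) = ¬ Blocked S U F x × ¬ Blocked S U F y × ¬ Hit S A

alive : List ℕ → List ℕ → List ℕ → Edge → Bool
alive S U F (x , y , A) = not (blocked S U F x) ∧ not (blocked S U F y) ∧ not (hit S A)

aliveR : ∀ S U F e → Reflects (Alive S U F e) (alive S U F e)
aliveR S U F (x , y , A) =
  ¬-reflects (blockedR S U F x) ×-reflects ¬-reflects (blockedR S U F y) ×-reflects ¬-reflects (hitR S A)

live : List ℕ → List ℕ → List ℕ → List Edge → List Edge
live S U F = filterᵇ (alive S U F)

Settled : List ℕ → List ℕ → Edge → Set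
Settled U F (x , y , _) = ¬ Open U F x × ¬ Open U F y

settledR : ∀ U F e → Reflects (Settled U F e) (settled U F e)
settledR U F (x , y , _) = ¬-reflects (openR U F x) ×-reflects ¬-reflects (openR U F y)

Inside : List ℕ → Edge → Set
Inside F (x , y , _) = x ∈ F × y ∈ F

insideR : ∀ F e → Reflects (Inside F e) (inside F e)
insideR F (x , y , _) = memR x F ×-reflects memR y F

Touches : ℕ → Edge → Set
Touches v (x , y , _) = v ≡ x ⊎ v ≡ y

touchesR : ∀ v e → Reflects (Touches v e) (touches v e)
touchesR v (x , y , _) = eqR v x ⊎-reflects eqR v y

joins-other : ∀ v e → Touches v e → Joins e v (other v e)
joins-other v (x , y , A) t with v ≡ᵇ x | eqR v x
... | true  | ofʸ refl = straight
joins-other v (x , y , A) (inj₁ eq) | false | ofⁿ n = contradiction eq n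
joins-other v (x , y , A) (inj₂ eq) | false | ofⁿ n = inj₂ (refl , sym eq)

joins-touches : ∀ {v a} e → Joins e v a → Touches v e
joins-touches e (inj₁ (refl , _)) = inj₁ refl
joins-touches e (inj₂ (_ , refl)) = inj₂ refl

removeR : ∀ v (e : Edge) → Reflects (¬ Touches v e) (not (touches v e))
removeR v e = ¬-reflects (touchesR v e)

untouched : ℕ → List Edge → List Edge
untouched v = filterᵇ (λ e → not (touches v e))

avoids-untouched : ∀ {v} (p : Edge → Bool) M → Avoids v (filterᵇ p (untouched v M))
avoids-untouched {v} p M {e} i j =
  holds (removeR v e) (proj₂ (∈-filterᵇ⁻ _ M (proj₁ (∈-filterᵇ⁻ p (untouched v M) i)))) (joins-touches e j)

-- What one step does

-- Which case applies depends on `U`, `F` and `M` only, so each equation holds for all clauses and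
-- guesses at once. Soundness, completeness and the growth of the state are proved along these same
-- cases.
data View (U F : List ℕ) (M : List Edge) : Set where
  resolve : ∀ x y A es → filterᵇ (settled U F) M ≡ (x , y , A) ∷ es →
    let M′ = es ++ filterᵇ (λ e → not (settled U F e)) M in
    (∀ out g → step (U , F , M , out , g) ≡
      (if head false g ∧ not (x ≡ᵇ y) then (U , F , contract x y M′ , out , tail g) else
          (U , F , M′ , A ∷ out , tail g))) →
    View U F M
  decide : ∀ v U′ → filterᵇ (settled U F) M ≡ [] → U ≡ v ∷ U′ →
    (∀ out g → step (U , F , M , out , g) ≡
      (if head false g then (U′ , F , M , out , tail g) else (U′ , F , untouched v M , (v ∷ []) ∷ out , tail g))) →
    View U F M
  stuck : filterᵇ (settled U F) M ≡ [] → U ≡ [] → filterᵇ (low F M) F ≡ [] →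
    (∀ out g → step (U , F , M , out , g) ≡ (U , F , M , out , g)) → View U F M
  prune : ∀ v → filterᵇ (settled U F) M ≡ [] → U ≡ [] → v ∈ F → low F M v ≡ true →
    filterᵇ (touches v) M ≡ [] ⊎ ∃[ e ] (filterᵇ (touches v) M ≡ e ∷ []) →
    (∀ out g → step (U , F , M , out , g) ≡ ([] , remove v F , untouched v M , out , g)) → View U F M
  series : ∀ v e₁ e₂ → filterᵇ (settled U F) M ≡ [] → U ≡ [] → v ∈ F → low F M v ≡ true → filterᵇ (touches v) M ≡
      e₁ ∷ e₂ ∷ [] →
    (∀ out g → step (U , F , M , out , g) ≡ ([] , remove v F , join v e₁ e₂ ∷ untouched v M , out , g)) → View U F M
  branch : ∀ v e₁ e₂ e₃ es → filterᵇ (settled U F) M ≡ [] → U ≡ [] → v ∈ F → low F M v ≡ true →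
    filterᵇ (touches v) M ≡ e₁ ∷ e₂ ∷ e₃ ∷ es →
    (∀ out g → step (U , F , M , out , g) ≡
      (if head false g then ([] , remove v F , M , out , tail g)
       else ([] , remove v F , untouched v M , (v ∷ []) ∷ out , tail g))) → View U F M

step-settled : ∀ {U F M e es} → filterᵇ (settled U F) M ≡ e ∷ es → ∀ out g → step (U , F , M , out , g) ≡
  (let M′ = es ++ filterᵇ (λ e → not (settled U F e)) M ; x = proj₁ e ; y = proj₁ (proj₂ e) in
   if head false g ∧ not (x ≡ᵇ y) then (U , F , contract x y M′ , out , tail g) else
       (U , F , M′ , proj₂ (proj₂ e) ∷ out , tail g))
step-settled eq out g rewrite eq = refl

step-decide : ∀ {v U F M} → filterᵇ (settled (v ∷ U) F) M ≡ [] → ∀ out g → step (v ∷ U , F , M , out , g) ≡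
  (if head false g then (U , F , M , out , tail g) else (U , F , untouched v M , (v ∷ []) ∷ out , tail g))
step-decide eq out g rewrite eq = refl

step-stuck : ∀ {F M} → filterᵇ (settled [] F) M ≡ [] → filterᵇ (low F M) F ≡ [] →
             ∀ out g → step ([] , F , M , out , g) ≡ ([] , F , M , out , g)
step-stuck eq eq′ out g rewrite eq | eq′ = refl

step-vertex : ∀ {F M v vs} → filterᵇ (settled [] F) M ≡ [] → filterᵇ (low F M) F ≡ v ∷ vs →
              ∀ out g → step ([] , F , M , out , g) ≡ stepVertex v F M out g
step-vertex eq eq′ out g rewrite eq | eq′ = refl

step-drop₀ : ∀ {v F M} → filterᵇ (touches v) M ≡ [] → ∀ out g →
             stepVertex v F M out g ≡ ([] , remove v F , untouched v M , out , g)
step-drop₀ eq out g rewrite eq = refl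

step-drop₁ : ∀ {v F M e} → filterᵇ (touches v) M ≡ e ∷ [] → ∀ out g →
             stepVertex v F M out g ≡ ([] , remove v F , untouched v M , out , g)
step-drop₁ eq out g rewrite eq = refl

step-series : ∀ {v F M e₁ e₂} → filterᵇ (touches v) M ≡ e₁ ∷ e₂ ∷ [] → ∀ out g →
              stepVertex v F M out g ≡ ([] , remove v F , join v e₁ e₂ ∷ untouched v M , out , g)
step-series eq out g rewrite eq = refl

step-branch : ∀ {v F M e₁ e₂ e₃ es} → filterᵇ (touches v) M ≡ e₁ ∷ e₂ ∷ e₃ ∷ es → ∀ out g →
              stepVertex v F M out g ≡
                (if head false g then ([] , remove v F , M , out , tail g)
                 else ([] , remove v F , untouched v M , (v ∷ []) ∷ out , tail g))
step-branch eq out g rewrite eq = refl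

view : ∀ U F M → View U F M
view U F M with filterᵇ (settled U F) M in eq
view U F M | (x , y , A) ∷ es = resolve x y A es eq (step-settled {U} {F} {M} eq)
view (v ∷ U) F M | [] = decide v U eq refl (step-decide {v} {U} {F} {M} eq)
view [] F M | [] with filterᵇ (low F M) F in eq′
... | [] = stuck eq refl eq′ (step-stuck {F} {M} eq eq′)
... | v ∷ vs with ∈-filterᵇ⁻ (low F M) F (subst (v ∈_) (sym eq′) (here refl))
...   | v∈ , lo with filterᵇ (touches v) M in eq″
...     | []                = prune v eq refl v∈ lo (inj₁ eq″) λ out g →
  trans (step-vertex {F} {M} eq eq′ out g) (step-drop₀ {v} {F} {M} eq″ out g)
...     | e ∷ []            = prune v eq refl v∈ lo (inj₂ (e , eq″)) λ out g →
  trans (step-vertex {F} {M} eq eq′ out g) (step-drop₁ {v} {F} {M} eq″ out g)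
...     | e₁ ∷ e₂ ∷ []      = series v e₁ e₂ eq refl v∈ lo eq″ λ out g →
  trans (step-vertex {F} {M} eq eq′ out g) (step-series {v} {F} {M} eq″ out g)
...     | e₁ ∷ e₂ ∷ e₃ ∷ es = branch v e₁ e₂ e₃ es eq refl v∈ lo eq″ λ out g →
  trans (step-vertex {F} {M} eq eq′ out g) (step-branch {v} {F} {M} eq″ out g)

-- Opening and closing vertices

alive-mono : ∀ {S U F U′ F′} e → (∀ {z} → z ∈ S → Open U′ F′ z → Open U F z) → Alive S U F e → Alive S U′ F′ e
alive-mono e h (a , b , c) = (λ (s , o) → a (s , h s o)) , (λ (s , o) → b (s , h s o)) , c

live-mono : ∀ {S U F U′ F′} → (∀ {z} → z ∈ S → Open U′ F′ z → Open U F z) → ∀ M → live S U F M ⊑ live S U′ F′ M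
live-mono {S} {U} {F} {U′} {F′} h M = filter-⊑ _ _ M λ {e} _ a →
  true-of (aliveR S U′ F′ e) (alive-mono {S} {U} {F} {U′} {F′} e h (holds (aliveR S U F e) a))

-- The edges at an open vertex of `S` are dead already, so removing them loses nothing that is
-- alive.
live-cut : ∀ {S U F U′ F′ v} → v ∈ S → Open U F v → (∀ {z} → Open U′ F′ z → Open U F z) → ∀ M →
           live S U F M ⊑ live S U′ F′ (untouched v M)
live-cut {S} {U} {F} {U′} {F′} {v} s o h M rewrite filter-filter (alive S U′ F′) (λ e → not (touches v e)) M =
  filter-⊑ _ _ M λ {e} _ a → true-of (removeR v e ×-reflects aliveR S U′ F′ e)
    (free e (holds (aliveR S U F e) a) , alive-mono {S} {U} {F} {U′} {F′} e (λ _ → h) (holds (aliveR S U F e) a))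
  where
  free : ∀ e → Alive S U F e → ¬ Touches v e
  free e (a , b , c) (inj₁ refl) = a (s , o)
  free e (a , b , c) (inj₂ refl) = b (s , o)

live-open : ∀ {S U F U′ F′ v} → (∀ {z} → Open U F z → z ≡ v ⊎ Open U′ F′ z) → ∀ M →
            (∀ {e} → e ∈ M → ¬ Touches v e) → live S U′ F′ M ⊑ live S U F M
live-open {S} {U} {F} {U′} {F′} {v} h M un = filter-⊑ _ _ M λ {e} i a →
  true-of (aliveR S U F e) (back e (un i) (holds (aliveR S U′ F′ e) a))
  where
  keep : ∀ z → v ≢ z → ¬ Blocked S U′ F′ z → ¬ Blocked S U F z
  keep z n a (s , o) with h o
  ... | inj₁ eq = n (sym eq)
  ... | inj₂ o′ = a (s , o′)
  back : ∀ e → ¬ Touches v e → Alive S U′ F′ e → Alive S U F e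
  back (x , y , A) n (a , b , c) = keep x (n ∘ inj₁) a , keep y (n ∘ inj₂) b , c

untouched-free : ∀ {v e} M → e ∈ untouched v M → ¬ Touches v e
untouched-free {v} {e} M i = holds (removeR v e) (proj₂ (∈-filterᵇ⁻ _ M i))

filter-filter-⊑ : ∀ {A : Set} (p q r : A → Bool) M → (∀ {e} → p e ≡ true → r e ≡ true) →
                  filterᵇ p (filterᵇ q M) ⊑ filterᵇ r M
filter-filter-⊑ p q r M h rewrite filter-filter p q M = filter-⊑ _ _ M λ {e} _ t → h (second (q e) t)
  where
  second : ∀ a {b} → a ∧ b ≡ true → b ≡ true
  second true eq = eq

open-remove : ∀ {v F z} → Open [] (remove v F) z → Open [] F z
open-remove {v} {F} (inj₂ i) = inj₂ (proj₁ (∈-remove⁻ {v} F i))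

open-restore : ∀ {v F z} → Open [] F z → z ≡ v ⊎ Open [] (remove v F) z
open-restore {v} {F} {z} (inj₂ i) with v ≟ z
... | yes eq = inj₁ (sym eq)
... | no ne  = inj₂ (inj₂ (∈-remove⁺ {v} i ne))

open-tail : ∀ {v U F z} → Open U F z → Open (v ∷ U) F z
open-tail (inj₁ i) = inj₁ (there i)
open-tail (inj₂ i) = inj₂ i

open-untail : ∀ {v U F z} → Open (v ∷ U) F z → z ≡ v ⊎ Open U F z
open-untail (inj₁ (here eq)) = inj₁ eq
open-untail (inj₁ (there i)) = inj₂ (inj₁ i)
open-untail (inj₂ i)         = inj₂ (inj₂ i)

-- Contracting a settled edge

rename-invariant : ∀ {x y} (P : ℕ → Set) z → (P x → P y) → (P y → P x) → (P (rename x y z) → P z) ×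
    (P z → P (rename x y z))
rename-invariant {x} {y} P z f g with z ≡ᵇ x | eqR z x
... | true  | ofʸ refl = g , f
... | false | _        = id , id

live-rename : ∀ {S U F x y} → ¬ Open U F x → ¬ Open U F y → ∀ M →
              live S U F (map (renameEdge x y) M) ≡ map (renameEdge x y) (live S U F M)
live-rename {S} {U} {F} {x} {y} nx ny M = filter-map _ _ _ M λ e →
  bool-cong (aliveR S U F (renameEdge x y e)) (aliveR S U F e)
    (λ (a , b , c) → a ∘ proj₂ (same (proj₁ e)) , b ∘ proj₂ (same (proj₁ (proj₂ e))) , c)
    (λ (a , b , c) → a ∘ proj₁ (same (proj₁ e)) , b ∘ proj₁ (same (proj₁ (proj₂ e))) , c)
  where
  same = λ z → rename-invariant {x} {y} (Blocked S U F) z (λ (_ , o) → contradiction o nx)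
      (λ (_ , o) → contradiction o ny)

contract-view : ∀ x y M → ∃[ a ] ∃[ b ] (contract x y M ≡ map (renameEdge a b) M ×
                  ((a ≡ x × b ≡ y) ⊎ (a ≡ y × b ≡ x)))
contract-view x y M with x ≤ᵇ y
... | true  = y , x , refl , flipped
... | false = x , y , refl , straight

settled-split : ∀ {U F e es} M → filterᵇ (settled U F) M ≡ e ∷ es → M ↭ e ∷ es ++ filterᵇ (λ e → not (settled U F e)) M
settled-split {U} {F} M eq = subst (λ l → M ↭ l ++ filterᵇ (λ e → not (settled U F e)) M) eq
    (filter-part (settled U F) M)

first-satisfies : ∀ {A : Set} (p : A → Bool) {e es} M → filterᵇ p M ≡ e ∷ es → p e ≡ true
first-satisfies p {e} M eq = proj₂ (∈-filterᵇ⁻ p M (subst (e ∈_) (sym eq) (here refl)))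

-- Low vertices

count-≤ : ∀ v z zs → count v zs ≤ count v (z ∷ zs)
count-≤ v z zs rewrite filterᵇ-∷ (v ≡ᵇ_) z zs with v ≡ᵇ z
... | true  = n≤1+n _
... | false = ≤-refl

length-inside : ∀ F v M → length (filterᵇ (inside F) (filterᵇ (touches v) M)) ≤ degree (filterᵇ (inside F) M) v
length-inside F v [] = z≤n
length-inside F v (e@(x , y , A) ∷ M) rewrite filterᵇ-∷ (touches v) e M | filterᵇ-∷ (inside F) e M with touches v e
    | touchesR v e
... | false | _ with inside F e
...   | false = length-inside F v M
...   | true  = ≤-trans (length-inside F v M) (≤-trans (count-≤ v y _) (count-≤ v x _))
length-inside F v (e@(x , y , A) ∷ M) | true | ofʸ t rewrite filterᵇ-∷ (inside F) e (filterᵇ (touches v) M) with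
    inside F e
... | false = length-inside F v M
... | true  = ≤-trans (s≤s (length-inside F v M)) (bump t)
  where
  E = concatMap ends (filterᵇ (inside F) M)
  bump : Touches v e → suc (count v E) ≤ count v (x ∷ y ∷ E)
  bump (inj₁ eq) = ≤-trans (s≤s (count-≤ v y E)) (≤-reflexive (sym (count-yes v (y ∷ E) eq)))
  bump (inj₂ eq) = ≤-trans (≤-reflexive (sym (count-yes v E eq))) (count-≤ v x (y ∷ E))

atMostOne-length : ∀ {A : Set} (xs : List A) → atMostOne xs ≡ true → length xs ≤ 1
atMostOne-length []       _ = z≤n
atMostOne-length (x ∷ []) _ = ≤-refl

length-atMostOne : ∀ {A : Set} (xs : List A) → length xs ≤ 1 → atMostOne xs ≡ true
length-atMostOne []           _         = refl
length-atMostOne (x ∷ [])     _         = refl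
length-atMostOne (x ∷ y ∷ _) (s≤s ())

low-degree : ∀ {F M v} → low F M v ≡ true → degree (filterᵇ (inside F) M) v ≤ 1
low-degree {F} {M} {v} = atMostOne-length (filterᵇ (v ≡ᵇ_) (concatMap ends (filterᵇ (inside F) M)))

degree-loop : ∀ {v A} es → (v , v , A) ∈ es → 2 ≤ degree es v
degree-loop {v} (_ ∷ es) (here refl) = ≤-trans (s≤s (≤-trans (s≤s z≤n) (≤-reflexive (sym (count-yes v _ refl)))))
                                         (≤-reflexive (sym (count-yes v _ refl)))
degree-loop {v} (_ ∷ es) (there i) = ≤-trans (degree-loop es i) (≤-trans (count-≤ v _ _) (count-≤ v _ _))

-- A loop at v would lie inside `F` and contribute two ends there. Without this fact, dropping or
-- smoothing v could destroy a cycle.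
low-loopless : ∀ {F M v e a} → low F M v ≡ true → v ∈ F → e ∈ M → Joins e v a → v ≢ a
low-loopless {F} {M} {v} {e} lo v∈ i j refl = <⇒≱ (degree-loop {v} _ loop) (low-degree {F} {M} {v} lo)
  where
  is-loop : Joins e v v → e ≡ (v , v , proj₂ (proj₂ e))
  is-loop straight = refl
  is-loop flipped = refl
  loop : (v , v , proj₂ (proj₂ e)) ∈ filterᵇ (inside F) M
  loop = ∈-filterᵇ⁺ (inside F) (subst (_∈ M) (is-loop j) i) (true-of (insideR F (v , v , [])) (v∈ , v∈))

touch-split : ∀ v M {es} → filterᵇ (touches v) M ≡ es → M ↭ es ++ untouched v M
touch-split v M eq = subst (λ l → M ↭ l ++ untouched v M) eq (filter-part (touches v) M)

-- Soundness of a step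

out-of : State → List (List ℕ)
out-of (U , F , M , out , g) = out

-- This invariant travels backwards, from the state after a step to the state before it. At the end
-- no edges are left, so it reduces to hitting the clauses; at the start it says that `S` solves the
-- instance.
Sound : List ℕ → State → Set
Sound S (U , F , M , out , g) = Forest (live S U F M) × hits S out ≡ true

truth : ∀ b → b ≡ true ⊎ b ≡ false
truth true  = inj₁ refl
truth false = inj₂ refl

∧-split : ∀ a {b} → a ∧ b ≡ true → a ≡ true × b ≡ true
∧-split true eq = refl , eq

hits-∷ : ∀ S C Cs → hits S (C ∷ Cs) ≡ true → Hit S C × hits S Cs ≡ true
hits-∷ S C Cs eq with ∧-split (hit S C) eq
... | a , b = holds (hitR S C) a , b

hit-singleton : ∀ {S v} → Hit S (v ∷ []) → v ∈ S
hit-singleton (_ , here refl , s) = s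

hit-++ : ∀ {S} A v B → ¬ Hit S A → ¬ (v ∈ S) → ¬ Hit S B → ¬ Hit S (A ++ v ∷ B)
hit-++ A v B a n b (u , i , s) with ∈-++⁻ A i
... | inj₁ j         = a (u , j , s)
... | inj₂ (here refl) = n s
... | inj₂ (there j) = b (u , j , s)

live-↭ : ∀ {S U F M N} → M ↭ N → Forest (live S U F N) → Forest (live S U F M)
live-↭ {S} {U} {F} p φ = forest-↭ (↭-sym (filterᵇ-↭ (alive S U F) p)) φ

alive-at : ∀ {S U F v a} e → Joins e v a → Alive S U F e → ¬ Blocked S U F v × ¬ Blocked S U F a × ¬ Hit S
    (proj₂ (proj₂ e))
alive-at e straight al            = al
alive-at e flipped (a , b , c)   = b , a , c

at-alive : ∀ {S U F v a} e → Joins e v a → ¬ Blocked S U F v → ¬ Blocked S U F a → ¬ Hit S (proj₂ (proj₂ e)) →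
    Alive S U F e
at-alive e straight a b c = a , b , c
at-alive e flipped a b c = b , a , c

-- Whether e is alive makes no difference: expanding the contraction gives a forest that contains e,
-- and the live edges are a sublist of it.
sound-contract : ∀ {S U F M e M′} → M ↭ e ∷ M′ → Settled U F e → proj₁ e ≢ proj₁ (proj₂ e) →
                 Forest (live S U F (contract (proj₁ e) (proj₁ (proj₂ e)) M′)) → Forest (live S U F M)
sound-contract {S} {U} {F} {M} {e@(x , y , A)} {M′} p (nx , ny) ne φ =
  live-↭ {S} {U} {F} p (forest-⊑ (filter-cons-⊑ (alive S U F) e M′) (go (contract-view x y M′)))
  where
  go : ∃[ a ] ∃[ b ] (contract x y M′ ≡ map (renameEdge a b) M′ × ((a ≡ x × b ≡ y) ⊎ (a ≡ y × b ≡ x))) →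
       Forest (e ∷ live S U F M′)
  go (_ , _ , eq , straight) = forest-expand {e} straight ne
    (subst Forest (trans (cong (live S U F) eq) (live-rename {S} nx ny M′)) φ)
  go (_ , _ , eq , flipped) = forest-expand {e} flipped (ne ∘ sym)
    (subst Forest (trans (cong (live S U F) eq) (live-rename {S} ny nx M′)) φ)

module AtVertex (S F : List ℕ) (M : List Edge) (v : ℕ) (v∈ : v ∈ F) (lo : low F M v ≡ true) where

  rest : List Edge
  rest = untouched v M

  F′ : List ℕ
  F′ = remove v F

  L : List Edge
  L = live S [] F′ rest

  shrink : live S [] F rest ⊑ L
  shrink = live-mono {S} {[]} {F} (λ _ → open-remove {v}) rest

  incident : ∀ {e es} → e ∈ es → M ↭ es ++ rest → Touches v e → Joins e v (other v e) × v ≢ other v e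
  incident {e} i p t = joins-other v e t ,
    low-loopless {F} {M} {v} lo v∈ (∈-resp-↭ (↭-sym p) (∈-++⁺ˡ i)) (joins-other v e t)

  touching : ∀ {e es} → filterᵇ (touches v) M ≡ es → e ∈ es → Touches v e
  touching {e} eq i = holds (touchesR v e) (proj₂ (∈-filterᵇ⁻ (touches v) M (subst (e ∈_) (sym eq) i)))

  ends-of : ∀ {e es} → filterᵇ (touches v) M ≡ es → e ∈ es → Joins e v (other v e) × v ≢ other v e
  ends-of eq i = incident i (touch-split v M eq) (touching eq i)

  pendant : ∀ {e es} → filterᵇ (touches v) M ≡ es → e ∈ es → Forest L → Forest (e ∷ L)
  pendant {e} eq i φ with ends-of eq i
  ... | j , ne = forest-pendant {e} j ne (avoids-untouched (alive S [] F′) M) φ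

  sound-drop₀ : filterᵇ (touches v) M ≡ [] → Forest L → Forest (live S [] F M)
  sound-drop₀ eq φ = live-↭ {S} {[]} {F} (touch-split v M eq) (forest-⊑ shrink φ)

  sound-drop₁ : ∀ {e} → filterᵇ (touches v) M ≡ e ∷ [] → Forest L → Forest (live S [] F M)
  sound-drop₁ {e} eq φ = live-↭ {S} {[]} {F} (touch-split v M eq)
    (forest-⊑ (⊆-trans (filter-cons-⊑ (alive S [] F) e rest) (refl ∷ shrink)) (pendant eq (here refl) φ))

  -- If the joined edge is alive, it is subdivided again. If it is dead, then at least one of the
  -- two old edges is dead, and the other is at most a pendant edge at v.
  sound-series : ∀ {e₁ e₂} → filterᵇ (touches v) M ≡ e₁ ∷ e₂ ∷ [] →
                 Forest (live S [] F′ (join v e₁ e₂ ∷ rest)) → Forest (live S [] F M)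
  sound-series {e₁} {e₂} eq φ = live-↭ {S} {[]} {F} (touch-split v M eq) go
    where
    P₁ = ends-of eq (here refl)
    P₂ = ends-of eq (there (here refl))
    both : live S [] F (e₁ ∷ e₂ ∷ rest) ⊑ e₁ ∷ e₂ ∷ L
    both = ⊆-trans (filter-cons-⊑ (alive S [] F) e₁ (e₂ ∷ rest))
        (refl ∷ ⊆-trans (filter-cons-⊑ (alive S [] F) e₂ rest) (refl ∷ shrink))
    smaller : ∀ {a} → ¬ Blocked S [] F a → ¬ Blocked S [] F′ a
    smaller n (s , o) = n (s , open-remove {v} o)
    joined : Alive S [] F e₁ → Alive S [] F e₂ → Alive S [] F′ (join v e₁ e₂)
    joined al₁ al₂ with alive-at e₁ (proj₁ P₁) al₁ | alive-at e₂ (proj₁ P₂) al₂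
    ... | nv , na , h₁ | _ , nb , h₂ = smaller na , smaller nb ,
      hit-++ (proj₂ (proj₂ e₁)) v (proj₂ (proj₂ e₂)) h₁ (λ s → nv (s , inj₂ v∈)) h₂
    go : Forest (live S [] F (e₁ ∷ e₂ ∷ rest))
    go with truth (alive S [] F′ (join v e₁ e₂)) | truth (alive S [] F e₁) | truth (alive S [] F e₂)
    ... | inj₁ t | _ | _ = forest-⊑ both (forest-series {join v e₁ e₂} {e₁} {e₂} straight (proj₁ P₁) (proj₁ P₂)
            (proj₂ P₁) (proj₂ P₂) (avoids-untouched (alive S [] F′) M)
                (subst Forest (filter-yes (alive S [] F′) rest t) φ))
    ... | inj₂ n | inj₁ a | inj₁ b = contradiction (joined (holds (aliveR S [] F e₁) a) (holds (aliveR S [] F e₂) b))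
            (fails (aliveR S [] F′ (join v e₁ e₂)) n)
    ... | inj₂ n | inj₂ a | _ = subst Forest (sym (filter-no (alive S [] F) (e₂ ∷ rest) a))
            (forest-⊑ (⊆-trans (filter-cons-⊑ (alive S [] F) e₂ rest) (refl ∷ shrink))
              (pendant eq (there (here refl)) (subst Forest (filter-no (alive S [] F′) rest n) φ)))
    ... | inj₂ n | inj₁ _ | inj₂ b = forest-⊑ (⊆-trans (filter-cons-⊑ (alive S [] F) e₁ (e₂ ∷ rest))
              (refl ∷ ⊆-trans (⊆-reflexive (filter-no (alive S [] F) rest b)) shrink))
              (pendant eq (here refl) (subst Forest (filter-no (alive S [] F′) rest n) φ))

sound-delete : ∀ S U F M {x y A M′ out g g′} → M ↭ (x , y , A) ∷ M′ →
               Sound S (U , F , M′ , A ∷ out , g′) → Sound S (U , F , M , out , g)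
sound-delete S U F M {x} {y} {A} {M′} {out} p (φ , hs) with hits-∷ S A out hs
... | a , hs′ = live-↭ {S} {U} {F} p (subst Forest (sym (filter-no (alive S U F) M′
                  (false-of (aliveR S U F (x , y , A)) λ (_ , _ , n) → n a))) φ) , hs′

sound-step : ∀ S U F M out g → Sound S (step (U , F , M , out , g)) → Sound S (U , F , M , out , g)
sound-step S U F M out g h with view U F M
sound-step S U F M out g h | resolve x y A es eq st rewrite st out g with head false g | x ≡ᵇ y | eqR x y
... | true  | false | ofⁿ ne = sound-contract {S} {U} {F} (settled-split {U} {F} M eq)
                                 (holds (settledR U F (x , y , A)) (first-satisfies (settled U F) M eq)) ne
                                     (proj₁ h) , proj₂ h
... | true  | true  | _      = sound-delete S U F M {x} {y} {A} {es ++ filterᵇ (λ e → not (settled U F e)) M} {out}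
    {g} {tail g} (settled-split {U} {F} M eq) h
... | false | _     | _      = sound-delete S U F M {x} {y} {A} {es ++ filterᵇ (λ e → not (settled U F e)) M} {out}
    {g} {tail g} (settled-split {U} {F} M eq) h
sound-step S U F M out g h | decide v U′ eq refl st rewrite st out g with head false g
... | true  = forest-⊑ (live-mono {S} {U} {F} {U′} {F} (λ _ → open-tail) M) (proj₁ h) , proj₂ h
... | false = let c , hs = hits-∷ S (v ∷ []) out (proj₂ h) in
              forest-⊑ (live-cut {S} {U} {F} {U′} {F} (hit-singleton c) (inj₁ (here refl)) open-tail M) (proj₁ h) , hs
sound-step S U F M out g h | stuck _ _ _ st rewrite st out g = h
sound-step S U F M out g h | prune v _ refl v∈ lo (inj₁ eq) st rewrite st out g = AtVertex.sound-drop₀ S F M v v∈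
    lo eq (proj₁ h) , proj₂ h
sound-step S U F M out g h | prune v _ refl v∈ lo (inj₂ (e , eq)) st rewrite st out g = AtVertex.sound-drop₁ S F M
    v v∈ lo eq (proj₁ h) , proj₂ h
sound-step S U F M out g h | series v e₁ e₂ _ refl v∈ lo eq st rewrite st out g = AtVertex.sound-series S F M v v∈
    lo eq (proj₁ h) , proj₂ h
sound-step S U F M out g h | branch v e₁ e₂ e₃ es _ refl v∈ lo eq st rewrite st out g with head false g
... | true  = forest-⊑ (live-mono {S} {[]} {F} {[]} {remove v F} (λ _ → open-remove {v}) M) (proj₁ h) , proj₂ h
... | false = let c , hs = hits-∷ S (v ∷ []) out (proj₂ h) in
              forest-⊑ (live-cut {S} {[]} {F} {[]} {remove v F} (hit-singleton c) (inj₂ v∈) (open-remove {v}) M)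
                  (proj₁ h) , hs

sound-repeat : ∀ {A : Set} S (xs : List A) σ → Sound S (repeat xs σ) → Sound S σ
sound-repeat S []       σ h = h
sound-repeat S (x ∷ xs) σ h = sound-repeat S xs σ (sound-step S U F M out g h)
  where
  U = proj₁ (repeat xs σ)
  F = proj₁ (proj₂ (repeat xs σ))
  M = proj₁ (proj₂ (proj₂ (repeat xs σ)))
  out = proj₁ (proj₂ (proj₂ (proj₂ (repeat xs σ))))
  g = proj₂ (proj₂ (proj₂ (proj₂ (repeat xs σ))))

sound-finish : ∀ S σ → hits S (finish σ) ≡ true → Sound S σ
sound-finish S (U , F , [] , out , g) h = tt , h

sound-clauses : ∀ S σ → hits S (clauses σ) ≡ true → Sound S σ
sound-clauses S σ@(U , F , M , _) h =
  sound-repeat S U σ (sound-repeat S F (repeat U σ) (sound-repeat S M (repeat F (repeat U σ))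
    (sound-finish S (repeat M (repeat F (repeat U σ))) h)))

-- Completeness: the guesses dictated by a solution S

among : List ℕ → List ℕ → ℕ
among S xs = length (filterᵇ (λ v → mem v S) xs)

weight : List ℕ → List Edge → ℕ
weight S []                = 0
weight S ((x , y , A) ∷ M) = among S A + weight S M

-- Every name of a vertex of `S` is counted where it is stored: undecided, in the forest, or in a
-- label. Smoothing only moves a name from the forest into a label, while a cut dictated by `S`
-- removes at least one.
charge : List ℕ → List ℕ → List ℕ → List Edge → ℕ
charge S U F M = among S U + (among S F + weight S M)

among-++ : ∀ S xs ys → among S (xs ++ ys) ≡ among S xs + among S ys
among-++ S xs ys = trans (cong length (filter-++ (λ v → mem v S) xs ys)) (length-++ (filterᵇ (λ v → mem v S) xs))

among-yes : ∀ {S v} xs → v ∈ S → among S (v ∷ xs) ≡ suc (among S xs)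
among-yes {S} {v} xs i = cong length (filter-yes (λ v → mem v S) xs (true-of (memR v S) i))

among-no : ∀ {S v} xs → v ∉ S → among S (v ∷ xs) ≡ among S xs
among-no {S} {v} xs n = cong length (filter-no (λ v → mem v S) xs (false-of (memR v S) n))

nonempty : ∀ {A : Set} {x : A} {xs} → x ∈ xs → 1 ≤ length xs
nonempty (here _)  = s≤s z≤n
nonempty (there _) = s≤s z≤n

among-hit : ∀ {S A} → Hit S A → 1 ≤ among S A
among-hit {S} {A} (v , i , s) = nonempty (∈-filterᵇ⁺ (λ v → mem v S) i (true-of (memR v S) s))

among-remove : ∀ {S v F} → v ∈ F → among S (remove v F) + among S (v ∷ []) ≤ among S F
among-remove {S} {v} {F} i with truth (mem v S)
... | inj₁ s = ≤-trans (≤-reflexive (trans (cong₂ _+_ swap-filters (among-yes [] (holds (memR v S) s))) (+-comm _ 1)))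
                 (remove-shorter {v} _ (∈-filterᵇ⁺ (λ v → mem v S) i s))
  where
  swap-filters : among S (remove v F) ≡ length (remove v (filterᵇ (λ v → mem v S) F))
  swap-filters = cong length (trans (filter-filter (λ v → mem v S) (λ u → not (v ≡ᵇ u)) F)
    (trans (same F) (sym (filter-filter (λ u → not (v ≡ᵇ u)) (λ v → mem v S) F))))
    where
    same : ∀ F → filterᵇ (λ u → not (v ≡ᵇ u) ∧ mem u S) F ≡ filterᵇ (λ u → mem u S ∧ not (v ≡ᵇ u)) F
    same []      = refl
    same (u ∷ F) rewrite filterᵇ-∷ (λ u → not (v ≡ᵇ u) ∧ mem u S) u F | filterᵇ-∷ (λ u → mem u S ∧ not (v ≡ᵇ u)) u F
                       | ∧-comm (not (v ≡ᵇ u)) (mem u S) | same F = refl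
... | inj₂ n = ≤-trans (≤-reflexive (trans (cong (among S (remove v F) +_) (among-no [] (fails (memR v S) n)))
    (+-identityʳ _)))
                 (length-⊑ (filter-filter-⊑ (λ v → mem v S) (λ u → not (v ≡ᵇ u)) (λ v → mem v S) F id))
  where
  length-⊑ : ∀ {xs ys : List ℕ} → xs ⊑ ys → length xs ≤ length ys
  length-⊑ []       = z≤n
  length-⊑ (_ ∷ʳ s) = m≤n⇒m≤1+n (length-⊑ s)
  length-⊑ (_ ∷ s)  = s≤s (length-⊑ s)

weight-↭ : ∀ {S M N} → M ↭ N → weight S M ≡ weight S N
weight-↭ refl             = refl
weight-↭ (prep _ p)       = cong (_ +_) (weight-↭ p)
weight-↭ {S} (swap {xs} {ys} e f p) = trans (lemma (among S (proj₂ (proj₂ e))) (among S (proj₂ (proj₂ f)))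
    (weight S xs))
  (cong (λ z → among S (proj₂ (proj₂ f)) + (among S (proj₂ (proj₂ e)) + z)) (weight-↭ {S} p))
  where
  lemma : ∀ a b c → a + (b + c) ≡ b + (a + c)
  lemma = solve-∀
weight-↭ (trans↭ p q)      = trans (weight-↭ p) (weight-↭ q)

weight-filter : ∀ S p M → weight S (filterᵇ p M) ≤ weight S M
weight-filter S p []      = z≤n
weight-filter S p (e ∷ M) rewrite filterᵇ-∷ p e M with p e
... | true  = +-monoʳ-≤ _ (weight-filter S p M)
... | false = ≤-trans (weight-filter S p M) (m≤n+m _ _)

weight-rename : ∀ S x y M → weight S (map (renameEdge x y) M) ≡ weight S M
weight-rename S x y []      = refl
weight-rename S x y (e ∷ M) = cong (_ +_) (weight-rename S x y M)

Known : List ℕ → List ℕ → List ℕ → ℕ → Set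
Known W U F z = z ∈ W ⊎ Open U F z

known-settled : ∀ {W U F z} → ¬ Open U F z → Known W U F z → z ∈ W
known-settled n (inj₁ i) = i
known-settled n (inj₂ o) = contradiction o n

Near : List ℕ → List ℕ → List ℕ → List Edge → Set
Near W U F M = ∀ {x y A} → (x , y , A) ∈ M → Known W U F x × Known W U F y

-- W lists the vertices that have been promoted and not been merged away.
record Good (S W U F : List ℕ) (M : List Edge) : Set where
  constructor good
  field
    inner : Forest (filterᵇ (inside F) M)
    outer : Forest (live S U F M)
    near  : Near W U F M

-- Each settled edge is hit by S or lies in the forest on W.
settled-bound : ∀ {S W U F M} → Good S W U F M → length (filterᵇ (settled U F) M) ≤ charge S U F M + length W
settled-bound {S} {W} {U} {F} {M} G = ≤-trans (split M) (+-mono-≤ (≤-trans (m≤n+m _ (among S F)) (m≤n+m _ (among S U)))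
  (forest-length _ (forest-⊑ smaller (Good.outer G)) inW))
  where
  p : Edge → Bool
  p e = settled U F e ∧ alive S U F e
  split : ∀ M → length (filterᵇ (settled U F) M) ≤ weight S M + length (filterᵇ p M)
  split []      = z≤n
  split (e@(x , y , A) ∷ M) rewrite filterᵇ-∷ (settled U F) e M | filterᵇ-∷ p e M
    with settled U F e | settledR U F e | alive S U F e | aliveR S U F e
  ... | false | _                | _     | _     = ≤-trans (split M) (+-monoˡ-≤ _ (m≤n+m (weight S M) (among S A)))
  ... | true  | _                | true  | _     =
    ≤-trans (s≤s (≤-trans (split M) (+-monoˡ-≤ _ (m≤n+m (weight S M) (among S A))))) (≤-reflexive (sym (+-suc _ _)))
  ... | true  | ofʸ (nx , ny)    | false | ofⁿ n with truth (hit S A)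
  ...   | inj₁ h = ≤-trans (+-mono-≤ (among-hit (holds (hitR S A) h)) (split M))
      (≤-reflexive (sym (+-assoc (among S A) _ _)))
  ...   | inj₂ h = contradiction ((nx ∘ proj₂) , (ny ∘ proj₂) , fails (hitR S A) h) n
  smaller : filterᵇ p M ⊑ live S U F M
  smaller = filter-⊑ _ _ M λ {e} _ eq → proj₂ (∧-split (settled U F e) eq)
  inW : EndsIn W (filterᵇ p M)
  inW {x} {y} {A} i with ∈-filterᵇ⁻ p M i
  ... | j , eq with holds (settledR U F (x , y , A)) (proj₁ (∧-split (settled U F (x , y , A)) eq)) | Good.near G j
  ...   | nx , ny | kx , ky = known-settled nx kx , known-settled ny ky

-- The budget: b guesses remain, the charge bounds the cuts still to come, w terminals,
-- u undecided vertices and q settled edges are left.  A cut lowers the charge, a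
-- contraction lowers w, and a promotion raises w by one but settles two edges, or
-- else lowers u; with 3 (charge + w) + 4 u ≤ b + 2 q every guess is paid for.

budget-resolve : ∀ {x u b q t} → suc t ≤ x → 3 * x + 4 * u ≤ b + 2 * suc q → suc q ≤ x →
                 ∃[ b′ ] (b ≡ suc b′ × 3 * t + 4 * u ≤ b′ + 2 * q)
-- Without a guess left, 3 x ≤ 2 (q + 1) ≤ 2 x, which contradicts x ≥ 1.
budget-resolve {x} {u} {zero} {q} h B le = contradiction
  (≤-by (2 * x + 1) (3 * x) 0 (≤-trans (s≤s z≤n) h) (lemma′ x))
  (<⇒≱ (≤-by (suc (3 * x)) (2 * x + 1) (4 * u) (+-mono-≤ B (*-monoʳ-≤ 2 le)) (lemma x u q)))
  where
  lemma : ∀ x u q → 2 * x + 1 + (3 * x + 4 * u + 2 * suc q) ≡ suc (3 * x) + (0 + 2 * suc q + 2 * x) + 4 * u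
  lemma = solve-∀
  lemma′ : ∀ x → 3 * x + 1 ≡ 2 * x + 1 + x + 0
  lemma′ = solve-∀
budget-resolve {x} {u} {suc b} {q} {t} h B le = b , refl ,
  ≤-by (3 * t + 4 * u) (b + 2 * q) 0 (+-mono-≤ B (*-monoʳ-≤ 3 h)) (lemma x u b q t)
  where
  lemma : ∀ x u b q t → b + 2 * q + (3 * x + 4 * u + 3 * suc t) ≡ 3 * t + 4 * u + (suc b + 2 * suc q + 3 * x) + 0
  lemma = solve-∀

-- The weight 4 of an undecided vertex pays for one guess and for the 3 that a new terminal may
-- cost.
budget-decide : ∀ {x u b q t} → t ≤ suc x → 3 * x + 4 * suc u ≤ b + 2 * 0 → ∃[ b′ ]
    (b ≡ suc b′ × 3 * t + 4 * u ≤ b′ + 2 * q)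
budget-decide {x} {u} {zero} h B = contradiction (≤-trans (m≤n+m _ (3 * x)) B) λ ()
budget-decide {x} {u} {suc b} {q} {t} h B = b , refl ,
  ≤-by (3 * t + 4 * u) (b + 2 * q) (2 * q) (+-mono-≤ B (*-monoʳ-≤ 3 h)) (lemma x u b q t)
  where
  lemma : ∀ x u b q t → b + 2 * q + (3 * x + 4 * suc u + 3 * t) ≡ 3 * t + 4 * u + (suc b + 2 * 0 + 3 * suc x) + 2 * q
  lemma = solve-∀

budget-cut : ∀ {x b q t} → suc t ≤ x → 3 * x + 4 * 0 ≤ b + 2 * 0 → ∃[ b′ ] (b ≡ suc b′ × 3 * t + 4 * 0 ≤ b′ + 2 * q)
budget-cut {suc x} {zero} h ()
budget-cut {x} {suc b} {q} {t} h B = b , refl ,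
  ≤-by (3 * t + 4 * 0) (b + 2 * q) (2 * q + 2) (+-mono-≤ B (*-monoʳ-≤ 3 h)) (lemma x b q t)
  where
  lemma : ∀ x b q t → b + 2 * q + (3 * x + 4 * 0 + 3 * suc t) ≡ 3 * t + 4 * 0 + (suc b + 2 * 0 + 3 * x) + (2 * q + 2)
  lemma = solve-∀

-- A new terminal costs 3 and the guess 1; two newly settled edges pay 2 each. As x ≥ 1 and no
-- settled edge was there before, a guess is indeed left.
budget-promote : ∀ {x b q t} → t ≤ suc x → 1 ≤ x → 2 ≤ q → 3 * x + 4 * 0 ≤ b + 2 * 0 →
                 ∃[ b′ ] (b ≡ suc b′ × 3 * t + 4 * 0 ≤ b′ + 2 * q)
budget-promote {suc x} {zero} h _ _ ()
budget-promote {x} {suc b} {q} {t} h _ le B = b , refl ,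
  ≤-by (3 * t + 4 * 0) (b + 2 * q) 0 (+-mono-≤ B (+-mono-≤ (*-monoʳ-≤ 3 h) (*-monoʳ-≤ 2 le))) (lemma x b q t)
  where
  lemma : ∀ x b q t → b + 2 * q + (3 * x + 4 * 0 + (3 * t + 2 * 2)) ≡ 3 * t + 4 * 0 +
      (suc b + 2 * 0 + (3 * suc x + 2 * q)) + 0
  lemma = solve-∀

-- Preservation of Good

near-cut : ∀ {W U F U′ F′ v M} → (∀ {z} → Open U F z → z ≡ v ⊎ Open U′ F′ z) → Near W U F M → Near W U′ F′
    (untouched v M)
near-cut {W} {U} {F} {U′} {F′} {v} {M} h k {x} {y} {A} i with ∈-filterᵇ⁻ (λ e → not (touches v e)) M i
... | j , _ with k j
...   | kx , ky = keep (n ∘ inj₁) kx , keep (n ∘ inj₂) ky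
  where
  n = untouched-free {v} M i
  keep : ∀ {z} → ¬ (v ≡ z) → Known W U F z → Known W U′ F′ z
  keep ne (inj₁ i) = inj₁ i
  keep ne (inj₂ o) with h o
  ... | inj₁ eq = contradiction (sym eq) ne
  ... | inj₂ o′ = inj₂ o′

good-cut : ∀ {S W U F U′ F′ v M} → (∀ {z} → Open U F z → z ≡ v ⊎ Open U′ F′ z) → (∀ {z} → z ∈ F′ → z ∈ F) →
           Good S W U F M → Good S W U′ F′ (untouched v M)
good-cut {S} {W} {U} {F} {U′} {F′} {v} {M} h sub (good φ ψ k) = good
  (forest-⊑ (filter-filter-⊑ (inside F′) _ (inside F) M
      (λ {e} t → let i , j = holds (insideR F′ e) t in true-of (insideR F e) (sub i , sub j))) φ)
  (forest-⊑ (⊆-trans (live-open {S} {U} {F} {U′} {F′} {v} h (untouched v M) (untouched-free {v} M))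
                     (filter-filter-⊑ (alive S U F) _ (alive S U F) M id)) ψ)
  (near-cut {W} {U} {F} {U′} {F′} {v} {M} h k)

good-promote : ∀ {S W U F U′ F′ v M} → v ∉ S → (∀ {z} → Open U F z → z ≡ v ⊎ Open U′ F′ z) → (∀ {z} → z ∈ F′ → z ∈ F) →
               Good S W U F M → Good S (v ∷ W) U′ F′ M
good-promote {S} {W} {U} {F} {U′} {F′} {v} {M} nv h sub (good φ ψ k) = good
  (forest-⊑ (filter-⊑ _ _ M (λ {e} _ t → let i , j = holds (insideR F′ e) t in true-of (insideR F e)
      (sub i , sub j))) φ)
  (forest-⊑ (live-mono {S} {U′} {F′} {U} {F} still M) ψ)
  (λ i → known (proj₁ (k i)) , known (proj₂ (k i)))
  where
  still : ∀ {z} → z ∈ S → Open U F z → Open U′ F′ z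
  still s o with h o
  ... | inj₁ refl = contradiction s nv
  ... | inj₂ o′   = o′
  known : ∀ {z} → Known W U F z → Known (v ∷ W) U′ F′ z
  known (inj₁ i) = inj₁ (there i)
  known (inj₂ o) with h o
  ... | inj₁ eq = inj₁ (here eq)
  ... | inj₂ o′ = inj₂ o′

forest-less : ∀ p {M e M′} → M ↭ e ∷ M′ → Forest (filterᵇ p M) → Forest (filterᵇ p M′)
forest-less p {e = e} {M′} π φ = forest-⊑ (skip (p e) refl) (forest-↭ (filterᵇ-↭ p π) φ)
  where
  skip : ∀ b → p e ≡ b → filterᵇ p M′ ⊑ filterᵇ p (e ∷ M′)
  skip true  eq rewrite filter-yes p M′ eq = e ∷ʳ ⊆-refl
  skip false eq rewrite filter-no p M′ eq = ⊆-refl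

good-delete : ∀ {S W U F M e M′} → M ↭ e ∷ M′ → Good S W U F M → Good S W U F M′
good-delete {S} {W} {U} {F} p (good φ ψ k) = good (forest-less (inside F) p φ) (forest-less (alive S U F) p ψ)
  (λ i → k (∈-resp-↭ (↭-sym p) (there i)))

-- Since e survives `S`, it belongs to the outer forest, so it is no loop and can be contracted
-- there. The inner forest does not change because neither end lies in `F`. The name a disappears,
-- which lowers the number of terminals.
good-contract : ∀ {S W U F M e M′ a b} → M ↭ e ∷ M′ → Joins e a b → ¬ Open U F a → ¬ Open U F b → Alive S U F e →
                Good S W U F M → Good S (remove a W) U F (map (renameEdge a b) M′) × a ≢ b × a ∈ W
good-contract {S} {W} {U} {F} {M} {e} {M′} {a} {b} p j na nb al G@(good φ ψ k)
  with forest-contract {e} j (subst Forest (filter-yes (alive S U F) M′ (true-of (aliveR S U F e) al))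
      (forest-↭ (filterᵇ-↭ (alive S U F) p) ψ))
... | ne , χ = good inner′ (subst Forest (sym (live-rename {S} na nb M′)) χ) near′ , ne , a∈
  where
  pair : ∀ {x y} → (x ≡ a × y ≡ b) ⊎ (x ≡ b × y ≡ a) → Known W U F x × Known W U F y → a ∈ W × b ∈ W
  pair straight (ka , kb) = known-settled na ka , known-settled nb kb
  pair flipped (kb , ka) = known-settled na ka , known-settled nb kb
  both : a ∈ W × b ∈ W
  both = pair j (k (∈-resp-↭ (↭-sym p) (here refl)))
  a∈ = proj₁ both
  same : filterᵇ (inside F) (map (renameEdge a b) M′) ≡ filterᵇ (inside F) M′
  same = trans (filter-map (renameEdge a b) (inside F) (inside F) M′ λ f → bool-cong (insideR F (renameEdge a b f))
      (insideR F f)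
      (λ (i , l) → proj₁ (rn (proj₁ f)) i , proj₁ (rn (proj₁ (proj₂ f))) l)
          (λ (i , l) → proj₂ (rn (proj₁ f)) i , proj₂ (rn (proj₁ (proj₂ f))) l))
    (map-id-local (All.tabulate λ {f} i → let (x∈ , y∈) = holds (insideR F f) (proj₂ (∈-filterᵇ⁻ (inside F) M′ i)) in
      cong₂ (λ x y → x , y , proj₂ (proj₂ f)) (rename-≢ b λ { refl → na (inj₂ x∈) })
          (rename-≢ b λ { refl → na (inj₂ y∈) })))
    where
    rn = λ z → rename-invariant {a} {b} (_∈ F) z (λ i → contradiction (inj₂ i) na) (λ i → contradiction (inj₂ i) nb)
  inner′ : Forest (filterᵇ (inside F) (map (renameEdge a b) M′))
  inner′ = subst Forest (sym same) (forest-less (inside F) p φ)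
  known : ∀ {z} → Known W U F z → Known (remove a W) U F (rename a b z)
  known (inj₁ i) = inj₁ (rename-∈ ne (proj₂ both) i)
  known {z} (inj₂ o) rewrite rename-≢ {a} {z} b (λ { refl → na o }) = inj₂ o
  near′ : Near (remove a W) U F (map (renameEdge a b) M′)
  near′ i with ∈-map⁻ (renameEdge a b) i
  ... | f , l , refl = let kx , ky = k (∈-resp-↭ (↭-sym p) (there l)) in known kx , known ky

joins-inside : ∀ {F v a} e → Joins e v a → v ∈ F → a ∈ F → Inside F e
joins-inside e straight i j = i , j
joins-inside e flipped i j = j , i

near-joins : ∀ {W U F M v a} e → Near W U F M → e ∈ M → Joins e v a → Known W U F a
near-joins e k i straight = proj₂ (k i)
near-joins e k i flipped = proj₁ (k i)

known-remove : ∀ {W v F a} → v ≢ a → Known W [] F a → Known W [] (remove v F) a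
known-remove ne (inj₁ i) = inj₁ i
known-remove {v = v} ne (inj₂ o) with open-restore {v} o
... | inj₁ eq = contradiction (sym eq) ne
... | inj₂ o′ = inj₂ o′

module GoodVertex (S W F : List ℕ) (M : List Edge) (v : ℕ) (v∈ : v ∈ F) (lo : low F M v ≡ true)
                  (G : Good S W [] F M) where

  open AtVertex S F M v v∈ lo
  open Good G

  few-inside : length (filterᵇ (inside F) (filterᵇ (touches v) M)) ≤ 1
  few-inside = ≤-trans (length-inside F v M) (low-degree {F} {M} {v} lo)

  -- As v is low, its two neighbours are not both in `F`, so the new edge is not part of the inner
  -- forest. If the new edge is alive, then `S` avoids v, which is in its label; hence both old
  -- edges were alive, and smoothing keeps the outer forest acyclic.
  good-series : ∀ {e₁ e₂} → filterᵇ (touches v) M ≡ e₁ ∷ e₂ ∷ [] → Good S W [] F′ (join v e₁ e₂ ∷ rest)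
  good-series {e₁} {e₂} eq = good
    (subst Forest (sym (filter-no (inside F′) rest (false-of (insideR F′ (join v e₁ e₂)) outside))) (Good.inner cut))
    outer′ near′
    where
    P₁ = ends-of eq (here refl)
    P₂ = ends-of eq (there (here refl))
    cut : Good S W [] F′ rest
    cut = good-cut {S} {W} {[]} {F} {[]} {F′} {v} {M} (open-restore {v}) (λ i → proj₁ (∈-remove⁻ {v} F i)) G
    outside : ¬ Inside F′ (join v e₁ e₂)
    outside (i , j) = <⇒≱ (s≤s (s≤s z≤n)) (subst (λ l → length l ≤ 1) (two) few-inside)
      where
      both : inside F e₁ ≡ true × inside F e₂ ≡ true
      both = true-of (insideR F e₁) (joins-inside e₁ (proj₁ P₁) v∈ (proj₁ (∈-remove⁻ {v} F i))) ,
             true-of (insideR F e₂) (joins-inside e₂ (proj₁ P₂) v∈ (proj₁ (∈-remove⁻ {v} F j)))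
      two : filterᵇ (inside F) (filterᵇ (touches v) M) ≡ e₁ ∷ e₂ ∷ []
      two = trans (cong (filterᵇ (inside F)) eq) (trans (filter-yes (inside F) (e₂ ∷ []) (proj₁ both))
              (cong (e₁ ∷_) (filter-yes (inside F) [] (proj₂ both))))
    in-M : ∀ {e} → e ∈ e₁ ∷ e₂ ∷ [] → e ∈ M
    in-M i = ∈-resp-↭ (↭-sym (touch-split v M eq)) (∈-++⁺ˡ i)
    near′ : Near W [] F′ (join v e₁ e₂ ∷ rest)
    near′ (here refl) = known-remove (proj₂ P₁) (near-joins e₁ near (in-M (here refl)) (proj₁ P₁)) ,
                        known-remove (proj₂ P₂) (near-joins e₂ near (in-M (there (here refl))) (proj₁ P₂))
    near′ (there i) = Good.near cut i
    outer′ : Forest (live S [] F′ (join v e₁ e₂ ∷ rest))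
    outer′ with truth (alive S [] F′ (join v e₁ e₂))
    ... | inj₂ n = subst Forest (sym (filter-no (alive S [] F′) rest n)) (Good.outer cut)
    ... | inj₁ t = subst Forest (sym (filter-yes (alive S [] F′) rest t))
        (forest-⊑ (refl {x = join v e₁ e₂} ∷ live-open {S} {[]} {F} {[]} {F′} {v} (open-restore {v}) rest
            (untouched-free {v} M))
          (forest-smooth {join v e₁ e₂} {e₁} {e₂} straight (proj₁ P₁) (proj₁ P₂)
            (subst Forest (trans (filter-yes (alive S [] F) (e₂ ∷ rest) al₁)
                (cong (e₁ ∷_) (filter-yes (alive S [] F) rest al₂)))
              (forest-↭ (filterᵇ-↭ (alive S [] F) (touch-split v M eq)) outer))))
      where
      A₁ = proj₂ (proj₂ e₁)
      A₂ = proj₂ (proj₂ e₂)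
      al : Alive S [] F′ (join v e₁ e₂)
      al = holds (aliveR S [] F′ (join v e₁ e₂)) t
      v∉S : v ∉ S
      v∉S s = proj₂ (proj₂ al) (v , ∈-++⁺ʳ A₁ (here refl) , s)
      larger : ∀ {a} → ¬ Blocked S [] F′ a → ¬ Blocked S [] F a
      larger n (s , o) with open-restore {v} o
      ... | inj₁ refl = v∉S s
      ... | inj₂ o′   = n (s , o′)
      al₁ : alive S [] F e₁ ≡ true
      al₁ = true-of (aliveR S [] F e₁) (at-alive e₁ (proj₁ P₁) (v∉S ∘ proj₁) (larger (proj₁ al))
              λ (u , i , s) → proj₂ (proj₂ al) (u , ∈-++⁺ˡ i , s))
      al₂ : alive S [] F e₂ ≡ true
      al₂ = true-of (aliveR S [] F e₂) (at-alive e₂ (proj₁ P₂) (v∉S ∘ proj₁) (larger (proj₁ (proj₂ al)))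
              λ (u , i , s) → proj₂ (proj₂ al) (u , ∈-++⁺ʳ A₁ (there i) , s))

  charge-series : ∀ {e₁ e₂} → filterᵇ (touches v) M ≡ e₁ ∷ e₂ ∷ [] →
                  charge S [] F′ (join v e₁ e₂ ∷ rest) ≤ charge S [] F M
  charge-series {e₁} {e₂} eq = ≤-by _ _ 0 (among-remove {S} {v} {F} v∈) (begin
      among S F + weight S M + (among S F′ + among S (v ∷ []))
        ≡⟨ cong (λ z → among S F + z + (among S F′ + among S (v ∷ []))) (weight-↭ {S} (touch-split v M eq)) ⟩
      among S F + (a₁ + (a₂ + weight S rest)) + (among S F′ + among S (v ∷ []))
        ≡⟨ lemma (among S F) a₁ a₂ (weight S rest) (among S F′) (among S (v ∷ [])) ⟩
      among S F′ + (a₁ + (among S (v ∷ []) + a₂) + weight S rest) + among S F + 0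
        ≡⟨ cong (λ z → among S F′ + (z + weight S rest) + among S F + 0)
             (sym (trans (among-++ S (proj₂ (proj₂ e₁)) _) (cong (a₁ +_) (among-++ S (v ∷ []) (proj₂ (proj₂ e₂)))))) ⟩
      among S F′ + (among S (proj₂ (proj₂ e₁) ++ v ∷ proj₂ (proj₂ e₂)) + weight S rest) + among S F + 0 ∎)
    where
    open ≡-Reasoning
    a₁ = among S (proj₂ (proj₂ e₁))
    a₂ = among S (proj₂ (proj₂ e₂))
    lemma : ∀ f a b w g c → f + (a + (b + w)) + (g + c) ≡ g + (a + (c + b) + w) + f + 0
    lemma = solve-∀

  -- Of three edges at v only one can lead into F.
  new-settled : ∀ {e₁ e₂ e₃ es} → filterᵇ (touches v) M ≡ e₁ ∷ e₂ ∷ e₃ ∷ es → 2 ≤ length (filterᵇ (settled [] F′) M)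
  new-settled {es = es} eq = +-cancelˡ-≤ 1 _ _ (≤-trans
      (≤-trans (m≤m+n 3 (length es)) (≤-reflexive (cong length (sym eq))))
    (≤-trans (split M) (+-monoˡ-≤ _ few-inside)))
    where
    split : ∀ N → length (filterᵇ (touches v) N) ≤
            length (filterᵇ (inside F) (filterᵇ (touches v) N)) + length (filterᵇ (settled [] F′) N)
    split []      = z≤n
    split (e ∷ N) rewrite filterᵇ-∷ (touches v) e N | filterᵇ-∷ (settled [] F′) e N
      with touches v e | touchesR v e | settled [] F′ e | settledR [] F′ e
    ... | false | _     | false | _ = split N
    ... | false | _     | true  | _ = ≤-trans (split N)
        (+-monoʳ-≤ (length (filterᵇ (inside F) (filterᵇ (touches v) N))) (n≤1+n _))
    ... | true  | ofʸ t | s | r rewrite filterᵇ-∷ (inside F) e (filterᵇ (touches v) N) with inside F e | insideR F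
        e | s | r
    ...   | true  | _     | false | _ = s≤s (split N)
    ...   | true  | _     | true  | _ = s≤s (≤-trans (split N)
        (+-monoʳ-≤ (length (filterᵇ (inside F) (filterᵇ (touches v) N))) (n≤1+n _)))
    ...   | false | _     | true  | _ = ≤-trans (s≤s (split N)) (≤-reflexive (sym (+-suc _ _)))
    ...   | false | ofⁿ m | false | ofⁿ n = contradiction (outer-ends (joins-other v e t)) n
      where
      a = other v e
      v∉F′ : ¬ Open [] F′ v
      v∉F′ (inj₂ i) = proj₂ (∈-remove⁻ {v} F i) refl
      a∉F′ : ¬ Open [] F′ a
      a∉F′ (inj₂ i) = m (joins-inside e (joins-other v e t) v∈ (proj₁ (∈-remove⁻ {v} F i)))
      outer-ends : Joins e v a → Settled [] F′ e
      outer-ends (inj₁ (p , q)) = subst (¬_ ∘ Open [] F′) (sym p) v∉F′ , subst (¬_ ∘ Open [] F′) (sym q) a∉F′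
      outer-ends (inj₂ (p , q)) = subst (¬_ ∘ Open [] F′) (sym p) a∉F′ , subst (¬_ ∘ Open [] F′) (sym q) v∉F′

  -- An edge that is settled once v has left the forest has its ends among v and the terminals, and
  -- it is no loop at v. This provides the positive value that `budget-promote` asks for.
  W-nonempty : ∀ {e₁ e₂ e₃ es} → filterᵇ (touches v) M ≡ e₁ ∷ e₂ ∷ e₃ ∷ es → 1 ≤ length W
  W-nonempty eq with filterᵇ (settled [] F′) M in eq′ | new-settled eq
  ... | (x , y , A) ∷ _ | _ with ∈-filterᵇ⁻ (settled [] F′) M (subst ((x , y , A) ∈_) (sym eq′) (here refl))
  ...   | i , t with holds (settledR [] F′ (x , y , A)) t | near i
  ...     | nx , ny | inj₁ k , _      = nonempty k
  ...     | nx , ny | _ , inj₁ k      = nonempty k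
  ...     | nx , ny | inj₂ o , inj₂ p with open-restore {v} o | open-restore {v} p
  ...       | inj₂ o′   | _        = contradiction o′ nx
  ...       | inj₁ _    | inj₂ p′  = contradiction p′ ny
  ...       | inj₁ refl | inj₁ eq″ = contradiction (sym eq″) (low-loopless {F} {M} {v} lo v∈ i straight)

-- The run

iterStep : ℕ → State → State
iterStep zero    σ = σ
iterStep (suc n) σ = iterStep n (step σ)

edges-of : State → List Edge
edges-of (U , F , M , out , g) = M

Finished : List ℕ → ℕ → State → Set
Finished S limit σ = edges-of σ ≡ [] × hits S (out-of σ) ≡ true × length (out-of σ) ≤ limit

-- The string has length exactly b, because `Full` provides strings of one fixed length; unread
-- guesses are padding. The number of clauses is bounded by the clauses present plus the charge, a
-- sum that no step increases: a cut adds a clause and lowers the charge.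
Done : List ℕ → ℕ → ℕ → List ℕ → List ℕ → List Edge → List (List ℕ) → Set
Done S n b U F M out = ∃[ g ] (length g ≡ b × Finished S (length out + charge S U F M)
    (iterStep n (U , F , M , out , g)))

done-guess : ∀ {S n b U F M out U′ F′ M′ out′} c → (∀ g → step (U , F , M , out , c ∷ g) ≡ (U′ , F′ , M′ , out′ , g)) →
             length out′ + charge S U′ F′ M′ ≤ length out + charge S U F M →
             Done S n b U′ F′ M′ out′ → Done S (suc n) (suc b) U F M out
done-guess {S} {n} c st le (g , len , em , hs , bd) =
  c ∷ g , cong suc len , subst (Finished S _ ∘ iterStep n) (sym (st g)) (em , hs , ≤-trans bd le)

done-go : ∀ {S n b U F M out U′ F′ M′ out′} → (∀ g → step (U , F , M , out , g) ≡ (U′ , F′ , M′ , out′ , g)) →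
          length out′ + charge S U′ F′ M′ ≤ length out + charge S U F M →
          Done S n b U′ F′ M′ out′ → Done S (suc n) b U F M out
done-go {S} {n} st le (g , len , em , hs , bd) =
  g , len , subst (Finished S _ ∘ iterStep n) (sym (st g)) (em , hs , ≤-trans bd le)

hits-cons : ∀ {S C Cs} → Hit S C → hits S Cs ≡ true → hits S (C ∷ Cs) ≡ true
hits-cons {S} {C} h hs rewrite true-of (hitR S C) h = hs

Budget : List ℕ → List ℕ → List ℕ → List ℕ → List Edge → ℕ → Set
Budget S W U F M b = 3 * (charge S U F M + length W) + 4 * length U ≤ b + 2 * length (filterᵇ (settled U F) M)

Measure : List ℕ → List ℕ → List Edge → ℕ
Measure U F M = length U + (length F + length M)

degree-touch : ∀ es {v} → 1 ≤ degree es v → ∃[ e ] (e ∈ es × Touches v e)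
degree-touch (e@(x , y , A) ∷ es) {v} h with v ≟ x | v ≟ y
... | yes p | _     = e , here refl , inj₁ p
... | no _  | yes q = e , here refl , inj₂ q
... | no p  | no q  with degree-touch es {v} (subst (1 ≤_) (trans (count-no v _ p) (count-no v _ q)) h)
...   | f , i , t = f , there i , t

-- With no forest vertex left, every edge would be settled. Otherwise no forest vertex is low; so
-- the forest inside `F` has no leaf and hence no edge, and then any vertex of `F` would be low.
stuck-empty : ∀ {S W F M} → Good S W [] F M → filterᵇ (settled [] F) M ≡ [] → filterᵇ (low F M) F ≡ [] → M ≡ []
stuck-empty {F = F} {[]} G st lw = refl
stuck-empty {F = []} {e ∷ M} G st lw = contradiction
  (subst (e ∈_) st (∈-filterᵇ⁺ (settled [] []) {e} {e ∷ M} (here refl)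
      (true-of (settledR [] [] e) ((λ { (inj₁ ()) ; (inj₂ ()) }) , λ { (inj₁ ()) ; (inj₂ ()) })))) λ ()
stuck-empty {F = f ∷ F} {M} G st lw = contradiction (is-low f (here refl) few) λ ()
  where
  es = filterᵇ (inside (f ∷ F)) M
  is-low : ∀ v → v ∈ f ∷ F → degree es v ≤ 1 → v ∈ []
  is-low v i d = subst (v ∈_) lw (∈-filterᵇ⁺ (low (f ∷ F) M) i
    (length-atMostOne (filterᵇ (v ≡ᵇ_) (concatMap ends es)) d))
  member : ∀ v → 1 ≤ degree es v → v ∈ f ∷ F
  member v h with degree-touch es {v} h
  ... | e , i , t with holds (insideR (f ∷ F) e) (proj₂ (∈-filterᵇ⁻ (inside (f ∷ F)) M i)) | t
  ...   | x∈ , y∈ | inj₁ refl = x∈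
  ...   | x∈ , y∈ | inj₂ refl = y∈
  none : es ≡ []
  none = forest-leafless es (Good.inner G) λ v one → contradiction
    (is-low v (member v (≤-reflexive (sym one))) (≤-reflexive one)) λ ()
  few : degree es f ≤ 1
  few = subst (λ l → degree l f ≤ 1) (sym none) z≤n

iter-stuck : ∀ n {σ} → step σ ≡ σ → iterStep n σ ≡ σ
iter-stuck zero    eq = refl
iter-stuck (suc n) eq = trans (cong (iterStep n) eq) (iter-stuck n eq)

-- The guess is `true` exactly when `S` spares what is being decided: the vertex does not lie in
-- `S`, or the label of the edge is not hit. The budget guarantees that a guess is available
-- whenever one is read by a decision.
complete : ∀ n {S W U F M out b} → Measure U F M ≤ n → Good S W U F M → Budget S W U F M b → hits S out ≡ true →
           Done S n b U F M out
complete zero {M = []} {out} {b} le G B hs = replicate b false , length-replicate b , refl , hs , m≤m+n _ _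
complete zero {U = []} {[]} {_ ∷ _} () G B hs
complete zero {U = []} {_ ∷ _} {_ ∷ _} () G B hs
complete zero {U = _ ∷ _} {M = _ ∷ _} () G B hs
complete (suc n) {S} {W} {U} {F} {M} {out} {b} le G B hs with view U F M
complete (suc n) {S} {W} {U} {F} {M} {out} {b} le G B hs | stuck eq refl lw st =
  replicate b false , length-replicate b , subst (Finished S (length out + charge S [] F M))
      (sym (iter-stuck (suc n) (st out _)))
    (stuck-empty {S} {W} {F} {M} G eq lw , hs , m≤m+n _ _)
complete (suc n) {S} {W} {U} {F} {M} {out} {b} le G B hs | resolve x y A es eq st = go (truth (hit S A))
  where
  M′ = es ++ filterᵇ (λ e → not (settled U F e)) M
  e : Edge
  e = x , y , A
  p : M ↭ e ∷ M′
  p = settled-split {U} {F} M eq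
  set : Settled U F e
  set = holds (settledR U F e) (first-satisfies (settled U F) M eq)
  q′ = length (filterᵇ (settled U F) M′)
  q≡ : length (filterᵇ (settled U F) M) ≡ suc q′
  q≡ = trans (↭-length (filterᵇ-↭ (settled U F) p))
      (cong length (filter-yes (settled U F) M′ (true-of (settledR U F e) set)))
  B′ : 3 * (charge S U F M + length W) + 4 * length U ≤ b + 2 * suc q′
  B′ = subst (λ q → 3 * (charge S U F M + length W) + 4 * length U ≤ b + 2 * q) q≡ B
  few : suc q′ ≤ charge S U F M + length W
  few = subst (_≤ charge S U F M + length W) q≡ (settled-bound {S} {W} {U} {F} {M} G)
  w≡ : weight S M ≡ among S A + weight S M′
  w≡ = weight-↭ {S} p
  charge≤ : ∀ a c → charge S U F (map (renameEdge a c) M′) ≤ charge S U F M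
  charge≤ a c = +-monoʳ-≤ (among S U) (+-monoʳ-≤ (among S F) (≤-trans (≤-reflexive (weight-rename S a c M′))
                  (≤-trans (m≤n+m _ (among S A)) (≤-reflexive (sym w≡)))))
  measure : ∀ M″ → length M″ ≡ length M′ → Measure U F M″ ≤ n
  measure M″ eq′ = s≤s⁻¹ (≤-trans (≤-reflexive (trans (cong (λ l → suc (length U + (length F + l))) eq′)
    (trans (lemma (length U) (length F) (length M′)) (cong (λ l → length U + (length F + l)) (sym (↭-length p)))))) le)
    where
    lemma : ∀ u f m → ℕ.suc (u + (f + m)) ≡ u + (f + suc m)
    lemma = solve-∀
  go : hit S A ≡ true ⊎ hit S A ≡ false → Done S (suc n) b U F M out
  go (inj₁ h) with budget-resolve {charge S U F M + length W} {length U} {b} {q′} {charge S U F M′ + length W}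
                    (≤-by _ _ 0 (among-hit {S} {A} (holds (hitR S A) h))
                        (trans (cong (λ z → among S U + (among S F + z) + length W + 1) w≡)
                      (lemma (among S U) (among S F) (among S A) (weight S M′) (length W)))) B′ few
    where
    lemma : ∀ u f a m w → u + (f + (a + m)) + w + 1 ≡ suc (u + (f + m) + w) + a + 0
    lemma = solve-∀
  ... | b′ , refl , B″ = done-guess {S} {n} {b′} {U} {F} {M} {out} {U} {F} {M′} {A ∷ out} false
      (λ g → st out (false ∷ g))
        (≤-by _ _ 0 (among-hit {S} {A} (holds (hitR S A) h))
            (trans (cong (λ z → length out + (among S U + (among S F + z)) + 1) w≡)
          (lemma (length out) (among S U) (among S F) (among S A) (weight S M′))))
        (complete n {S} {W} {U} {F} {M′} {A ∷ out} {b′} (measure M′ refl)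
            (good-delete {S} {W} {U} {F} {M} {e} {M′} p G) B″ (hits-cons {S} {A} {out} (holds (hitR S A) h) hs))
    where
    lemma : ∀ o u f a m → o + (u + (f + (a + m))) + 1 ≡ suc o + (u + (f + m)) + a + 0
    lemma = solve-∀
  go (inj₂ h) = merge (contract-view x y M′)
    where
    merge : ∃[ a ] ∃[ c ] (contract x y M′ ≡ map (renameEdge a c) M′ × ((a ≡ x × c ≡ y) ⊎ (a ≡ y × c ≡ x))) →
            Done S (suc n) b U F M out
    merge (a , c , ceq , ac) with good-contract {S} {W} {U} {F} {M} {e} {M′} {a} {c} p (joins ac) (na ac) (nc ac)
                                    (proj₁ set ∘ proj₂ , proj₂ set ∘ proj₂ , fails (hitR S A) h) G
      where
      joins : (a ≡ x × c ≡ y) ⊎ (a ≡ y × c ≡ x) → Joins e a c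
      joins straight = straight
      joins flipped = flipped
      na : (a ≡ x × c ≡ y) ⊎ (a ≡ y × c ≡ x) → ¬ Open U F a
      na straight = proj₁ set
      na flipped = proj₂ set
      nc : (a ≡ x × c ≡ y) ⊎ (a ≡ y × c ≡ x) → ¬ Open U F c
      nc straight = proj₂ set
      nc flipped = proj₁ set
    ... | G′ , ne , a∈ with budget-resolve {charge S U F M + length W} {length U} {b} {q′}
        {charge S U F (map (renameEdge a c) M′) + length (remove a W)}
                              (≤-trans (≤-reflexive (sym (+-suc (charge S U F (map (renameEdge a c) M′)) _)))
                                  (+-mono-≤ (charge≤ a c) (remove-shorter {a} W a∈))) B′ few
    ...   | b′ , refl , B″ = done-guess {S} {n} {b′} {U} {F} {M} {out} {U} {F} {M″} {out} true contracted
        (+-monoʳ-≤ (length out) (charge≤ a c))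
            (complete n {S} {remove a W} {U} {F} {M″} {out} {b′} (measure M″ (length-map (renameEdge a c) M′)) G′
              (subst (λ q → 3 * (charge S U F M″ + length (remove a W)) + 4 * length U ≤ b′ + 2 * q) (sym q″) B″) hs)
      where
      M″ = map (renameEdge a c) M′
      sides′ : (a ≡ x × c ≡ y) ⊎ (a ≡ y × c ≡ x) → ¬ Open U F a × ¬ Open U F c × x ≢ y
      sides′ straight = proj₁ set , proj₂ set , ne
      sides′ flipped = proj₂ set , proj₁ set , ne ∘ sym
      sides = sides′ ac
      x≢y : x ≢ y
      x≢y = proj₂ (proj₂ sides)
      contracted : ∀ g → step (U , F , M , out , true ∷ g) ≡ (U , F , M″ , out , g)
      contracted g = trans (st out (true ∷ g)) (trans
        (cong (λ t → if not t then (U , F , contract x y M′ , out , g) else (U , F , M′ , A ∷ out , g))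
            (false-of (eqR x y) x≢y))
        (cong (λ N → U , F , N , out , g) ceq))
      q″ : length (filterᵇ (settled U F) M″) ≡ q′
      q″ = trans (cong length (filter-map (renameEdge a c) (settled U F) (settled U F) M′ λ f →
             bool-cong (settledR U F (renameEdge a c f)) (settledR U F f)
               (λ (i , j) → i ∘ proj₂ (rn (proj₁ f)) , j ∘ proj₂ (rn (proj₁ (proj₂ f))))
               (λ (i , j) → i ∘ proj₁ (rn (proj₁ f)) , j ∘ proj₁ (rn (proj₁ (proj₂ f))))))
             (length-map (renameEdge a c) (filterᵇ (settled U F) M′))
        where
        rn = λ z → rename-invariant {a} {c} (Open U F) z (λ o → contradiction o (proj₁ sides))
            (λ o → contradiction o (proj₁ (proj₂ sides)))
complete (suc n) {S} {W} {.(v ∷ U)} {F} {M} {out} {b} le G B hs | decide v U eq refl st = go (truth (mem v S))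
  where
  B′ : 3 * (charge S (v ∷ U) F M + length W) + 4 * suc (length U) ≤ b + 2 * 0
  B′ = subst (λ l → 3 * (charge S (v ∷ U) F M + length W) + 4 * suc (length U) ≤ b + 2 * length l) eq B
  less : mem v S ≡ true → suc (charge S U F (untouched v M)) ≤ charge S (v ∷ U) F M
  less h = +-mono-≤ (≤-reflexive (sym (among-yes {S} {v} U (holds (memR v S) h))))
             (+-monoʳ-≤ (among S F) (weight-filter S (λ e → not (touches v e)) M))
  go : mem v S ≡ true ⊎ mem v S ≡ false → Done S (suc n) b (v ∷ U) F M out
  go (inj₁ h) with budget-decide {charge S (v ∷ U) F M + length W} {length U} {b}
      {length (filterᵇ (settled U F) (untouched v M))}
                     {charge S U F (untouched v M) + length W}
                         (≤-trans (+-monoˡ-≤ (length W) (≤-trans (n≤1+n _) (less h))) (n≤1+n _)) B′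
  ... | b′ , refl , B″ = done-guess {S} {n} {b′} {v ∷ U} {F} {M} {out} {U} {F} {untouched v M} {(v ∷ []) ∷ out}
      false (λ g → st out (false ∷ g))
        (≤-trans (≤-reflexive (sym (+-suc (length out) _))) (+-monoʳ-≤ (length out) (less h)))
        (complete n {S} {W} {U} {F} {untouched v M} {(v ∷ []) ∷ out} {b′}
            (≤-trans (+-monoʳ-≤ (length U) (+-monoʳ-≤ (length F) (filterᵇ-length (λ e → not (touches v e)) M)))
            (s≤s⁻¹ le))
          (good-cut {S} {W} {v ∷ U} {F} {U} {F} {v} {M} open-untail id G) B″
              (hits-cons {S} {v ∷ []} {out} (v , here refl , holds (memR v S) h) hs))
  go (inj₂ h) with budget-decide {charge S (v ∷ U) F M + length W} {length U} {b} {length (filterᵇ (settled U F) M)}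
                     {charge S U F M + length (v ∷ W)}
                     (≤-reflexive (trans (+-suc _ _)
                         (cong (λ z → suc (z + (among S F + weight S M) + length W))
                         (sym (among-no {S} {v} U (fails (memR v S) h)))))) B′
  ... | b′ , refl , B″ = done-guess {S} {n} {b′} {v ∷ U} {F} {M} {out} {U} {F} {M} {out} true (λ g → st out (true ∷ g))
        (+-monoʳ-≤ (length out) (≤-reflexive (cong (_+ (among S F + weight S M))
            (sym (among-no {S} {v} U (fails (memR v S) h))))))
        (complete n {S} {v ∷ W} {U} {F} {M} {out} {b′} (s≤s⁻¹ le)
            (good-promote {S} {W} {v ∷ U} {F} {U} {F} {v} {M} (fails (memR v S) h) open-untail id G) B″ hs)
complete (suc n) {S} {W} {U} {F} {M} {out} {b} le G B hs | prune v eq refl v∈ lo _ st =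
  done-go {S} {n} {b} {[]} {F} {M} {out} {[]} {remove v F} {untouched v M} {out} (st out) (+-monoʳ-≤ (length out) less)
    (complete n {S} {W} {[]} {remove v F} {untouched v M} {out} {b}
        (s≤s⁻¹ (≤-trans (+-mono-≤ (remove-shorter {v} F v∈) (filterᵇ-length (λ e → not (touches v e)) M)) le))
      (good-cut {S} {W} {[]} {F} {[]} {remove v F} {v} {M} (open-restore {v}) (λ i → proj₁ (∈-remove⁻ {v} F i)) G)
      (≤-trans (+-monoˡ-≤ 0 (*-monoʳ-≤ 3 (+-monoˡ-≤ (length W) less)))
        (≤-trans (subst (λ l → 3 * (charge S [] F M + length W) + 0 ≤ b + 2 * length l) eq B) (+-monoʳ-≤ b z≤n))) hs)
  where
  less : charge S [] (remove v F) (untouched v M) ≤ charge S [] F M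
  less = +-mono-≤ (≤-trans (m≤m+n _ _) (among-remove {S} {v} {F} v∈)) (weight-filter S (λ e → not (touches v e)) M)
complete (suc n) {S} {W} {U} {F} {M} {out} {b} le G B hs | series v e₁ e₂ eq refl v∈ lo eq′ st =
  done-go {S} {n} {b} {[]} {F} {M} {out} {[]} {remove v F} {join v e₁ e₂ ∷ untouched v M} {out} (st out)
      (+-monoʳ-≤ (length out) less)
    (complete n {S} {W} {[]} {remove v F} {join v e₁ e₂ ∷ untouched v M} {out} {b}
        (s≤s⁻¹ (≤-trans (+-mono-≤ (remove-shorter {v} F v∈) shorter) le))
      (GoodVertex.good-series S W F M v v∈ lo G eq′)
      (≤-trans (+-monoˡ-≤ 0 (*-monoʳ-≤ 3 (+-monoˡ-≤ (length W) less)))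
        (≤-trans (subst (λ l → 3 * (charge S [] F M + length W) + 0 ≤ b + 2 * length l) eq B) (+-monoʳ-≤ b z≤n))) hs)
  where
  less = GoodVertex.charge-series S W F M v v∈ lo G eq′
  shorter : suc (length (untouched v M)) ≤ length M
  shorter = ≤-trans (n≤1+n (suc (length (untouched v M)))) (≤-reflexive (sym (↭-length (touch-split v M eq′))))
complete (suc n) {S} {W} {U} {F} {M} {out} {b} le G B hs | branch v e₁ e₂ e₃ es eq refl v∈ lo eq′ st = go
    (truth (mem v S))
  where
  F′ = remove v F
  B′ : 3 * (charge S [] F M + length W) + 4 * 0 ≤ b + 2 * 0
  B′ = subst (λ l → 3 * (charge S [] F M + length W) + 4 * 0 ≤ b + 2 * length l) eq B
  F′≤ : among S F′ ≤ among S F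
  F′≤ = ≤-trans (m≤m+n _ _) (among-remove {S} {v} {F} v∈)
  less : mem v S ≡ true → suc (charge S [] F′ (untouched v M)) ≤ charge S [] F M
  less h = +-mono-≤ (≤-trans (≤-reflexive (trans (+-comm 1 _)
      (cong (among S F′ +_) (sym (among-yes {S} {v} [] (holds (memR v S) h))))))
             (among-remove {S} {v} {F} v∈)) (weight-filter S (λ e → not (touches v e)) M)
  go : mem v S ≡ true ⊎ mem v S ≡ false → Done S (suc n) b [] F M out
  go (inj₁ h) with budget-cut {charge S [] F M + length W} {b} {length (filterᵇ (settled [] F′) (untouched v M))}
                     {charge S [] F′ (untouched v M) + length W} (+-monoˡ-≤ (length W) (less h)) B′
  ... | b′ , refl , B″ = done-guess {S} {n} {b′} {[]} {F} {M} {out} {[]} {F′} {untouched v M} {(v ∷ []) ∷ out}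
      false (λ g → st out (false ∷ g))
        (≤-trans (≤-reflexive (sym (+-suc (length out) _))) (+-monoʳ-≤ (length out) (less h)))
        (complete n {S} {W} {[]} {F′} {untouched v M} {(v ∷ []) ∷ out} {b′}
            (s≤s⁻¹ (≤-trans (+-mono-≤ (remove-shorter {v} F v∈) (filterᵇ-length (λ e → not (touches v e)) M)) le))
          (good-cut {S} {W} {[]} {F} {[]} {F′} {v} {M} (open-restore {v}) (λ i → proj₁ (∈-remove⁻ {v} F i)) G) B″
              (hits-cons {S} {v ∷ []} {out} (v , here refl , holds (memR v S) h) hs))
  go (inj₂ h) with budget-promote {charge S [] F M + length W} {b} {length (filterᵇ (settled [] F′) M)}
                     {charge S [] F′ M + length (v ∷ W)}
                     (≤-trans (≤-reflexive (+-suc _ _)) (s≤s (+-monoˡ-≤ (length W) (+-monoˡ-≤ (weight S M) F′≤))))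
                     (≤-trans (GoodVertex.W-nonempty S W F M v v∈ lo G eq′) (m≤n+m _ _))
                     (GoodVertex.new-settled S W F M v v∈ lo G eq′) B′
  ... | b′ , refl , B″ = done-guess {S} {n} {b′} {[]} {F} {M} {out} {[]} {F′} {M} {out} true (λ g → st out (true ∷ g))
        (+-monoʳ-≤ (length out) (+-monoˡ-≤ (weight S M) F′≤))
        (complete n {S} {v ∷ W} {[]} {F′} {M} {out} {b′}
            (s≤s⁻¹ (≤-trans (+-monoˡ-≤ (length M) (remove-shorter {v} F v∈)) le))
          (good-promote {S} {W} {[]} {F} {[]} {F′} {v} {M} (fails (memR v S) h) (open-restore {v})
              (λ i → proj₁ (∈-remove⁻ {v} F i)) G) B″ hs)

-- Running a whole colour

-- With `S` as the list of open vertices, a vertex is blocked exactly when it lies in `S`. The edges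
-- carry empty labels here, so those avoiding `S` are required to form a forest.
Solves : Bool → Matrix → List ℕ → List ℕ → Set
Solves c m V S = Forest (live S S [] (edges c m V))

Full : ℕ → List (List Bool) → Set
Full L pool = ∀ g → length g ≡ L → g ∈ pool

edges-ends : ∀ c m V {x y A} → (x , y , A) ∈ edges c m V → x ∈ V × y ∈ V × A ≡ []
edges-ends c m (v ∷ V) {x} {y} i with ∈-++⁻ (map (λ y → v , y , []) (filterᵇ (λ y → colour? c (entry m v y)) V)) i
... | inj₂ j = let k , l , eq = edges-ends c m V j in there k , there l , eq
... | inj₁ j with ∈-map⁻ (λ y → v , y , []) j
...   | _ , k , refl = here refl , there (proj₁ (∈-filterᵇ⁻ (λ y → colour? c (entry m v y)) V k)) , refl

blocked-self : ∀ {S U F z} → Blocked S U F z → Blocked S S [] z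
blocked-self (s , _) = s , inj₁ s

complement : List ℕ → List ℕ → List ℕ
complement T V = filterᵇ (λ v → not (mem v T)) V

open-all : ∀ T V {z} → z ∈ V → Open T (complement T V) z
open-all T V {z} i with truth (mem z T)
... | inj₁ t = inj₁ (holds (memR z T) t)
... | inj₂ n = inj₂ (∈-filterᵇ⁺ (λ v → not (mem v T)) i (cong not n))

solves-live : ∀ c m V T S → Solves c m V S → Forest (live S T (complement T V) (edges c m V))
solves-live c m V T S = forest-⊑ (filter-⊑ _ _ (edges c m V) λ {e} i a → true-of (aliveR S S [] e)
    (back e i (holds (aliveR S T (complement T V) e) a)))
  where
  back : ∀ e → e ∈ edges c m V → Alive S T (complement T V) e → Alive S S [] e
  back e i (a , b , h) = let x∈ , y∈ , _ = edges-ends c m V i in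
    (λ (s , _) → a (s , open-all T V x∈)) , (λ (s , _) → b (s , open-all T V y∈)) , h

live-solves : ∀ c m V T S → Forest (live S T (complement T V) (edges c m V)) → Solves c m V S
live-solves c m V T S = forest-⊑ (filter-⊑ _ _ (edges c m V) λ {e} i a → true-of (aliveR S T (complement T V) e)
    (back e (holds (aliveR S S [] e) a)))
  where
  back : ∀ e → Alive S S [] e → Alive S T (complement T V) e
  back e (a , b , h) = a ∘ blocked-self , b ∘ blocked-self , h

systems-sound : ∀ c m T V pool {S Cs} → Cs ∈ systems c m T V pool → hits S Cs ≡ true → Solves c m V S
systems-sound c m T V pool {S} i h with ∈-map⁻ (λ g → clauses (initial c m T V g)) i
... | g , _ , refl = live-solves c m V T S (proj₁ (sound-clauses S (initial c m T V g) h))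

iter-step : ∀ n σ → iterStep n (step σ) ≡ step (iterStep n σ)
iter-step zero    σ = refl
iter-step (suc n) σ = iter-step n (step σ)

iter-+ : ∀ a b σ → iterStep b (iterStep a σ) ≡ iterStep (a + b) σ
iter-+ zero    b σ = refl
iter-+ (suc a) b σ = iter-+ a b (step σ)

repeat-iter : ∀ {A : Set} (xs : List A) σ → repeat xs σ ≡ iterStep (length xs) σ
repeat-iter []       σ = refl
repeat-iter (x ∷ xs) σ = trans (cong step (repeat-iter xs σ)) (sym (iter-step (length xs) σ))

clauses-iter : ∀ U F M out g → clauses (U , F , M , out , g) ≡ finish (iterStep (Measure U F M) (U , F , M , out , g))
clauses-iter U F M out g = cong finish (trans (repeat-iter M _)
    (trans (cong (iterStep (length M)) (trans (repeat-iter F _)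
  (trans (cong (iterStep (length F)) (repeat-iter U σ)) (iter-+ (length U) (length F) σ))))
  (trans (iter-+ (length U + length F) (length M) σ)
      (cong (λ n → iterStep n σ) (+-assoc (length U) (length F) (length M))))))
  where
  σ = U , F , M , out , g

finish-done : ∀ S limit σ → Finished S limit σ → hits S (finish σ) ≡ true × length (finish σ) ≤ limit
finish-done S limit (U , F , [] , out , g) (refl , h , le) = h , le

weight-unlabelled : ∀ S M → (∀ {x y A} → (x , y , A) ∈ M → A ≡ []) → weight S M ≡ 0
weight-unlabelled S []                h = refl
weight-unlabelled S ((x , y , A) ∷ M) h rewrite h (here refl) = weight-unlabelled S M (h ∘ there)

length-sub : ∀ {A : Set} {xs ys : List A} → xs ⊑ ys → length xs ≤ length ys
length-sub []       = z≤n
length-sub (_ ∷ʳ s) = m≤n⇒m≤1+n (length-sub s)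
length-sub (_ ∷ s)  = s≤s (length-sub s)

-- 10 (k + 1) ≥ 3 (2 k + 1) + 4 (k + 1): at the start the charge is at most 2 k + 1,
-- and there are at most k + 1 undecided vertices.
guesses : ℕ → ℕ
guesses k = 10 * suc k

charge-initial : ∀ c m T V {S k} → length T ≤ suc k → among S V ≤ k →
               charge S T (complement T V) (edges c m V) ≤ suc (2 * k)
charge-initial c m T V {S} {k} T≤ S≤ = +-mono-≤ (≤-trans (filterᵇ-length _ T) T≤)
  (+-mono-≤ (≤-trans (length-sub (filter-filter-⊑ (λ v → mem v S) (λ v → not (mem v T)) (λ v → mem v S) V id)) S≤)
    (≤-reflexive (weight-unlabelled S (edges c m V) (λ i → proj₂ (proj₂ (edges-ends c m V i))))))

-- The old solution `T` supplies the inner forest of the initial state and the wanted solution `S`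
-- the outer one. There are no terminals yet, so the budget has to cover the charge and the
-- undecided vertices only.
systems-complete : ∀ c m T V pool {S k} → Full (guesses k) pool → Solves c m V T → Solves c m V S →
                   length T ≤ suc k → among S V ≤ k →
                   ∃[ Cs ] (Cs ∈ systems c m T V pool × hits S Cs ≡ true × length Cs ≤ suc (2 * k))
systems-complete c m T V pool {S} {k} full solT solS T≤ S≤
  = conclude (complete (Measure T F E) {S} {[]} {T} {F} {E} {[]} {guesses k} ≤-refl G budget refl)
  where
  F = complement T V
  E = edges c m V
  budget : Budget S [] T F E (guesses k)
  budget = ≤-trans (+-mono-≤ (*-monoʳ-≤ 3 (≤-trans (≤-reflexive (+-identityʳ _))
      (charge-initial c m T V {S} T≤ S≤))) (*-monoʳ-≤ 4 T≤))
    (≤-trans (≤-by _ _ 3 (≤-refl {0}) (lemma k)) (m≤m+n _ _))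
    where
    lemma : ∀ k → 10 * suc k + 0 ≡ 3 * suc (2 * k) + 4 * suc k + 0 + 3
    lemma = solve-∀
  G : Good S [] T F E
  G = good (forest-⊑ (filter-⊑ _ _ E λ {e} i t → true-of (aliveR T T [] e) (out-of-T e i (holds (insideR F e) t))) solT)
           (solves-live c m V T S solS)
           (λ i → let x∈ , y∈ , _ = edges-ends c m V i in inj₂ (open-all T V x∈) , inj₂ (open-all T V y∈))
    where
    avoid : ∀ {z} → z ∈ F → ¬ Blocked T T [] z
    avoid {z} i (t , _) with ∈-filterᵇ⁻ (λ v → not (mem v T)) V i
    ... | _ , eq rewrite true-of (memR z T) t = contradiction eq λ ()
    out-of-T : ∀ e → e ∈ E → Inside F e → Alive T T [] e
    out-of-T e i (x∈ , y∈) with edges-ends c m V i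
    ... | _ , _ , refl = avoid x∈ , avoid y∈ , λ { (_ , () , _) }
  conclude : Done S (Measure T F E) (guesses k) T F E [] →
             ∃[ Cs ] (Cs ∈ systems c m T V pool × hits S Cs ≡ true × length Cs ≤ suc (2 * k))
  conclude (g , len , fin) with finish-done S (charge S T F E) (iterStep (Measure T F E) (T , F , E , [] , g)) fin
  ... | h , le = clauses (initial c m T V g) , ∈-map⁺ (λ g → clauses (initial c m T V g)) (full g len) ,
    trans (cong (hits S) (clauses-iter T F E [] g)) h ,
    ≤-trans (≤-reflexive (cong length (clauses-iter T F E [] g))) (≤-trans le (charge-initial c m T V {S} T≤ S≤))

-- Hitting a few clauses

Satisfies : List ℕ → (List ℕ → Bool) → List (List ℕ) → Set
Satisfies S p Cs = ∀ {C} → C ∈ Cs → p C ≡ true → Hit S C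

hits⁺ : ∀ {S} Cs → (∀ {C} → C ∈ Cs → Hit S C) → hits S Cs ≡ true
hits⁺ []       h = refl
hits⁺ {S} (C ∷ Cs) h = hits-cons {S} {C} {Cs} (h (here refl)) (hits⁺ Cs (h ∘ there))

hits⁻ : ∀ {S} Cs → hits S Cs ≡ true → ∀ {C} → C ∈ Cs → Hit S C
hits⁻ {S} (C ∷ Cs) h (here refl) = proj₁ (hits-∷ S C Cs h)
hits⁻ {S} (C ∷ Cs) h (there i)   = hits⁻ Cs (proj₂ (hits-∷ S C Cs h)) i

-- The state of the selection after j bits chosen according to p: the second component contains
-- selected clauses only, and every clause satisfying p is selected or still waits for a bit.
record Picks (p : List ℕ → Bool) (Cs : List (List ℕ)) (j : ℕ) (r : List (List ℕ) × List (List ℕ)) : Set where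
  constructor picks
  field
    sound : ∀ {C} → C ∈ proj₂ r → C ∈ Cs × p C ≡ true
    cover : ∀ {C} → C ∈ Cs → p C ≡ true → C ∈ proj₁ r ⊎ C ∈ proj₂ r
    from  : ∀ {C} → C ∈ proj₁ r → C ∈ Cs
    short : length (proj₁ r) ≤ length Cs ∸ j

pick-exists : ∀ p Cs j → ∃[ bs ] (length bs ≡ j × Picks p Cs j (pick bs Cs))
pick-exists p Cs zero = [] , refl , picks (λ ()) (λ i _ → inj₁ i) id ≤-refl
pick-exists p Cs (suc j) with pick-exists p Cs j
... | bs , len , P with pick bs Cs in eq
...   | [] , out = false ∷ bs , cong suc len , subst (Picks p Cs (suc j)) (sym (empty eq))
        (picks (Picks.sound P) (Picks.cover P) (λ ()) z≤n)
  where
  empty : pick bs Cs ≡ ([] , out) → pick (false ∷ bs) Cs ≡ ([] , out)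
  empty eq rewrite eq = refl
...   | C ∷ rest , out = p C ∷ bs , cong suc len , subst (Picks p Cs (suc j)) (sym (full eq)) (next (truth (p C)))
  where
  full : pick bs Cs ≡ (C ∷ rest , out) → pick (p C ∷ bs) Cs ≡ (rest , (if p C then C ∷ out else out))
  full eq rewrite eq = refl
  shorter : length rest ≤ length Cs ∸ suc j
  shorter = ≤-trans (∸-monoˡ-≤ 1 (Picks.short P))
      (≤-reflexive (trans (∸-+-assoc (length Cs) j 1) (cong (length Cs ∸_) (+-comm j 1))))
  next : p C ≡ true ⊎ p C ≡ false → Picks p Cs (suc j) (rest , (if p C then C ∷ out else out))
  next (inj₁ t) rewrite t = picks
    (λ { (here refl) → Picks.from P (here refl) , t ; (there i) → Picks.sound P i })
    (λ i q → sort i q (Picks.cover P i q)) (Picks.from P ∘ there) shorter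
    where
    sort : ∀ {D} → D ∈ Cs → p D ≡ true → D ∈ C ∷ rest ⊎ D ∈ out → D ∈ rest ⊎ D ∈ C ∷ out
    sort _ _ (inj₁ (here refl)) = inj₂ (here refl)
    sort _ _ (inj₁ (there i))   = inj₁ i
    sort _ _ (inj₂ i)           = inj₂ (there i)
  next (inj₂ f) rewrite f = picks (Picks.sound P)
    (λ i q → sort i q (Picks.cover P i q)) (Picks.from P ∘ there) shorter
    where
    sort : ∀ {D} → D ∈ Cs → p D ≡ true → D ∈ C ∷ rest ⊎ D ∈ out → D ∈ rest ⊎ D ∈ out
    sort _ q (inj₁ (here refl)) = contradiction (trans (sym q) f) λ ()
    sort _ _ (inj₁ (there i))   = inj₁ i
    sort _ _ (inj₂ i)           = inj₂ i

∈-concatMap⁺ : ∀ {A B : Set} {f : A → List B} {x y} xs → x ∈ xs → y ∈ f x → y ∈ concatMap f xs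
∈-concatMap⁺ (_ ∷ xs) (here refl) j = ∈-++⁺ˡ j
∈-concatMap⁺ {f = f} (x ∷ xs) (there i) j = ∈-++⁺ʳ (f x) (∈-concatMap⁺ xs i j)

∈-concatMap⁻ : ∀ {A B : Set} {f : A → List B} {y} xs → y ∈ concatMap f xs → ∃[ x ] (x ∈ xs × y ∈ f x)
∈-concatMap⁻ {f = f} (x ∷ xs) i with ∈-++⁻ (f x) i
... | inj₁ j = x , here refl , j
... | inj₂ j = let z , k , l = ∈-concatMap⁻ xs j in z , there k , l

first-∈ : ∀ {A : Set} {x : A} xs → x ∈ first xs → x ∈ xs
first-∈ (x ∷ xs) (here eq) = here eq

first-nonempty : ∀ {A : Set} {x : A} xs → x ∈ xs → ∃[ y ] (y ∈ first xs)
first-nonempty (x ∷ xs) _ = x , here refl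

represent-short : ∀ V Cs pool k {S} → S ∈ represent V Cs pool k → length S ≤ k
represent-short V Cs pool zero    (here refl) = z≤n
represent-short V Cs pool (suc k) i with ∈-concatMap⁻ pool i
... | bs , _ , j with ∈-++⁻ (represent V Cs pool k) (proj₁ (∈-filterᵇ⁻ _ _ (first-∈ _ j)))
...   | inj₁ l = m≤n⇒m≤1+n (represent-short V Cs pool k l)
...   | inj₂ l with ∈-concatMap⁻ V l
...     | v , _ , r with ∈-map⁻ (v ∷_) r
...       | S′ , s , refl = s≤s (represent-short V Cs pool k s)

-- For a solution `v ∷ S`, the clauses that v misses are hit by S, so the previous table contains a
-- set doing the same; adding v to it yields a candidate. The entry kept for the clauses satisfying
-- p may differ from it, but it hits them too. The induction needs arbitrary p because the clauses
-- containing v are taken out.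
represent-complete : ∀ V Cs {pool L} → Full L pool → length Cs ≤ L → ∀ k S p → length S ≤ k → (∀ {v} → v ∈ S → v ∈ V) →
                     Satisfies S p Cs → ∃[ S′ ] (S′ ∈ represent V Cs pool k × Satisfies S′ p Cs)
represent-complete V Cs {pool} {L} full le zero    []      p z≤n sub sat = [] , here refl , sat
represent-complete V Cs {pool} {L} full le (suc k) S p S≤ sub sat with candidate S S≤ sub sat
  where
  table = represent V Cs pool k
  candidate : ∀ S → length S ≤ suc k → (∀ {v} → v ∈ S → v ∈ V) → Satisfies S p Cs →
              ∃[ S′ ] (S′ ∈ candidates V table × Satisfies S′ p Cs)
  candidate []      _        sub sat with represent-complete V Cs {pool} {L} full le k [] p z≤n sub sat
  ... | S′ , i , sat′ = S′ , ∈-++⁺ˡ i , sat′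
  candidate (v ∷ S) (s≤s le′) sub sat with represent-complete V Cs {pool} {L} full le k S
      (λ C → p C ∧ not (mem v C)) le′ (sub ∘ there) sat″
    where
    sat″ : Satisfies S (λ C → p C ∧ not (mem v C)) Cs
    sat″ {C} i q with ∧-split (p C) q
    ... | pc , nv with sat i pc
    ...   | u , j , there s   = u , j , s
    ...   | u , j , here refl rewrite true-of (memR v C) j = contradiction nv λ ()
  ... | S′ , i , sat′ = v ∷ S′ , ∈-++⁺ʳ table (∈-concatMap⁺ V (sub (here refl)) (∈-map⁺ (v ∷_) i)) , sat‴
    where
    sat‴ : Satisfies (v ∷ S′) p Cs
    sat‴ {C} i q with truth (mem v C)
    ... | inj₁ t = v , holds (memR v C) t , here refl
    ... | inj₂ f with sat′ i (trans (cong₂ _∧_ q (cong not f)) refl)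
    ...   | u , j , s = u , j , there s
... | S′ , i , sat′ with pick-exists p Cs L
...   | bs , len , P with first-nonempty _ (∈-filterᵇ⁺ (λ S → hits S (proj₂ (pick bs Cs))) i
                            (hits⁺ (proj₂ (pick bs Cs)) λ j → let k , q = Picks.sound P j in sat′ k q))
...     | S″ , j = S″ , ∈-concatMap⁺ pool (full bs len) j , good-enough
  where
  good-enough : Satisfies S″ p Cs
  good-enough {C} i q with Picks.cover P i q
  ... | inj₂ l = hits⁻ (proj₂ (pick bs Cs)) (proj₂
      (∈-filterᵇ⁻ (λ S → hits S (proj₂ (pick bs Cs))) (candidates V (represent V Cs pool k)) (first-∈ _ j))) l
  -- There are L bits and at most L clauses, so no clause is left without a bit.
  ... | inj₁ l = contradiction (nonempty l) (<⇒≱ (s≤s (≤-trans (Picks.short P) (≤-reflexive (m≤n⇒m∸n≡0 le)))))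

-- Correctness of the compression

Valid : Matrix → ℕ → List ℕ → List ℕ → Set
Valid m k V S = (∀ c → Solves c m V S) × length S ≤ k

hits-++ : ∀ {S} Bs Rs → hits S (Bs ++ Rs) ≡ true → hits S Bs ≡ true × hits S Rs ≡ true
hits-++ {S} Bs Rs h = hits⁺ {S} Bs (λ i → hits⁻ {S} (Bs ++ Rs) h (∈-++⁺ˡ i)) , hits⁺ {S} Rs
    (λ i → hits⁻ {S} (Bs ++ Rs) h (∈-++⁺ʳ Bs i))

hitting-sound : ∀ V Cs pool k {S} → S ∈ hitting V Cs pool k → hits S Cs ≡ true × length S ≤ k
hitting-sound V Cs pool k i = let s , h = ∈-filterᵇ⁻ (λ S → hits S Cs) (represent V Cs pool k) i in
  h , represent-short V Cs pool k s

compress-sound : ∀ m k pool T V {S} → S ∈ compress m k pool T V → Valid m k V S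
compress-sound m k pool T V {S} i =
  let Bs , b , j = ∈-concatMap⁻ (systems false m T V pool) (first-∈ (solutions m k pool T V) i)
      Rs , r , l = ∈-concatMap⁻ (systems true m T V pool) j
      h , short  = hitting-sound V (Bs ++ Rs) pool k l
      hb , hr    = hits-++ {S} Bs Rs h
  in (λ { false → systems-sound false m T V pool {S} b hb ; true → systems-sound true m T V pool {S} r hr }) , short

among-≤ : ∀ {V} → Unique V → ∀ S → among S V ≤ length S
among-≤ [] S = z≤n
among-≤ {v ∷ V} (new ∷ u) S with truth (mem v S)
... | inj₂ n = ≤-trans (≤-reflexive (among-no {S} V (fails (memR v S) n))) (among-≤ u S)
... | inj₁ t = ≤-trans (≤-reflexive (among-yes {S} V (holds (memR v S) t)))
    (≤-trans (s≤s (≤-trans (length-sub fewer) (among-≤ u (remove v S)))) (remove-shorter {v} S (holds (memR v S) t)))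
  where
  fewer : filterᵇ (λ u → mem u S) V ⊑ filterᵇ (λ u → mem u (remove v S)) V
  fewer = filter-⊑ _ _ V λ {u} i eq → true-of (memR u (remove v S)) (∈-remove⁺ (holds (memR u S) eq) (All.lookup new i))

-- All ends of edges lie in `V`, so members of `S` elsewhere delete nothing. They have to go because
-- the table is built from vertices of `V`.
solves-restrict : ∀ c m V S → Solves c m V S → Solves c m V (filterᵇ (λ v → mem v V) S)
solves-restrict c m V S = forest-⊑ (filter-⊑ _ _ (edges c m V) λ {e} i a →
  true-of (aliveR S S [] e) (back e i (holds (aliveR S′ S′ [] e) a)))
  where
  S′ = filterᵇ (λ v → mem v V) S
  keep : ∀ {z} → z ∈ V → ¬ Blocked S′ S′ [] z → ¬ Blocked S S [] z
  keep {z} i n (s , _) = let s′ = ∈-filterᵇ⁺ (λ v → mem v V) s (true-of (memR z V) i) in n (s′ , inj₁ s′)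
  back : ∀ e → e ∈ edges c m V → Alive S′ S′ [] e → Alive S S [] e
  back e i (a , b , h) with edges-ends c m V i
  ... | x∈ , y∈ , refl = keep x∈ a , keep y∈ b , λ { (_ , () , _) }

compress-complete : ∀ m k pool T V {S} → Full (guesses k) pool → Unique V → (∀ c → Solves c m V T) → length T ≤ suc k →
                    Valid m k V S → ∃[ S′ ] (S′ ∈ compress m k pool T V)
compress-complete m k pool T V {S} full uniq solT T≤ (solS , S≤) = choose (family false) (family true)
  where
  S′ = filterᵇ (λ v → mem v V) S
  S′≤ : length S′ ≤ k
  S′≤ = ≤-trans (filterᵇ-length _ S) S≤
  family : ∀ c → ∃[ Cs ] (Cs ∈ systems c m T V pool × hits S′ Cs ≡ true × length Cs ≤ suc (2 * k))
  family c = systems-complete c m T V pool {S′} {k} full (solT c) (solves-restrict c m V S (solS c)) T≤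
      (≤-trans (among-≤ {V} uniq S′) S′≤)
  choose : ∃[ Cs ] (Cs ∈ systems false m T V pool × hits S′ Cs ≡ true × length Cs ≤ suc (2 * k)) →
           ∃[ Cs ] (Cs ∈ systems true m T V pool × hits S′ Cs ≡ true × length Cs ≤ suc (2 * k)) →
           ∃[ S″ ] (S″ ∈ compress m k pool T V)
  choose (Bs , b , hb , lb) (Rs , r , hr , lr) = found
    (represent-complete V (Bs ++ Rs) {pool} {guesses k} full few k S′ (λ _ → true) S′≤
      (λ {v} i → holds (memR v V) (proj₂ (∈-filterᵇ⁻ (λ v → mem v V) S i))) sat)
    where
    -- Each colour gives at most 2 k + 1 clauses, and 4 k + 2 ≤ 10 (k + 1): the pool made for the
    -- guesses also describes all sets of clauses.
    few : length (Bs ++ Rs) ≤ guesses k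
    few = ≤-trans (≤-reflexive (length-++ Bs)) (≤-trans (+-mono-≤ lb lr)
            (≤-by (suc (2 * k) + suc (2 * k)) (guesses k) (6 * k + 8) (≤-refl {0}) (lemma k)))
      where
      lemma : ∀ k → 10 * suc k + 0 ≡ suc (2 * k) + suc (2 * k) + 0 + (6 * k + 8)
      lemma = solve-∀
    split : ∀ {C} → C ∈ Bs ⊎ C ∈ Rs → Hit S′ C
    split (inj₁ j) = hits⁻ Bs hb j
    split (inj₂ j) = hits⁻ Rs hr j
    sat : Satisfies S′ (λ _ → true) (Bs ++ Rs)
    sat i _ = split (∈-++⁻ Bs i)
    found : ∃[ S″ ] (S″ ∈ represent V (Bs ++ Rs) pool k × Satisfies S″ (λ _ → true) (Bs ++ Rs)) →
            ∃[ S″ ] (S″ ∈ compress m k pool T V)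
    found (S″ , i , sat″) = first-nonempty (solutions m k pool T V) (∈-concatMap⁺ (systems false m T V pool) b
      (∈-concatMap⁺ (systems true m T V pool) r
        (∈-filterᵇ⁺ (λ S → hits S (Bs ++ Rs)) i (hits⁺ (Bs ++ Rs) λ j → sat″ j refl))))

solve-sound : ∀ m k pool V {S} → S ∈ solve m k pool V → Valid m k V S
solve-sound m k pool []      (here refl) = (λ _ → tt) , z≤n
solve-sound m k pool (x ∷ V) {S} i = go (solve m k pool V) i
  where
  go : ∀ r → S ∈ caseList r [] (λ S₀ _ → compress m k pool (x ∷ S₀) (x ∷ V)) → Valid m k (x ∷ V) S
  go (S₀ ∷ _) = compress-sound m k pool (x ∷ S₀) (x ∷ V) {S}

-- By contraposition, `solve` may give up as soon as a smaller graph has no solution of size k.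
solves-tail : ∀ c m x V S → Solves c m (x ∷ V) S → Solves c m V S
solves-tail c m x V S φ = forest-⊑ (suffix _) (subst Forest (filter-++ (alive S S []) new (edges c m V)) φ)
  where
  new = map (λ y → x , y , []) (filterᵇ (λ y → colour? c (entry m x y)) V)
  suffix : ∀ xs {ys : List Edge} → ys ⊑ xs ++ ys
  suffix []       = ⊆-refl
  suffix (x ∷ xs) = x ∷ʳ suffix xs

solves-cons : ∀ c m x V S → Solves c m V S → Solves c m (x ∷ V) (x ∷ S)
solves-cons c m x V S φ = subst Forest (sym (filter-++ (alive T T []) new (edges c m V)))
  (subst (λ l → Forest (l ++ live T T [] (edges c m V))) (sym (dead ys)) (forest-⊑ fewer φ))
  where
  T = x ∷ S
  ys = filterᵇ (λ y → colour? c (entry m x y)) V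
  new = map (λ y → x , y , []) ys
  dead : ∀ ys → live T T [] (map (λ y → x , y , []) ys) ≡ []
  dead []       = refl
  dead (y ∷ ys) = trans (filter-no (alive T T []) {x , y , []} (map (λ y → x , y , []) ys)
      (false-of (aliveR T T [] (x , y , []))
                    λ (a , _) → a (here refl , inj₁ (here refl)))) (dead ys)
  fewer : live T T [] (edges c m V) ⊑ live S S [] (edges c m V)
  fewer = filter-⊑ _ _ (edges c m V) λ {e} _ a → let p , q , h = holds (aliveR T T [] e) a in
    true-of (aliveR S S [] e) ((λ (s , _) → p (there s , inj₁ (there s))) , (λ (s , _) → q (there s , inj₁ (there s))) ,
      λ (u , i , s) → h (u , i , there s))

solve-complete : ∀ m k pool V {S} → Full (guesses k) pool → Unique V → Valid m k V S → ∃[ S′ ] (S′ ∈ solve m k pool V)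
solve-complete m k pool []      full uniq        val = [] , here refl
solve-complete m k pool (x ∷ V) {S} full (new ∷ uniq) (sol , S≤) =
  go (solve m k pool V) (λ i → solve-sound m k pool V {_} i)
     (solve-complete m k pool V {S} full uniq ((λ c → solves-tail c m x V S (sol c)) , S≤))
  where
  go : ∀ r → (∀ {S₀} → S₀ ∈ r → Valid m k V S₀) → ∃[ S₀ ] (S₀ ∈ r) →
       ∃[ S′ ] (S′ ∈ caseList r [] (λ S₀ _ → compress m k pool (x ∷ S₀) (x ∷ V)))
  go (S₁ ∷ _) sound _ = compress-complete m k pool (x ∷ S₁) (x ∷ V) {S} full (new ∷ uniq)
    (λ c → solves-cons c m x V S₁ (proj₁ (sound (here refl)) c)) (s≤s (proj₂ (sound (here refl)))) (sol , S≤)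

-- The matrix of a graph

entryOf : Maybe Colour → List Bool
entryOf nothing     = []
entryOf (just blue) = false ∷ []
entryOf (just red)  = true ∷ []

colourOf : Bool → Colour
colourOf false = blue
colourOf true  = red

matrix : ∀ {n} → BicolouredGraph n → Matrix
matrix G = tabulate λ u → tabulate λ v → entryOf (colour G u v)

head-drop : ∀ {A : Set} {n} d (f : Fin n → A) i → head d (drop (toℕ i) (tabulate f)) ≡ f i
head-drop d f zero    = refl
head-drop d f (suc i) = head-drop d (f ∘ suc) i

entry-matrix : ∀ {n} (G : BicolouredGraph n) u v → entry (matrix G) (toℕ u) (toℕ v) ≡ entryOf (colour G u v)
entry-matrix G u v = trans (cong (λ r → head [] (drop (toℕ v) r))
    (head-drop [] (λ u → tabulate λ v → entryOf (colour G u v)) u))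
  (head-drop [] (λ v → entryOf (colour G u v)) v)

colour?-adj : ∀ {n} (G : BicolouredGraph n) c {u v} → Adj G (colourOf c) u v → colour? c
    (entry (matrix G) (toℕ u) (toℕ v)) ≡ true
colour?-adj G c {u} {v} a = trans (cong (colour? c) (trans (entry-matrix G u v) (cong entryOf a))) (same c)
  where
  same : ∀ c → colour? c (entryOf (just (colourOf c))) ≡ true
  same false = refl
  same true  = refl

adj-colour? : ∀ {n} (G : BicolouredGraph n) c {u v} → colour? c (entry (matrix G) (toℕ u) (toℕ v)) ≡ true → Adj G
    (colourOf c) u v
adj-colour? G c {u} {v} eq = same c (colour G u v) (trans (cong (colour? c) (sym (entry-matrix G u v))) eq)
  where
  same : ∀ c m → colour? c (entryOf m) ≡ true → m ≡ just (colourOf c)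
  same false (just blue) _ = refl
  same true  (just red)  _ = refl

edges-∈⁺ : ∀ c m n {x y} → y < x → x < n → colour? c (entry m x y) ≡ true → (x , y , []) ∈ edges c m (downFrom n)
edges-∈⁺ c m (suc n) {x} {y} y<x (s≤s x≤n) eq with x ≟ n
... | yes refl = ∈-++⁺ˡ (∈-map⁺ (λ y → x , y , []) (∈-filterᵇ⁺ (λ y → colour? c (entry m x y)) (∈-downFrom⁺ y<x) eq))
... | no ne    = ∈-++⁺ʳ (map (λ y → n , y , []) (filterᵇ (λ y → colour? c (entry m n y)) (downFrom n)))
                   (edges-∈⁺ c m n y<x (≤∧≢⇒< x≤n ne) eq)

edges-∈⁻ : ∀ c m n {x y A} → (x , y , A) ∈ edges c m (downFrom n) → y < x × x < n × colour? c (entry m x y) ≡ true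
edges-∈⁻ c m (suc n) i with ∈-++⁻ (map (λ y → n , y , []) (filterᵇ (λ y → colour? c (entry m n y)) (downFrom n))) i
... | inj₂ j = let a , b , e = edges-∈⁻ c m n j in a , m≤n⇒m≤1+n b , e
... | inj₁ j with ∈-map⁻ (λ y → n , y , []) j
...   | y , k , refl = let l , e = ∈-filterᵇ⁻ (λ y → colour? c (entry m n y)) (downFrom n) k in ∈-downFrom⁻ l ,
    ≤-refl , e

edges-unique : ∀ c m n → Unique (edges c m (downFrom n))
edges-unique c m zero    = []
edges-unique c m (suc n) = Unique.++⁺
  (Unique.map⁺ (λ { refl → refl }) (Unique.filter⁺ (λ y → T? (colour? c (entry m n y))) (Unique.downFrom⁺ n)))
  (edges-unique c m n)
  λ (i , j) → disjoint (∈-map⁻ (λ y → n , y , []) i) j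
  where
  disjoint : ∀ {e ys} → ∃[ y ] (y ∈ ys × e ≡ (n , y , [])) → e ∈ edges c m (downFrom n) → ⊥
  disjoint (y , _ , refl) j = <-irrefl refl (proj₁ (proj₂ (edges-∈⁻ c m n j)))

edge-between : ∀ {n} (G : BicolouredGraph n) c {u v} → Adj G (colourOf c) u v →
               ∃[ e ] (e ∈ edges c (matrix G) (downFrom n) × Joins e (toℕ u) (toℕ v))
edge-between {n} G c {u} {v} a with <-cmp (toℕ u) (toℕ v)
... | tri< lt _ _ = _ , edges-∈⁺ c (matrix G) n lt (toℕ<n v) (colour?-adj G c (trans (symm G v u) a)) , flipped
... | tri> _ _ gt = _ , edges-∈⁺ c (matrix G) n gt (toℕ<n u) (colour?-adj G c a) , straight
... | tri≈ _ eq _ with toℕ-injective eq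
...   | refl = contradiction (trans (sym a) (irrefl G u)) λ ()

adj-joined : ∀ {n} (G : BicolouredGraph n) c {e} {u v : Fin n} → e ∈ edges c (matrix G) (downFrom n) → Joins e
    (toℕ u) (toℕ v) →
             Adj G (colourOf c) u v
adj-joined {n} G c i straight = adj-colour? G c (proj₂ (proj₂ (edges-∈⁻ c (matrix G) n i)))
adj-joined {n} G c {u = u} {v} i flipped =
  trans (symm G u v) (adj-colour? G c (proj₂ (proj₂ (edges-∈⁻ c (matrix G) n i))))

-- Forests are acyclic

move-front : ∀ {A : Set} {x : A} {xs} → x ∈ xs → ∃[ ys ] (xs ↭ x ∷ ys)
move-front {x = x} i with ∈-∃++ i
... | ys , zs , refl = ys ++ zs , ↭-shift x ys zs

_Names_ : ∀ {n} → List ℕ → Subset n → Set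
_Names_ {n} S p = (∀ (u : Fin n) → u Sub.∈ p → toℕ u ∈ S) × (∀ (u : Fin n) → toℕ u ∈ S → u Sub.∈ p)

-- The rest of the cycle is a walk that connects the ends of its first edge. It does not use that
-- edge, because the vertices are distinct and there are at least three of them; moving the edge to
-- the front of the list contradicts the forest property.
solves-acyclic : ∀ {n} (G : BicolouredGraph n) c S p → S Names p → Solves c (matrix G) (downFrom n) S →
                 Acyclic (Adj G (colourOf c) ─ p)
solves-acyclic {n} G c S p (_ , named) φ C = go rest long distinct closed
  where
  open Cycle C
  es = live S S [] (edges c (matrix G) (downFrom n))
  R = Adj G (colourOf c) ─ p
  live-edge : ∀ {u v} → R u v → ∃[ e ] (e ∈ es × Joins e (toℕ u) (toℕ v))
  live-edge {u} {v} (nu , nv , a) with edge-between G c a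
  ... | e , i , j = e , ∈-filterᵇ⁺ (alive S S []) i
      (true-of (aliveR S S [] e) (at-alive e j (nu ∘ named u ∘ proj₁) (nv ∘ named v ∘ proj₁)
          λ (_ , k , _) → unlabelled (proj₂ (proj₂ (edges-ends c (matrix G) (downFrom n) i))) k)) , j
    where
    unlabelled : ∀ {A : List ℕ} {x} → A ≡ [] → x ∈ A → ⊥
    unlabelled refl ()
  go : ∀ rs → 3 ≤ length (start ∷ rs) → Unique (start ∷ rs) → Linked R (start ∷ rs ++ start ∷ []) → ⊥
  go (_ ∷ []) (s≤s (s≤s ()))
  go (r₁ ∷ r₂ ∷ rs) _ ((sr₁ ∷ sr₂ ∷ srs) ∷ (r₁r₂ ∷ r₁rs) ∷ _) (l₁ ∷ l₂ ∷ ls) with live-edge l₁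
  ... | e₀ , i₀ , j₀ with move-front i₀
  ...   | es′ , π = forest-head {e₀} j₀ (forest-↭ π φ)
            (conn-sym (kept l₂ (λ { (inj₁ (eq , _)) → sr₁ (sym (toℕ-injective eq)) ; (inj₂ (_ , eq)) → sr₂
                (sym (toℕ-injective eq)) })
              ◅ walk r₂ rs (sr₂ ∷ srs) (r₁r₂ ∷ r₁rs) ls))
    where
    s≡ = toℕ start
    kept : ∀ {u v} → R u v → ¬ ((toℕ u ≡ toℕ start × toℕ v ≡ toℕ r₁) ⊎ (toℕ u ≡ toℕ r₁ × toℕ v ≡ toℕ start)) → Step
        es′ (toℕ u) (toℕ v)
    kept {u} {v} l ne with live-edge l
    ... | e , i , j with ∈-resp-↭ π i
    ...   | there k   = e , k , j
    ...   | here refl = contradiction (joins-unique e j j₀) ne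
    away : ∀ {u v} → start ≢ u → r₁ ≢ u → ¬ ((toℕ u ≡ toℕ start × toℕ v ≡ toℕ r₁) ⊎
        (toℕ u ≡ toℕ r₁ × toℕ v ≡ toℕ start))
    away su ru (inj₁ (eq , _)) = su (sym (toℕ-injective eq))
    away su ru (inj₂ (eq , _)) = ru (sym (toℕ-injective eq))
    walk : ∀ a as → All (start ≢_) (a ∷ as) → All (r₁ ≢_) (a ∷ as) → Linked R (a ∷ as ++ start ∷ []) → Conn es′
        (toℕ a) (toℕ start)
    walk a []       (sa ∷ _)  (ra ∷ _)  (l ∷ _)  = kept l (away sa ra) ◅ ε
    walk a (b ∷ as) (sa ∷ ss) (ra ∷ rr) (l ∷ ls) = kept l (away sa ra) ◅ walk b as ss rr ls

-- Acyclic graphs are forests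

data Path {A : Set} (R : A → A → Set) : A → List A → A → Set where
  []  : ∀ {a} → Path R a [] a
  _∷_ : ∀ {a b as z} → R a b → Path R b as z → Path R a (b ∷ as) z

path-from : ∀ {A : Set} {R : A → A → Set} {a as z u} → Path R a as z → Unique (a ∷ as) → u ∈ a ∷ as →
            ∃[ us ] (Path R u us z × Unique (u ∷ us))
path-from p        uniq       (here refl)         = _ , p , uniq
path-from (_ ∷ p) (_ ∷ uniq) (there i)            = path-from p uniq i

path-linked : ∀ {A : Set} {R Q : A → A → Set} {a as z w} → (∀ {x y} → R x y → Q x y) → Path R a as z → Q z w →
    Linked Q (a ∷ as ++ w ∷ [])
path-linked h []      q = q ∷ [-]
path-linked h (r ∷ p) q = h r ∷ path-linked h p q

-- Loop erasure from the far end: if u already occurs on the simple path obtained for the rest of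
-- the walk, everything before that occurrence is discarded.
simple-path : ∀ {n} {es} (u v : Fin n) → (∀ {e x y} → e ∈ es → Joins e x y → y < n) → Conn es (toℕ u) (toℕ v) →
              ∃[ us ] (Path (λ a b → Step es (toℕ a) (toℕ b)) u us v × Unique (u ∷ us))
simple-path {n} {es} u v below c = go u c refl refl
  where
  go : ∀ {x y} u → Conn es x y → x ≡ toℕ u → y ≡ toℕ v → ∃[ us ]
      (Path (λ a b → Step es (toℕ a) (toℕ b)) u us v × Unique (u ∷ us))
  go u ε eq eq′ with toℕ-injective (trans (sym eq) eq′)
  ... | refl = [] , [] , [] ∷ []
  go u ((e , i , j) ◅ c) refl eq = prepend (go w c (sym w≡) eq)
    where
    w : Fin n
    w = fromℕ< (below i j)
    w≡ = toℕ-fromℕ< (below i j)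
    prepend : ∃[ ws ] (Path (λ a b → Step es (toℕ a) (toℕ b)) w ws v × Unique (w ∷ ws)) →
             ∃[ us ] (Path (λ a b → Step es (toℕ a) (toℕ b)) u us v × Unique (u ∷ us))
    prepend (ws , p , uniq) with Data.List.Membership.DecPropositional._∈?_ Fin._≟_ u (w ∷ ws)
    ... | yes k = path-from p uniq k
    ... | no n  = _ , (e , i , subst (Joins e (toℕ u)) (sym w≡) j) ∷ p , ¬Any⇒All¬ _ n ∷ uniq

path-nil : ∀ {A : Set} {R : A → A → Set} {a z} → Path R a [] z → a ≡ z
path-nil [] = refl

path-one : ∀ {A : Set} {R : A → A → Set} {a b z} → Path R a (b ∷ []) z → R a z
path-one (r ∷ []) = r

-- If later edges connect the ends of an edge, consider a simple path among them. Length zero would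
-- make the edge a loop, length one would repeat it in the list, and any longer path closes to a
-- cycle of the graph.
acyclic-solves : ∀ {n} (G : BicolouredGraph n) c S p → S Names p → Acyclic (Adj G (colourOf c) ─ p) →
                 Solves c (matrix G) (downFrom n) S
acyclic-solves {n} G c S p (named , _) acyc = go es
    (Unique.filter⁺ (λ e → T? (alive S S [] e)) (edges-unique c (matrix G) n)) id
  where
  everything = edges c (matrix G) (downFrom n)
  es = live S S [] everything
  R = Adj G (colourOf c) ─ p
  in-all : ∀ {e} → e ∈ es → e ∈ everything
  in-all i = proj₁ (∈-filterᵇ⁻ (alive S S []) everything i)
  related : ∀ {e} {u v : Fin n} → e ∈ es → Joins e (toℕ u) (toℕ v) → R u v
  related {e} {u} {v} i j with alive-at e j (holds (aliveR S S [] e) (proj₂ (∈-filterᵇ⁻ (alive S S []) everything i)))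
  ... | nu , nv , _ = (λ k → nu (named u k , inj₁ (named u k))) , (λ k → nv (named v k , inj₁ (named v k))) ,
      adj-joined G c (in-all i) j
  below : ∀ {e x y} → e ∈ es → Joins e x y → y < n
  below i straight = let a , b , _ = edges-∈⁻ c (matrix G) n (in-all i) in <-trans a b
  below i flipped = proj₁ (proj₂ (edges-∈⁻ c (matrix G) n (in-all i)))
  parallel : ∀ {x y A e′} → (x , y , A) ∈ es → e′ ∈ es → Joins e′ x y → (x , y , A) ≡ e′
  parallel {x} {y} {A} {e′} i i′ j with edges-ends c (matrix G) (downFrom n) (in-all i) | edges-ends c (matrix G)
      (downFrom n) (in-all i′) | j
  ... | _ , _ , refl | _ , _ , refl | straight = refl
  ... | _ | _ | flipped = contradiction (proj₁ (edges-∈⁻ c (matrix G) n (in-all i)))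
      (<-asym (proj₁ (edges-∈⁻ c (matrix G) n (in-all i′))))
  go : ∀ fs → Unique fs → (∀ {e} → e ∈ fs → e ∈ es) → Forest fs
  go [] _ _ = tt
  go ((x , y , A) ∷ fs) (new ∷ uniq) sub = cyc , go fs uniq (sub ∘ there)
    where
    x<n : x < n
    x<n = below (sub (here refl)) flipped
    y<n : y < n
    y<n = below (sub (here refl)) straight
    u v : Fin n
    u = fromℕ< x<n
    v = fromℕ< y<n
    j₀ : Joins (x , y , A) (toℕ u) (toℕ v)
    j₀ = inj₁ (sym (toℕ-fromℕ< x<n) , sym (toℕ-fromℕ< y<n))
    loop : ∀ us → Path (λ a b → Step fs (toℕ a) (toℕ b)) u us v → Unique (u ∷ us) → ⊥
    loop [] path _ = <-irrefl (trans (sym (toℕ-fromℕ< y<n)) (trans (cong toℕ (sym (path-nil path))) (toℕ-fromℕ< x<n)))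
      (proj₁ (edges-∈⁻ c (matrix G) n (in-all (sub (here refl)))))
    loop (_ ∷ []) path _ = let e′ , i , j = path-one path in All.lookup new i
        (parallel (sub (here refl)) (sub (there i))
      (subst₂ (Joins e′) (toℕ-fromℕ< x<n) (toℕ-fromℕ< y<n) j))
    loop us@(_ ∷ _ ∷ _) path uq = acyc record
      { start = u ; rest = us ; long = s≤s (s≤s (s≤s z≤n)) ; distinct = uq
      ; closed = path-linked (λ (_ , i , j) → related (sub (there i)) j) path
          (related (sub (here refl)) (joins-sym {x , y , A} j₀)) }
    cyc : ¬ Conn fs x y
    cyc c with simple-path u v (λ i → below (sub (there i)))
        (subst₂ (Conn fs) (sym (toℕ-fromℕ< x<n)) (sym (toℕ-fromℕ< y<n)) c)
    ... | us , path , uq = loop us path uq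

-- Subsets and lists of vertices

subsetOf : ∀ n → List ℕ → Subset n
subsetOf n S = Vec.tabulate λ i → mem (toℕ i) S

members : ∀ {n} → Subset n → List ℕ
members []          = []
members (true ∷ p)  = 0 ∷ map ℕ.suc (members p)
members (false ∷ p) = map ℕ.suc (members p)

subsetOf-names : ∀ n S → S Names subsetOf n S
subsetOf-names n S =
  (λ u i → holds (memR (toℕ u) S) (trans (sym (lookup∘tabulate (λ i → mem (toℕ i) S) u)) ([]=⇒lookup i))) ,
  (λ u i → lookup⇒[]= u _ (trans (lookup∘tabulate (λ i → mem (toℕ i) S) u) (true-of (memR (toℕ u) S) i)))

∈-suc : ∀ {x : ℕ} xs → suc x ∈ map ℕ.suc xs → x ∈ xs
∈-suc xs i with ∈-map⁻ ℕ.suc i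
... | _ , j , refl = j

zero-∉ : ∀ xs → ℕ.zero ∉ map ℕ.suc xs
zero-∉ xs i with ∈-map⁻ ℕ.suc i
... | _ , _ , ()

members-names : ∀ {n} (p : Subset n) → members p Names p
members-names p = to p , from p
  where
  to : ∀ {n} (p : Subset n) u → u Sub.∈ p → toℕ u ∈ members p
  to (true ∷ p)  zero    i              = here refl
  to (false ∷ p) zero    ()
  to (true ∷ p)  (suc u) (Vec.there i) = there (∈-map⁺ ℕ.suc (to p u i))
  to (false ∷ p) (suc u) (Vec.there i) = ∈-map⁺ ℕ.suc (to p u i)
  from : ∀ {n} (p : Subset n) u → toℕ u ∈ members p → u Sub.∈ p
  from (true ∷ p)  zero    i         = Vec.here
  from (false ∷ p) zero    i         = contradiction i (zero-∉ (members p))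
  from (true ∷ p)  (suc u) (there i) = Vec.there (from p u (∈-suc (members p) i))
  from (false ∷ p) (suc u) i         = Vec.there (from p u (∈-suc (members p) i))

length-members : ∀ {n} (p : Subset n) → length (members p) ≡ Sub.∣ p ∣
length-members []          = refl
length-members (true ∷ p)  = cong suc (trans (length-map ℕ.suc (members p)) (length-members p))
length-members (false ∷ p) = trans (length-map ℕ.suc (members p)) (length-members p)

members-unique : ∀ {n} (p : Subset n) → Unique (members p)
members-unique []          = []
members-unique (true ∷ p)  = All.tabulate (λ { i refl → zero-∉ (members p) i }) ∷ Unique.map⁺ suc-injective
    (members-unique p)
members-unique (false ∷ p) = Unique.map⁺ suc-injective (members-unique p)

unique-length : ∀ {V S} → Unique V → (∀ {v} → v ∈ V → v ∈ S) → length V ≤ length S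
unique-length {[]}    _            _   = z≤n
unique-length {v ∷ V} {S} (new ∷ u) sub = ≤-trans
    (s≤s (unique-length {V} {remove v S} u λ i → ∈-remove⁺ (sub (there i)) (All.lookup new i)))
  (remove-shorter {v} S (sub (here refl)))

-- Only an inequality, since the list may contain repetitions and numbers that are no vertices.
∣subsetOf∣ : ∀ n S → Sub.∣ subsetOf n S ∣ ≤ length S
∣subsetOf∣ n S = ≤-trans (≤-reflexive (sym (length-members p))) (unique-length (members-unique p) λ i → back i)
  where
  p = subsetOf n S
  below : ∀ {n} (p : Subset n) {x} → x ∈ members p → ∃[ u ] toℕ {n} u ≡ x
  below (true ∷ p)  (here refl) = zero , refl
  below (true ∷ p)  (there i) with ∈-map⁻ ℕ.suc i
  ... | _ , j , refl = let u , eq = below p j in suc u , cong suc eq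
  below (false ∷ p) i with ∈-map⁻ ℕ.suc i
  ... | _ , j , refl = let u , eq = below p j in suc u , cong suc eq
  back : ∀ {x} → x ∈ members p → x ∈ S
  back i with below p i
  ... | u , refl = proj₁ (subsetOf-names n S) u (proj₂ (members-names p) u i)

-- What the algorithm answers

toAnswer : ∀ n → List (List ℕ) → Maybe (Subset n)
toAnswer n []      = nothing
toAnswer n (S ∷ _) = just (subsetOf n S)

answers : ∀ {n} (G : BicolouredGraph n) k pool → Full (guesses k) pool →
          Answers G k (toAnswer n (solve (matrix G) k pool (downFrom n)))
answers {n} G k pool full = go (solve (matrix G) k pool (downFrom n)) (solve-sound (matrix G) k pool (downFrom n))
                              (λ {S} → solve-complete (matrix G) k pool (downFrom n) {S} full (Unique.downFrom⁺ n))
  where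
  go : ∀ r → (∀ {S} → S ∈ r → Valid (matrix G) k (downFrom n) S) →
       (∀ {S} → Valid (matrix G) k (downFrom n) S → ∃[ S′ ] (S′ ∈ r)) → Answers G k (toAnswer n r)
  go [] _ complete (p , (bl , rd) , small) with complete {members p}
      ((λ { false → acyclic-solves G false (members p) p (members-names p) bl ; true → acyclic-solves G true
      (members p) p (members-names p) rd }) ,
                                                (≤-trans (≤-reflexive (length-members p)) small))
  ... | _ , ()
  go (S ∷ _) sound _ with sound (here refl)
  ... | sol , short = (solves-acyclic G false S (subsetOf n S) (subsetOf-names n S) (sol false) ,
                       solves-acyclic G true S (subsetOf n S) (subsetOf-names n S) (sol true)) , ≤-trans
                           (∣subsetOf∣ n S) short

-- Polynomial time for the parts of the algorithm

sz-∈ : ∀ {a} {x : ⟦ a ⟧} {xs} → x ∈ xs → suc (sz a x) ≤ sz (list a) xs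
sz-∈ {a} {x} {_ ∷ xs} (here refl) = s≤s (m≤m+n _ (sz (list a) xs))
sz-∈ {a} {x} {y ∷ xs} (there i)   = ≤-trans (sz-∈ {a} i) (sz-tail {a} y xs)

sz-↭ : ∀ {a} {xs ys : List ⟦ a ⟧} → xs ↭ ys → sz (list a) xs ≡ sz (list a) ys
sz-↭ refl = refl
sz-↭ {a} (prep x p) = cong (λ n → suc (sz a x + n)) (sz-↭ {a} p)
sz-↭ {a} (swap {xs} x y p) = trans (lemma (sz a x) (sz a y) (sz (list a) xs))
    (cong (λ n → suc (sz a y + suc (sz a x + n))) (sz-↭ {a} p))
  where
  lemma : ∀ x y n → ℕ.suc (x + suc (y + n)) ≡ suc (y + suc (x + n))
  lemma = solve-∀
sz-↭ {a} (trans↭ p q) = trans (sz-↭ {a} p) (sz-↭ {a} q)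

sz-filter : ∀ {a} p (xs : List ⟦ a ⟧) → sz (list a) (filterᵇ p xs) ≤ sz (list a) xs
sz-filter p []       = ≤-refl
sz-filter {a} p (x ∷ xs) rewrite filterᵇ-∷ p x xs with p x
... | true  = s≤s (+-monoʳ-≤ (sz a x) (sz-filter {a} p xs))
... | false = ≤-trans (sz-filter {a} p xs) (sz-tail {a} x xs)

fstP : ∀ {Γ a b x} → PT Γ (a ⊗ b) x → PT Γ a (proj₁ ∘ x)
fstP p = splitP p (varP here)

sndP : ∀ {Γ a b x} → PT Γ (a ⊗ b) x → PT Γ b (proj₂ ∘ x)
sndP p = splitP p (varP (there here))

-- Edges

edgeᵗ : Ty
edgeᵗ = nat ⊗ nat ⊗ list nat

memP : ∀ {Γ x xs} → PT Γ nat x → PT Γ (list nat) xs → PT Γ bool (λ ρ → mem (x ρ) (xs ρ))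
memP p q = anyP (wk p ≡P varP here) q

touchesP : ∀ {Γ v e} → PT Γ nat v → PT Γ edgeᵗ e → PT Γ bool (λ ρ → touches (v ρ) (e ρ))
touchesP p q = (p ≡P fstP q) ∨P (p ≡P fstP (sndP q))

renameP′ : ∀ {Γ x y z} → PT Γ nat x → PT Γ nat y → PT Γ nat z → PT Γ nat (λ ρ → rename (x ρ) (y ρ) (z ρ))
renameP′ p q r = ifP (r ≡P p) q r

renameEdgeP : ∀ {Γ x y e} → PT Γ nat x → PT Γ nat y → PT Γ edgeᵗ e → PT Γ edgeᵗ (λ ρ → renameEdge (x ρ) (y ρ) (e ρ))
renameEdgeP p q r = renameP′ p q (fstP r) ,P renameP′ p q (fstP (sndP r)) ,P sndP (sndP r)

contractP : ∀ {Γ x y M} → PT Γ nat x → PT Γ nat y → PT Γ (list edgeᵗ) M → PT Γ (list edgeᵗ)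
    (λ ρ → contract (x ρ) (y ρ) (M ρ))
contractP p q r = ifP (p ≤P q) (mapP (renameEdgeP (wk q) (wk p) (varP here)) r)
    (mapP (renameEdgeP (wk p) (wk q) (varP here)) r)

otherP : ∀ {Γ v e} → PT Γ nat v → PT Γ edgeᵗ e → PT Γ nat (λ ρ → other (v ρ) (e ρ))
otherP p q = ifP (p ≡P fstP q) (fstP (sndP q)) (fstP q)

joinP : ∀ {Γ v e f} → PT Γ nat v → PT Γ edgeᵗ e → PT Γ edgeᵗ f → PT Γ edgeᵗ (λ ρ → join (v ρ) (e ρ) (f ρ))
joinP p q r = otherP p q ,P otherP p r ,P (sndP (sndP q) ++P consP p (sndP (sndP r)))

settledP : ∀ {Γ U F e} → PT Γ (list nat) U → PT Γ (list nat) F → PT Γ edgeᵗ e → PT Γ bool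
    (λ ρ → settled (U ρ) (F ρ) (e ρ))
settledP p q r = notP (memP (fstP r) p ∨P memP (fstP r) q) ∧P notP (memP (fstP (sndP r)) p ∨P memP (fstP (sndP r)) q)

insideP : ∀ {Γ F e} → PT Γ (list nat) F → PT Γ edgeᵗ e → PT Γ bool (λ ρ → inside (F ρ) (e ρ))
insideP p q = memP (fstP q) p ∧P memP (fstP (sndP q)) p

endsP : ∀ {Γ e} → PT Γ edgeᵗ e → PT Γ (list nat) (λ ρ → ends (e ρ))
endsP p = consP (fstP p) (consP (fstP (sndP p)) nilP)

atMostOneP : ∀ {Γ a xs} → PT Γ (list a) xs → PT Γ bool (λ ρ → atMostOne (xs ρ))
atMostOneP p = caseP p trueP (caseP (varP (there here)) trueP falseP)

lowP : ∀ {Γ F M v} → PT Γ (list nat) F → PT Γ (list edgeᵗ) M → PT Γ nat v → PT Γ bool (λ ρ → low (F ρ) (M ρ) (v ρ))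
lowP p q r = atMostOneP (filterP (wk r ≡P varP here)
    (concatMapP (endsP (varP here)) (filterP (insideP (wk p) (varP here)) q)))

removeP : ∀ {Γ v F} → PT Γ nat v → PT Γ (list nat) F → PT Γ (list nat) (λ ρ → remove (v ρ) (F ρ))
removeP p q = filterP (notP (wk p ≡P varP here)) q

untouchedP : ∀ {Γ v M} → PT Γ nat v → PT Γ (list edgeᵗ) M → PT Γ (list edgeᵗ) (λ ρ → untouched (v ρ) (M ρ))
untouchedP p q = filterP (notP (touchesP (wk p) (varP here))) q

-- The step

stateᵗ : Ty
stateᵗ = list nat ⊗ list nat ⊗ list edgeᵗ ⊗ list (list nat) ⊗ list bool

stepVertexP : ∀ {Γ v F M out g} → PT Γ nat v → PT Γ (list nat) F → PT Γ (list edgeᵗ) M → PT Γ (list (list nat)) out →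
              PT Γ (list bool) g → PT Γ stateᵗ (λ ρ → stepVertex (v ρ) (F ρ) (M ρ) (out ρ) (g ρ))
stepVertexP {v = v} {F} {M} {out} {g} p q r s t =
  caseP (filterP (touchesP (wk p) (varP here)) r) dropped
    (caseP (varP (there here)) (wk (wk dropped))
      (caseP (varP (there here))
        (nilP ,P wk⁴ (removeP p q) ,P
          consP (joinP (wk⁴ p) (varP (there (there here))) (varP here)) (wk⁴ (untouchedP p r)) ,P wk⁴ s ,P wk⁴ t)
        (wk (wk (wk⁴ (ifP (headP falseP t) (nilP ,P removeP p q ,P r ,P s ,P tailP t)
                      (nilP ,P removeP p q ,P untouchedP p r ,P consP (consP p nilP) s ,P tailP t)))))))
  where
  dropped = nilP ,P removeP p q ,P untouchedP p r ,P s ,P t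
  wk⁴ : ∀ {Γ a b c d e f} → PT Γ a f → PT (b ∷ c ∷ d ∷ e ∷ Γ) a (λ (_ , _ , _ , _ , ρ) → f ρ)
  wk⁴ p = wk (wk (wk (wk p)))

stepP : ∀ {Γ σ} → PT Γ stateᵗ σ → PT Γ stateᵗ (λ ρ → step (σ ρ))
stepP {Γ} {σ} p = caseP (filterP (settledP (wk U) (wk F) (varP here)) M)
  (caseP U (caseP (filterP (lowP (wk F) (wk M) (varP here)) F) (nilP ,P F ,P M ,P out ,P g)
      (stepVertexP (varP here) (wk² F) (wk² M) (wk² out) (wk² g)))
    (ifP (wk² (headP falseP g)) (varP (there here) ,P wk² F ,P wk² M ,P wk² out ,P wk² (tailP g))
      (varP (there here) ,P wk² F ,P untouchedP (varP here) (wk² M) ,P consP (consP (varP here) nilP) (wk² out) ,P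
          wk² (tailP g))))
  (ifP (wk² (headP falseP g) ∧P notP (fstP (varP here) ≡P fstP (sndP (varP here))))
    (wk² U ,P wk² F ,P contractP (fstP (varP here)) (fstP (sndP (varP here))) M′ ,P wk² out ,P wk² (tailP g))
    (wk² U ,P wk² F ,P M′ ,P consP (sndP (sndP (varP here))) (wk² out) ,P wk² (tailP g)))
  where
  wk² : ∀ {Γ a b c f} → PT Γ a f → PT (b ∷ c ∷ Γ) a (λ (_ , _ , ρ) → f ρ)
  wk² p = wk (wk p)
  U = fstP p
  F = fstP (sndP p)
  M = fstP (sndP (sndP p))
  out = fstP (sndP (sndP (sndP p)))
  g = sndP (sndP (sndP (sndP p)))
  M′ = varP (there here) ++P wk² (filterP (notP (settledP (wk U) (wk F) (varP here))) M)

-- Growth of the state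

sz-mono : ∀ {m n} → m ≤ n → sz nat m ≤ sz nat n
sz-mono z≤n     = 1≤size _
sz-mono (s≤s h) = s≤s (s≤s (sz-mono h))

sz-rename : ∀ {x y} → y ≤ x → ∀ z → sz nat (rename x y z) ≤ sz nat z
sz-rename {x} h z with z ≡ᵇ x | eqR z x
... | true  | ofʸ refl = sz-mono h
... | false | _        = ≤-refl

sz-renameEdges : ∀ {x y} → y ≤ x → ∀ M → sz (list edgeᵗ) (map (renameEdge x y) M) ≤ sz (list edgeᵗ) M
sz-renameEdges h []                = ≤-refl
sz-renameEdges h ((p , q , A) ∷ M) = s≤s (+-mono-≤
    (s≤s (+-mono-≤ (sz-rename h p) (s≤s (+-monoˡ-≤ _ (sz-rename h q))))) (sz-renameEdges h M))

sz-contract : ∀ x y M → sz (list edgeᵗ) (contract x y M) ≤ sz (list edgeᵗ) M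
sz-contract x y M with x ≤ᵇ y | ≤ᵇ-reflects-≤ x y
... | true  | ofʸ h = sz-renameEdges h M
... | false | ofⁿ n = sz-renameEdges (≰⇒≥ n) M

sz-remove : ∀ {v} F → v ∈ F → suc (sz nat v + sz (list nat) (remove v F)) ≤ sz (list nat) F
sz-remove {v} (u ∷ F) i rewrite filterᵇ-∷ (λ u → not (v ≡ᵇ u)) u F with v ≡ᵇ u | eqR v u
... | true  | ofʸ refl = s≤s (+-monoʳ-≤ (sz nat v) (sz-filter {nat} (λ u → not (v ≡ᵇ u)) F))
sz-remove {v} (u ∷ F) (here eq) | false | ofⁿ n = contradiction eq n
sz-remove {v} (u ∷ F) (there i) | false | ofⁿ n = s≤s
    (≤-trans (≤-reflexive (lemma (sz nat v) (sz nat u) (sz (list nat) (remove v F))))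
    (+-monoʳ-≤ (sz nat u) (sz-remove F i)))
  where
  lemma : ∀ v u f → v + suc (u + f) ≡ u + suc (v + f)
  lemma = solve-∀

sz-other : ∀ v e → sz nat (other v e) + sz (list nat) (proj₂ (proj₂ e)) ≤ sz edgeᵗ e
sz-other v (x , y , A) with v ≡ᵇ x
... | true  = ≤-trans (≤-trans (n≤1+n _) (m≤n+m _ (sz nat x))) (n≤1+n _)
... | false = ≤-trans (+-monoʳ-≤ (sz nat x) (≤-trans (m≤n+m _ (sz nat y)) (n≤1+n _))) (n≤1+n _)

sz-join : ∀ v e f → sz edgeᵗ (join v e f) ≤ 3 + (sz nat v + (sz edgeᵗ e + sz edgeᵗ f))
sz-join v e f = ≤-by _ _ 0 (+-mono-≤ (sz-++ {nat} (proj₂ (proj₂ e)) (v ∷ proj₂ (proj₂ f)))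
    (+-mono-≤ (sz-other v e) (sz-other v f)))
  (lemma (sz nat v) (sz edgeᵗ e) (sz edgeᵗ f) (sz nat (other v e)) (sz nat (other v f))
      (sz (list nat) (proj₂ (proj₂ e)))
         (sz (list nat) (proj₂ (proj₂ f))) (sz (list nat) (proj₂ (proj₂ e) ++ v ∷ proj₂ (proj₂ f))))
  where
  lemma : ∀ v e f a b A B AB → 3 + (v + (e + f)) + (AB + (a + A + (b + B))) ≡
          suc (a + suc (b + AB)) + (A + suc (v + B) + (e + f)) + 0
  lemma = solve-∀

parts : ℕ → ℕ → ℕ → ℕ → ℕ → ℕ
parts u f m o g = suc (u + suc (f + suc (m + suc (o + g))))

parts-mono : ∀ {u u′ f f′ m m′ o o′ g g′} → u ≤ u′ → f ≤ f′ → m ≤ m′ → o ≤ o′ → g ≤ g′ → parts u f m o g ≤ parts u′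
    f′ m′ o′ g′
parts-mono a b c d e = s≤s (+-mono-≤ a (s≤s (+-mono-≤ b (s≤s (+-mono-≤ c (s≤s (+-mono-≤ d e)))))))

-- A step writes almost nothing but what it removes elsewhere, so the growth is additive and
-- `paraAdd` applies. The 2 arises when a name moves from a list of vertices into a clause of its
-- own.
sz-step : ∀ U F M out g → sz stateᵗ (step (U , F , M , out , g)) ≤ sz stateᵗ (U , F , M , out , g) + 2
sz-step U F M out g with view U F M
... | resolve x y A es eq st rewrite st out g = choose (head false g ∧ not (x ≡ᵇ y))
  where
  M′ = es ++ filterᵇ (λ e → not (settled U F e)) M
  M≡ : sz (list edgeᵗ) M ≡ sz (list edgeᵗ) ((x , y , A) ∷ M′)
  M≡ = sz-↭ {edgeᵗ} (settled-split {U} {F} M eq)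
  M′≤ : sz (list edgeᵗ) M′ ≤ sz (list edgeᵗ) M
  M′≤ = ≤-trans (sz-tail {edgeᵗ} (x , y , A) M′) (≤-reflexive (sym M≡))
  choose : ∀ b → sz stateᵗ (if b then (U , F , contract x y M′ , out , tail g) else (U , F , M′ , A ∷ out , tail g)) ≤
           sz stateᵗ (U , F , M , out , g) + 2
  choose true  = ≤-trans (parts-mono (≤-refl {sz (list nat) U}) (≤-refl {sz (list nat) F})
      (≤-trans (sz-contract x y M′) M′≤)
                   (≤-refl {sz (list (list nat)) out}) (sz-tail≤ {bool} g)) (m≤m+n _ 2)
  choose false = ≤-by _ _ (4 + (sz nat x + sz nat y)) (+-mono-≤ (≤-reflexive (sym M≡)) (sz-tail≤ {bool} g))
    (lemma (sz (list nat) U) (sz (list nat) F) (sz (list edgeᵗ) M) (sz (list edgeᵗ) M′) (sz (list (list nat)) out)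
           (sz (list bool) g) (sz (list bool) (tail g)) (sz nat x) (sz nat y) (sz (list nat) A))
    where
    lemma : ∀ u f m m′ o g t x y a → ℕ.suc (u + suc (f + suc (m + suc (o + g)))) + 2 +
        (suc (suc (x + suc (y + a)) + m′) + t) ≡
            suc (u + suc (f + suc (m′ + suc ((suc (a + o)) + t)))) + (m + g) + (4 + (x + y))
    lemma = solve-∀
... | decide v U′ eq refl st rewrite st out g = choose (head false g)
  where
  choose : ∀ b → sz stateᵗ (if b then (U′ , F , M , out , tail g) else
      (U′ , F , untouched v M , (v ∷ []) ∷ out , tail g)) ≤
           sz stateᵗ (v ∷ U′ , F , M , out , g) + 2
  choose true  = ≤-trans (parts-mono (sz-tail {nat} v U′) (≤-refl {sz (list nat) F}) (≤-refl {sz (list edgeᵗ) M})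
                   (≤-refl {sz (list (list nat)) out}) (sz-tail≤ {bool} g)) (m≤m+n _ 2)
  choose false = ≤-by _ _ 0 (+-mono-≤ (sz-filter {edgeᵗ} (λ e → not (touches v e)) M) (sz-tail≤ {bool} g))
    (lemma (sz (list nat) U′) (sz (list nat) F) (sz (list edgeᵗ) M) (sz (list edgeᵗ) (untouched v M))
        (sz (list (list nat)) out)
           (sz (list bool) g) (sz (list bool) (tail g)) (sz nat v))
    where
    lemma : ∀ u f m m′ o g t v → ℕ.suc ((suc (v + u)) + suc (f + suc (m + suc (o + g)))) + 2 + (m′ + t) ≡ suc
        (u + suc (f + suc (m′ + suc ((suc (suc (v + 1) + o)) + t)))) + (m + g) + 0
    lemma = solve-∀
... | stuck _ _ _ st rewrite st out g = m≤m+n _ 2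
... | prune v _ refl v∈ lo _ st rewrite st out g =
  ≤-trans (parts-mono (≤-refl {1}) (sz-filter {nat} (λ u → not (v ≡ᵇ u)) F)
      (sz-filter {edgeᵗ} (λ e → not (touches v e)) M)
    (≤-refl {sz (list (list nat)) out}) (≤-refl {sz (list bool) g})) (m≤m+n _ 2)
... | series v e₁ e₂ _ refl v∈ lo eq st rewrite st out g =
  ≤-by _ _ 1 (+-mono-≤ (sz-join v e₁ e₂) (+-mono-≤ (sz-remove F v∈)
      (≤-reflexive (sym (sz-↭ {edgeᵗ} (touch-split v M eq))))))
    (lemma (sz (list nat) F) (sz (list nat) (remove v F)) (sz (list edgeᵗ) M) (sz (list edgeᵗ) (untouched v M))
           (sz (list (list nat)) out) (sz (list bool) g) (sz nat v) (sz edgeᵗ e₁) (sz edgeᵗ e₂)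
               (sz edgeᵗ (join v e₁ e₂)))
  where
  lemma : ∀ f f′ m r o g v e₁ e₂ j → ℕ.suc (1 + suc (f + suc (m + suc (o + g)))) + 2 +
      (j + (suc (v + f′) + suc (e₁ + suc (e₂ + r)))) ≡
          suc (1 + suc (f′ + suc ((suc (j + r)) + suc (o + g)))) + (3 + (v + (e₁ + e₂)) + (f + m)) + 1
  lemma = solve-∀
... | branch v e₁ e₂ e₃ es _ refl v∈ lo eq st rewrite st out g = choose (head false g)
  where
  choose : ∀ b → sz stateᵗ (if b then ([] , remove v F , M , out , tail g) else
      ([] , remove v F , untouched v M , (v ∷ []) ∷ out , tail g)) ≤
           sz stateᵗ ([] , F , M , out , g) + 2
  choose true  = ≤-trans (parts-mono (≤-refl {1}) (sz-filter {nat} (λ u → not (v ≡ᵇ u)) F) (≤-refl {sz (list edgeᵗ) M})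
                   (≤-refl {sz (list (list nat)) out}) (sz-tail≤ {bool} g)) (m≤m+n _ 2)
  choose false = ≤-by _ _ 0 (+-mono-≤ (sz-remove F v∈)
      (+-mono-≤ (sz-filter {edgeᵗ} (λ e → not (touches v e)) M) (sz-tail≤ {bool} g)))
    (lemma (sz (list nat) F) (sz (list nat) (remove v F)) (sz (list edgeᵗ) M) (sz (list edgeᵗ) (untouched v M))
        (sz (list (list nat)) out)
           (sz (list bool) g) (sz (list bool) (tail g)) (sz nat v))
    where
    lemma : ∀ f f′ m m′ o g t v → ℕ.suc (1 + suc (f + suc (m + suc (o + g)))) + 2 + (suc (v + f′) + (m′ + t)) ≡ suc
        (1 + suc (f′ + suc (m′ + suc ((suc (suc (v + 1) + o)) + t)))) + (f + (m + g)) + 0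
    lemma = solve-∀

repeatP : ∀ {Γ a xs σ} → PT Γ (list a) xs → PT Γ stateᵗ σ → PT Γ stateᵗ (λ ρ → repeat (xs ρ) (σ ρ))
repeatP p q = paraAdd p q (stepP (varP here)) (con 2) λ (U , F , M , out , g) _ _ _ → sz-step U F M out g

clausesP : ∀ {Γ σ} → PT Γ stateᵗ σ → PT Γ (list (list nat)) (λ ρ → clauses (σ ρ))
clausesP p = finishP (repeatP (fstP (sndP (sndP p))) (repeatP (fstP (sndP p)) (repeatP (fstP p) p)))
  where
  finishP : ∀ {Γ σ} → PT Γ stateᵗ σ → PT Γ (list (list nat)) (λ ρ → finish (σ ρ))
  finishP p = caseP (fstP (sndP (sndP p))) out (consP nilP (wk (wk out)))
    where
    out = fstP (sndP (sndP (sndP p)))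

-- Edges of a matrix

matrixᵗ : Ty
matrixᵗ = list (list (list bool))

entryP : ∀ {Γ m x y} → PT Γ matrixᵗ m → PT Γ nat x → PT Γ nat y → PT Γ (list bool) (λ ρ → entry (m ρ) (x ρ) (y ρ))
entryP p q r = headP nilP (dropP r (headP nilP (dropP q p)))

colour?P : ∀ {Γ c l} → PT Γ bool c → PT Γ (list bool) l → PT Γ bool (λ ρ → colour? (c ρ) (l ρ))
colour?P p q = caseP q falseP (ifP (wk (wk p)) (varP here) (notP (varP here)))

neighbours : Bool → Matrix → ℕ → List ℕ → List Edge
neighbours c m x xs = map (λ y → x , y , []) (filterᵇ (λ y → colour? c (entry m x y)) xs)

neighboursP : ∀ {Γ c m x xs} → PT Γ bool c → PT Γ matrixᵗ m → PT Γ nat x → PT Γ (list nat) xs →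
              PT Γ (list edgeᵗ) (λ ρ → neighbours (c ρ) (m ρ) (x ρ) (xs ρ))
neighboursP p q r s = mapP (wk r ,P varP here ,P nilP) (filterP (colour?P (wk p) (entryP (wk q) (wk r) (varP here))) s)

-- Stated for an arbitrary pf: normalising the bound of a concrete one is infeasible.
paraConcatP : ∀ {Γ a b l} {f : Env (a ∷ list a ∷ Γ) → List ⟦ b ⟧} → PT Γ (list a) l → PT (a ∷ list a ∷ Γ) (list b) f →
              PT Γ (list b) (λ ρ → para (λ r x xs → f (x , xs , ρ) ++ r) [] (l ρ))
paraConcatP {Γ} {a} {b} {l} {f} pl pf = paraAdd pl nilP (wk pf ++P varP here) (bound pf) λ r x xs ρ → begin
  sz (list b) (f (x , xs , ρ) ++ r)                                  ≤⟨ sz-++ {b} (f (x , xs , ρ)) r ⟩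
  sz (list b) (f (x , xs , ρ)) + sz (list b) r                       ≡⟨ +-comm (sz (list b) (f (x , xs , ρ))) _ ⟩
  sz (list b) r + sz (list b) (f (x , xs , ρ))                       ≤⟨ +-monoʳ-≤ (sz (list b) r)
      (size≤ pf (x , xs , ρ)) ⟩
  sz (list b) r + eval (bound pf) (szs (a ∷ list a ∷ Γ) (x , xs , ρ)) ≤⟨ +-monoʳ-≤ (sz (list b) r)
      (eval-mono (bound pf) (arg x xs ρ)) ⟩
  sz (list b) r + eval (bound pf) (sz (list a) (x ∷ xs) + szs Γ ρ)   ∎
  where
  open ≤-Reasoning
  arg : ∀ x xs ρ → sz a x + (sz (list a) xs + szs Γ ρ) ≤ sz (list a) (x ∷ xs) + szs Γ ρ
  arg x xs ρ = ≤-trans (≤-reflexive (sym (+-assoc (sz a x) (sz (list a) xs) (szs Γ ρ))))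
      (n≤1+n (sz a x + sz (list a) xs + szs Γ ρ))

edgesP : ∀ {Γ c m V} → PT Γ bool c → PT Γ matrixᵗ m → PT Γ (list nat) V → PT Γ (list edgeᵗ)
    (λ ρ → edges (c ρ) (m ρ) (V ρ))
edgesP {c = c} {m} {V} p q r = congP
  (paraConcatP r (neighboursP (wk (wk p)) (wk (wk q)) (varP here) (varP (there here))))
  (λ ρ → para-cong {f = edges (c ρ) (m ρ)} (λ _ _ → refl) (V ρ))

systemsP : ∀ {Γ c m T V pool} → PT Γ bool c → PT Γ matrixᵗ m → PT Γ (list nat) T → PT Γ (list nat) V → PT Γ
    (list (list bool)) pool →
           PT Γ (list (list (list nat))) (λ ρ → systems (c ρ) (m ρ) (T ρ) (V ρ) (pool ρ))
systemsP p q r s t = mapP (clausesP (wk r ,P filterP (notP (memP (varP here) (wk (wk r)))) (wk s) ,P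
                              edgesP (wk p) (wk q) (wk s) ,P nilP ,P varP here)) t

-- Hitting

hitsP : ∀ {Γ S Cs} → PT Γ (list nat) S → PT Γ (list (list nat)) Cs → PT Γ bool (λ ρ → hits (S ρ) (Cs ρ))
hitsP p q = allP (anyP (memP (varP here) (wk (wk p))) (varP here)) q

pickᵗ : Ty
pickᵗ = list (list nat) ⊗ list (list nat)

pickP : ∀ {Γ bs Cs} → PT Γ (list bool) bs → PT Γ (list (list nat)) Cs → PT Γ pickᵗ (λ ρ → pick (bs ρ) (Cs ρ))
pickP {Γ} {bs} {Cs} p q = congP
  (paraAdd p (q ,P nilP)
    (caseP (fstP (varP here)) (nilP ,P sndP (varP here))
      (varP (there here) ,P ifP (varP (there (there (there here))))
          (consP (varP here) (sndP (varP (there (there here))))) (sndP (varP (there (there here))))))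
    (con 0) (λ (r , o) b _ _ → growth r o b))
  (λ ρ → para-cong {f = λ bs → pick bs (Cs ρ)} (λ _ _ → refl) (bs ρ))
  where
  growth : ∀ (r o : List (List ℕ)) b → sz pickᵗ (caseList r ([] , o) (λ C Cs′ → Cs′ , (if b then C ∷ o else o))) ≤
      sz pickᵗ (r , o) + 0
  growth []       o b     = m≤m+n _ 0
  growth (C ∷ r) o true  = ≤-reflexive (lemma (sz (list nat) C) (sz (list (list nat)) r) (sz (list (list nat)) o))
    where
    lemma : ∀ c r o → ℕ.suc (r + suc (c + o)) ≡ suc (suc (c + r) + o) + 0
    lemma = solve-∀
  growth (C ∷ r) o false = ≤-trans (s≤s (+-monoˡ-≤ _ (sz-tail {list nat} C r))) (m≤m+n _ 0)

firstP : ∀ {Γ a xs} → PT Γ (list a) xs → PT Γ (list a) (λ ρ → first (xs ρ))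
firstP p = caseP p nilP (consP (varP here) nilP)

candidatesP : ∀ {Γ V t} → PT Γ (list nat) V → PT Γ (list (list nat)) t → PT Γ (list (list nat))
    (λ ρ → candidates (V ρ) (t ρ))
candidatesP p q = q ++P concatMapP (mapP (consP (varP (there here)) (varP here)) (wk q)) p

extendP : ∀ {Γ V Cs pool t} → PT Γ (list nat) V → PT Γ (list (list nat)) Cs → PT Γ (list (list bool)) pool → PT Γ
    (list (list nat)) t →
          PT Γ (list (list nat)) (λ ρ → extend (V ρ) (Cs ρ) (pool ρ) (t ρ))
extendP p q r s = concatMapP (firstP (filterP (hitsP (varP here) (sndP (pickP (varP (there here)) (wk (wk q)))))
    (wk (candidatesP p s)))) r

sz-represent : ∀ V Cs pool k {S} → S ∈ represent V Cs pool k → sz (list nat) S ≤ 1 + k * sz (list nat) V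
sz-represent V Cs pool zero    (here refl) = ≤-refl
sz-represent V Cs pool (suc k) i with ∈-concatMap⁻ pool i
... | bs , _ , j with ∈-++⁻ (represent V Cs pool k) (proj₁ (∈-filterᵇ⁻ _ _ (first-∈ _ j)))
...   | inj₁ l = ≤-trans (sz-represent V Cs pool k l) (s≤s (m≤n+m _ (sz (list nat) V)))
...   | inj₂ l with ∈-concatMap⁻ V l
...     | v , v∈ , r with ∈-map⁻ (v ∷_) r
...       | S , s , refl = ≤-by (sz (list nat) (v ∷ S)) (1 + suc k * sz (list nat) V) 0
    (+-mono-≤ (sz-∈ {nat} v∈) (sz-represent V Cs pool k s))
  (lemma (sz nat v) (sz (list nat) S) (sz (list nat) V) (k * sz (list nat) V))
  where
  lemma : ∀ v s V kV → 1 + (V + kV) + (suc v + s) ≡ suc (v + s) + (V + (1 + kV)) + 0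
  lemma = solve-∀

length-first : ∀ {A : Set} (xs : List A) → length (first xs) ≤ 1
length-first []      = z≤n
length-first (_ ∷ _) = ≤-refl

length-concatMap : ∀ {A B : Set} (f : A → List B) → (∀ x → length (f x) ≤ 1) → ∀ xs → length (concatMap f xs) ≤
    length xs
length-concatMap f h []       = z≤n
length-concatMap f h (x ∷ xs) = ≤-trans (≤-reflexive (length-++ (f x))) (+-mono-≤ (h x) (length-concatMap f h xs))

-- Each bit string contributes at most one entry; the extra 1 covers the initial table. The bound
-- does not depend on k.
length-represent : ∀ V Cs pool k → length (represent V Cs pool k) ≤ 1 + length pool
length-represent V Cs pool zero    = s≤s z≤n
length-represent V Cs pool (suc k) = m≤n⇒m≤1+n (length-concatMap _
    (λ bs → length-first (filterᵇ (λ S → hits S (proj₂ (pick bs Cs))) (candidates V (represent V Cs pool k)))) pool)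

sz-list-bound : ∀ {a} B (xs : List ⟦ a ⟧) → (∀ {x} → x ∈ xs → sz a x ≤ B) → sz (list a) xs ≤ 1 + length xs * (1 + B)
sz-list-bound B []       h = ≤-refl
sz-list-bound {a} B (x ∷ xs) h = ≤-trans (s≤s (+-mono-≤ (h (here refl)) (sz-list-bound {a} B xs (h ∘ there))))
    (≤-reflexive (lemma B (length xs * (1 + B))))
  where
  lemma : ∀ B l → ℕ.suc (B + (1 + l)) ≡ 1 + (1 + B + l)
  lemma = solve-∀

length-sz : ∀ {a} (xs : List ⟦ a ⟧) → length xs ≤ sz (list a) xs
length-sz []       = z≤n
length-sz {a} (x ∷ xs) = s≤s (≤-trans (length-sz {a} xs) (m≤n+m _ (sz a x)))

para-represent : ∀ {A : Set} V Cs pool (xs : List A) → para (λ r _ _ → extend V Cs pool r) ([] ∷ []) xs ≡ represent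
    V Cs pool (length xs)
para-represent V Cs pool []       = refl
para-represent V Cs pool (x ∷ xs) = cong (extend V Cs pool) (para-represent V Cs pool xs)

-- Every round builds a new table, at a cost in size that is not additive, so the size is bounded
-- directly. The fixed context of four variables lets this be done once; other contexts are reached
-- by renaming.
representP₀ : PT (list nat ∷ list (list nat) ∷ list (list bool) ∷ nat ∷ []) (list (list nat))
    (λ (V , Cs , pool , k , _) → represent V Cs pool k)
representP₀ = congP
  (paraP (unitsP (varP (there (there (there here))))) (consP nilP nilP)
    (extendP (varP v₃) (varP (there v₃)) (varP (there (there v₃))) (varP here)) q
    (λ ρ xs → ≤-trans (≤-reflexive (cong (sz (list (list nat)))
        (para-represent (proj₁ ρ) (proj₁ (proj₂ ρ)) (proj₁ (proj₂ (proj₂ ρ))) xs)))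
      (table-size (proj₁ ρ) (proj₁ (proj₂ ρ)) (proj₁ (proj₂ (proj₂ ρ))) (proj₁ (proj₂ (proj₂ (proj₂ ρ)))) xs)))
  (λ (V , Cs , pool , k , _) → trans (para-represent V Cs pool (units k))
      (cong (represent V Cs pool) (length-replicate k)))
  where
  v₃ : ∀ {Γ a b c d} → a ∷ b ∷ c ∷ d ∷ Γ ∋ d
  v₃ = there (there (there here))
  -- At most 1 + N sets, each encoded by at most 1 + N * N nodes and one list cell.
  q = con 1 ⊕ (con 1 ⊕ X) ⊛ (con 1 ⊕ (con 1 ⊕ X ⊛ X))
  table-size : ∀ V Cs pool k (xs : List ⊤) → let N = sz (list unit) xs + szs (list nat ∷ list (list nat) ∷ list (list bool) ∷ nat ∷ []) (V , Cs , pool , k , tt) in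
         sz (list (list nat)) (represent V Cs pool (length xs)) ≤ 1 + (1 + N) * (1 + (1 + N * N))
  table-size V Cs pool k xs = ≤-trans (sz-list-bound {list nat} (1 + length xs * sz (list nat) V) _
      (λ {S} i → sz-represent V Cs pool (length xs) i))
    (s≤s (*-mono-≤ (≤-trans (length-represent V Cs pool (length xs)) (s≤s (≤-trans (length-sz {list bool} pool) pool≤)))
      (s≤s (s≤s (*-mono-≤ (≤-trans (length-sz {unit} xs) (m≤m+n _ _))
          (≤-trans (m≤m+n _ _) (m≤n+m _ (sz (list unit) xs))))))))
    where
    pool≤ : sz (list (list bool)) pool ≤ sz (list unit) xs +
        (sz (list nat) V + (sz (list (list nat)) Cs + (sz (list (list bool)) pool + (sz nat k + 0))))
    pool≤ = ≤-trans (≤-trans (≤-trans (m≤m+n _ (sz nat k + 0)) (m≤n+m _ (sz (list (list nat)) Cs)))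
        (m≤n+m _ (sz (list nat) V))) (m≤n+m _ (sz (list unit) xs))

representP : ∀ {Γ V Cs pool k} → PT Γ (list nat) V → PT Γ (list (list nat)) Cs → PT Γ (list (list bool)) pool → PT
    Γ nat k →
             PT Γ (list (list nat)) (λ ρ → represent (V ρ) (Cs ρ) (pool ρ) (k ρ))
representP p q r s = letP s (letP (wk r) (letP (wk (wk q)) (letP (wk (wk (wk p)))
  (renameP representP₀ (here ∷ there here ∷ there (there here) ∷ there (there (there here)) ∷ [])))))

hittingP : ∀ {Γ V Cs pool k} → PT Γ (list nat) V → PT Γ (list (list nat)) Cs → PT Γ (list (list bool)) pool → PT Γ
    nat k →
           PT Γ (list (list nat)) (λ ρ → hitting (V ρ) (Cs ρ) (pool ρ) (k ρ))
hittingP p q r s = filterP (hitsP (varP here) (wk q)) (representP p q r s)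

compressP : ∀ {Γ m k pool T V} → PT Γ matrixᵗ m → PT Γ nat k → PT Γ (list (list bool)) pool → PT Γ (list nat) T →
    PT Γ (list nat) V →
            PT Γ (list (list nat)) (λ ρ → compress (m ρ) (k ρ) (pool ρ) (T ρ) (V ρ))
compressP p q r s t = firstP (concatMapP (concatMapP
  (hittingP (wk (wk t)) (varP (there here) ++P varP here) (wk (wk r)) (wk (wk q)))
  (wk (systemsP trueP p s t r))) (systemsP falseP p s t r))

sz-first : ∀ {a} B (xs : List ⟦ a ⟧) → (∀ {x} → x ∈ xs → sz a x ≤ B) → sz (list a) (first xs) ≤ 2 + B
sz-first B []       h = s≤s z≤n
sz-first {a} B (x ∷ xs) h = s≤s (≤-trans (+-monoˡ-≤ 1 (h (here refl))) (≤-reflexive (+-comm B 1)))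

sz-compress : ∀ m k pool T V → sz (list (list nat)) (compress m k pool T V) ≤ 2 + (1 + k * sz (list nat) V)
sz-compress m k pool T V = sz-first {list nat} _ (solutions m k pool T V) λ i →
  let Bs , _ , j = ∈-concatMap⁻ (systems false m T V pool) i
      Rs , _ , l = ∈-concatMap⁻ (systems true m T V pool) j
  in sz-represent V (Bs ++ Rs) pool k (proj₁ (∈-filterᵇ⁻ (λ S → hits S (Bs ++ Rs)) (represent V (Bs ++ Rs) pool k) l))

sz-solve : ∀ m k pool V → sz (list (list nat)) (solve m k pool V) ≤ 2 + (1 + k * sz (list nat) V)
sz-solve m k pool []      = m≤m+n 3 _
sz-solve m k pool (x ∷ V) = go (solve m k pool V)
  where
  go : ∀ r → sz (list (list nat)) (caseList r [] (λ S _ → compress m k pool (x ∷ S) (x ∷ V))) ≤ 2 +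
      (1 + k * sz (list nat) (x ∷ V))
  go []      = s≤s z≤n
  go (S ∷ _) = sz-compress m k pool (x ∷ S) (x ∷ V)

n≤sz : ∀ n → n ≤ sz nat n
n≤sz zero    = z≤n
n≤sz (suc n) = s≤s (m≤n⇒m≤1+n (n≤sz n))

solveP₀ : PT (matrixᵗ ∷ nat ∷ list (list bool) ∷ list nat ∷ []) (list (list nat))
    (λ (m , k , pool , V , _) → solve m k pool V)
solveP₀ = congP
  (paraP (varP (there (there (there here)))) (consP nilP nilP)
    (caseP (varP here) nilP
      (compressP (varP (w here)) (varP (w (there here))) (varP (w (there (there here))))
        (consP (varP (there (there (there here)))) (varP here))
        (consP (varP (there (there (there here)))) (varP (there (there (there (there here))))))))
    -- At most one solution is kept, and its at most k names are drawn from the list of vertices.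
    (con 2 ⊕ (con 1 ⊕ X ⊛ X))
    (λ ρ xs → ≤-trans (≤-reflexive (cong (sz (list (list nat)))
        (same (proj₁ ρ) (proj₁ (proj₂ ρ)) (proj₁ (proj₂ (proj₂ ρ))) xs)))
      (solution-size (proj₁ ρ) (proj₁ (proj₂ ρ)) (proj₁ (proj₂ (proj₂ ρ))) (proj₁ (proj₂ (proj₂ (proj₂ ρ)))) xs)))
  (λ (m , k , pool , V , _) → same m k pool V)
  where
  w : ∀ {Γ a b c d e f} → Γ ∋ a → b ∷ c ∷ d ∷ e ∷ f ∷ Γ ∋ a
  w i = there (there (there (there (there i))))
  same : ∀ m k pool xs → para (λ r x xs → caseList r [] (λ S _ → compress m k pool (x ∷ S) (x ∷ xs))) ([] ∷ []) xs
      ≡ solve m k pool xs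
  same m k pool []       = refl
  same m k pool (x ∷ xs) = cong (λ r → caseList r [] (λ S _ → compress m k pool (x ∷ S) (x ∷ xs))) (same m k pool xs)
  solution-size : ∀ m k pool V xs → let N = sz (list nat) xs + szs (matrixᵗ ∷ nat ∷ list (list bool) ∷ list nat ∷ []) (m , k , pool , V , tt) in
                  sz (list (list nat)) (solve m k pool xs) ≤ 2 + (1 + N * N)
  solution-size m k pool V xs = ≤-trans (sz-solve m k pool xs)
      (s≤s (s≤s (s≤s (*-mono-≤ k≤ (m≤m+n (sz (list nat) xs) _)))))
    where
    k≤ : k ≤ sz (list nat) xs + (sz matrixᵗ m + (sz nat k + (sz (list (list bool)) pool + (sz (list nat) V + 0))))
    k≤ = ≤-trans (n≤sz k) (≤-trans (m≤m+n (sz nat k) _) (≤-trans (m≤n+m _ (sz matrixᵗ m)) (m≤n+m _ (sz (list nat) xs))))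

answerP : PT (list (list bool) ∷ (matrixᵗ ⊗ nat) ∷ []) (list (list bool)) (λ (pool , (m , k) , _) → answer m k pool)
answerP = caseP solved nilP (consP (mapP (memP (varP here) (varP (there here))) (wk (wk (upToP m)))) nilP)
  where
  m = fstP (varP (there here))
  k = sndP (varP (there here))
  solved = letP (downFromP m) (letP (wk (varP here)) (letP (wk (wk k)) (letP (wk (wk (wk m)))
    (renameP solveP₀ (here ∷ there here ∷ there (there here) ∷ there (there (there here)) ∷ [])))))

-- The pool of all guesses

double : List (List Bool) → List (List Bool)
double p = map (true ∷_) p ++ map (false ∷_) p

doubles : ℕ → List (List Bool) → List (List Bool)
doubles zero    p = p
doubles (suc w) p = double (doubles w p)

doubleP : ∀ {Γ p} → PT Γ (list (list bool)) p → PT Γ (list (list bool)) (λ ρ → double (p ρ))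
doubleP q = mapP (consP trueP (varP here)) q ++P mapP (consP falseP (varP here)) q

doublesP : ∀ {Γ p} w → PT Γ (list (list bool)) p → PT Γ (list (list bool)) (λ ρ → doubles w (p ρ))
doublesP zero    q = q
doublesP (suc w) q = doubleP (doublesP w q)

full-double : ∀ {L p} → Full L p → Full (suc L) (double p)
full-double {p = p} full (true ∷ g)  refl = ∈-++⁺ˡ (∈-map⁺ (true ∷_) (full g refl))
full-double {p = p} full (false ∷ g) refl = ∈-++⁺ʳ (map (true ∷_) p) (∈-map⁺ (false ∷_) (full g refl))

full-doubles : ∀ w {L p} → Full L p → Full (w + L) (doubles w p)
full-doubles zero    full = full
full-doubles (suc w) full = full-double (full-doubles w full)

-- One round of w doublings is polynomial for fixed w; iterating it along k is not. This is the one
-- loop outside `PT`, so its cost is bounded separately.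
poolFrom : ℕ → List ⊤ → List (List Bool)
poolFrom w = para (λ r _ _ → doubles w r) (doubles w ([] ∷ []))

full-pool : ∀ w xs → Full (w * suc (length xs)) (poolFrom w xs)
full-pool w []       = subst (λ L → Full L (poolFrom w [])) (trans (+-identityʳ w) (sym (*-identityʳ w)))
    (full-doubles w λ { [] refl → here refl })
full-pool w (x ∷ xs) = subst (λ L → Full L (poolFrom w (x ∷ xs))) (sym (*-suc w (suc (length xs))))
    (full-doubles w (full-pool w xs))

-- A bit adds at most four nodes to each string, which occupies at least one node already; hence the
-- factor 5, and 10 for both halves of a doubling.
sz-map-cons : ∀ b p → sz (list (list bool)) (map (b ∷_) p) ≤ 5 * sz (list (list bool)) p
sz-map-cons b []      = s≤s z≤n
sz-map-cons b (g ∷ p) = ≤-by _ _ (4 * sz (list bool) g) (+-mono-≤ (sz-bool b) (sz-map-cons b p))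
  (lemma (sz bool b) (sz (list bool) g) (sz (list (list bool)) p) (sz (list (list bool)) (map (b ∷_) p)))
  where
  lemma : ∀ b g p m → 5 * suc (g + p) + (b + m) ≡ suc (suc (b + g) + m) + (3 + 5 * p) + (4 * g)
  lemma = solve-∀

sz-double : ∀ p → sz (list (list bool)) (double p) ≤ 10 * sz (list (list bool)) p
sz-double p = ≤-trans (sz-++ {list bool} (map (true ∷_) p) (map (false ∷_) p))
  (≤-trans (+-mono-≤ (sz-map-cons true p) (sz-map-cons false p)) (≤-reflexive (lemma (sz (list (list bool)) p))))
  where
  lemma : ∀ p → 5 * p + 5 * p ≡ 10 * p
  lemma = solve-∀

sz-doubles : ∀ w p → sz (list (list bool)) (doubles w p) ≤ 10 ^ w * sz (list (list bool)) p
sz-doubles zero    p = ≤-reflexive (sym (*-identityˡ _))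
sz-doubles (suc w) p = ≤-trans (sz-double (doubles w p))
    (≤-trans (*-monoʳ-≤ 10 (sz-doubles w p)) (≤-reflexive (sym (*-assoc 10 (10 ^ w) _))))

sz-pool : ∀ w xs → sz (list (list bool)) (poolFrom w xs) ≤ (10 ^ w) ^ suc (length xs) * 3
sz-pool w []       = ≤-trans (sz-doubles w ([] ∷ [])) (*-monoˡ-≤ 3 (≤-reflexive (sym (*-identityʳ (10 ^ w)))))
sz-pool w (x ∷ xs) = ≤-trans (sz-doubles w (poolFrom w xs))
    (≤-trans (*-monoʳ-≤ (10 ^ w) (sz-pool w xs)) (≤-reflexive (sym (*-assoc (10 ^ w) _ 3))))

-- The program

inputᵗ : Ty
inputᵗ = matrixᵗ ⊗ nat

poolᵗ : Ty
poolᵗ = list (list bool)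

-- The ingredients of the program are passed as variables of these types, with w abstract, to keep
-- their polynomial bounds and the powers of 10 from being unfolded.
Bits Solver : Set₁
Bits   = PT (inputᵗ ∷ []) (list unit) (λ ρ → units (proj₂ (proj₁ ρ)))
Solver = PT (poolᵗ ∷ inputᵗ ∷ []) (list (list bool)) (λ (pool , (m , k) , _) → answer m k pool)

Seed Grow : ℕ → Set₁
Seed w = PT (inputᵗ ∷ []) poolᵗ (λ _ → doubles w ([] ∷ []))
Grow w = PT (poolᵗ ∷ unit ∷ list unit ∷ list unit ∷ poolᵗ ∷ inputᵗ ∷ []) poolᵗ (λ ρ → doubles w (proj₁ ρ))

poolCode : ∀ w → Bits → Seed w → Grow w →
           Code (inputᵗ ∷ []) (λ ρ → enc poolᵗ (poolFrom w (units (proj₂ (proj₁ ρ)))))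
poolCode w pl pz ps = codePara {a = unit} {l = λ ρ → units (proj₂ (proj₁ ρ))} {z = λ _ → doubles w ([] ∷ [])}
    {s = λ ρ → doubles w (proj₁ ρ)}
  (code pl) (code pz) (code ps)

mainCode : ∀ w → Bits → Seed w → Grow w → Solver →
           Code (inputᵗ ∷ []) (λ ρ → enc (list (list bool))
               (answer (proj₁ (proj₁ ρ)) (proj₂ (proj₁ ρ)) (poolFrom w (units (proj₂ (proj₁ ρ))))))
mainCode w pl pz ps pa = codeLet {x = λ ρ → poolFrom w (units (proj₂ (proj₁ ρ)))} (poolCode w pl pz ps) (code pa)

length-units : ∀ k {y} (ys : List ⊤) → sz (list unit) (y ∷ ys) ≤ sz (list unit) (units k) → length ys ≤ k
length-units zero    ys       (s≤s ())
length-units (suc k) []       h             = z≤n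
length-units (suc k) (y ∷ ys) (s≤s (s≤s h)) = s≤s (length-units k ys h)

sz-units : ∀ k → sz (list unit) (units k) ≡ sz nat k
sz-units zero    = refl
sz-units (suc k) = cong (λ n → suc (suc n)) (sz-units k)

-- A bound for the pool and the instance taken together, in which all the remaining work is
-- polynomial.
extent : ℕ → ⟦ inputᵗ ⟧ → ℕ
extent w (m , k) = (10 ^ w) ^ suc k * 3 + sz inputᵗ (m , k)

time-within : ∀ {Γ a f} (p : PT Γ a f) ρ {E} → szs Γ ρ ≤ E → cost (code p) ρ ≤ eval (bound p) E
time-within p ρ h = ≤-trans (time≤ p ρ) (eval-mono (bound p) h)

-- The shape of the cost of `codePara` with one outer variable. The step sees six values, none
-- larger than the extent, hence the argument `con 6 ⊛ X`; the other 6 is the overhead of a round.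
poolBound : Poly → Poly → Poly → Poly
poolBound l z s = con 1 ⊕ (l ⊕ (z ⊕ con 1) ⊕ (con 3 ⊕ X ⊛ (con 1 ⊕ s ⊚ (con 6 ⊛ X) ⊕ con 6)))

-- Again for arbitrary components, whose bounds are not normalised.
pool-cost : ∀ w → 1 ≤ 10 ^ w →
            (pl : Bits) (pz : Seed w) (ps : Grow w) → ∀ x →
            cost (poolCode w pl pz ps) (x , tt) ≤ eval (poolBound (bound pl) (bound pz) (bound ps)) (extent w x)
pool-cost w pos pl pz ps x@(m , k) = s≤s (+-mono-≤
    (+-mono-≤ (time-within pl (x , tt) x≤) (+-monoˡ-≤ 1 (time-within pz (x , tt) x≤)))
  (≤-trans (loopCost≤ {unit} 1 (poolFrom w) (λ r y ys → cost (code ps)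
      (r , y , ys , y ∷ ys , doubles w ([] ∷ []) , x , tt))
      (sz (list unit) (units k)) (eval (bound ps) (6 * E)) each (units k) ≤-refl)
    (+-monoʳ-≤ 3 (*-monoˡ-≤ (1 + eval (bound ps) (6 * E) + 6) k≤))))
  where
  E = extent w x
  D = 10 ^ w
  x≤ : sz inputᵗ x + 0 ≤ E
  x≤ = ≤-trans (≤-reflexive (+-identityʳ _)) (m≤n+m _ (D ^ suc k * 3))
  k≤ : sz (list unit) (units k) ≤ E
  k≤ = ≤-trans (≤-reflexive (sz-units k)) (≤-trans (≤-trans (m≤n+m _ (sz matrixᵗ m)) (n≤1+n _))
      (m≤n+m _ (D ^ suc k * 3)))
  pool≤ : ∀ xs → length xs ≤ k → sz poolᵗ (poolFrom w xs) ≤ E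
  pool≤ xs h = ≤-trans (sz-pool w xs) (≤-trans (*-monoˡ-≤ 3 (^-monoʳ-≤ D {{>-nonZero pos}} (s≤s h))) (m≤m+n _ _))
  each : ∀ y ys → sz (list unit) (y ∷ ys) ≤ sz (list unit) (units k) →
         cost (code ps) (poolFrom w ys , y , ys , y ∷ ys , doubles w ([] ∷ []) , x , tt) ≤ eval (bound ps) (6 * E)
  each y ys h = time-within ps (poolFrom w ys , y , ys , y ∷ ys , doubles w ([] ∷ []) , x , tt)
    (+-mono-≤ (pool≤ ys (length-units k ys h)) (+-mono-≤
        (≤-trans (1≤size nil) (≤-trans (1≤size (enc (list unit) (units k))) k≤))
      (+-mono-≤ (≤-trans (sz-tail {unit} y ys) (≤-trans h k≤)) (+-mono-≤ (≤-trans h k≤)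
        (+-mono-≤ (pool≤ [] z≤n) (+-monoˡ-≤ 0 (≤-trans (≤-reflexive (sym (+-identityʳ _))) x≤)))))))

main-cost : ∀ w → 1 ≤ 10 ^ w → ∀ pl pz ps pa x →
            cost (mainCode w pl pz ps pa) (x , tt) ≤ eval
                (con 1 ⊕ (poolBound (bound pl) (bound pz) (bound ps) ⊕ bound pa)) (extent w x)
main-cost w pos pl pz ps pa x@(m , k) = s≤s (+-mono-≤ (pool-cost w pos pl pz ps x)
  (time-within pa (poolFrom w (units k) , x , tt) (+-mono-≤
    (≤-trans (sz-pool w (units k)) (*-monoˡ-≤ 3 (^-monoʳ-≤ (10 ^ w) {{>-nonZero pos}}
        (s≤s (≤-reflexive (length-replicate k))))))
    (≤-reflexive (+-identityʳ _)))))

k≤D^k : ∀ {D} → 2 ≤ D → ∀ k → suc k ≤ D ^ k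
k≤D^k         h zero    = ≤-refl
k≤D^k {D} h (suc k) = ≤-trans (≤-by (suc (suc k)) (2 * suc k) k (≤-refl {0}) (lemma k)) (*-mono-≤ h (k≤D^k h k))
  where
  lemma : ∀ k → 2 * suc k + 0 ≡ suc (suc k) + 0 + k
  lemma = solve-∀

-- With K = Dᵏ ≥ k + 1 and s ≥ 1, every summand is at most a constant times K s.
extent-bound : ∀ D K k s → suc k ≤ K → 1 ≤ s → suc (D * K * 3 + suc (s + suc (2 * k))) ≤ (D * 3 + 4) * (K * s)
extent-bound D (suc K) k (suc s) (s≤s h) _ = ≤-by _ _ (3 * D * s + 3 * D * K * s + 0 + 2 * K + 3 * s + 4 * K * s)
    (*-monoʳ-≤ 2 h) (lemma D K k s)
  where
  lemma : ∀ D K k s → (D * 3 + 4) * (suc K * suc s) + 2 * k ≡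
          suc (D * suc K * 3 + suc (suc s + suc (2 * k))) + 2 * K +
              (3 * D * s + 3 * D * K * s + 0 + 2 * K + 3 * s + 4 * K * s)
  lemma = solve-∀

sz-nat : ∀ k → sz nat k ≡ suc (2 * k)
sz-nat zero    = refl
sz-nat (suc k) = trans (cong (λ n → suc (suc n)) (sz-nat k)) (cong suc (sym (*-suc 2 k)))

-- Encodings

enc-tabulate : ∀ {A : Set} {a} (e : A → Tree) {n} (f : Fin n → A) (g : Fin n → ⟦ a ⟧) → (∀ i → e (f i) ≡ enc a (g i)) →
               encodeVec e (Vec.tabulate f) ≡ enc (list a) (tabulate g)
enc-tabulate e {zero}  f g h = refl
enc-tabulate {a = a} e {suc n} f g h = cong₂ cons (h zero) (enc-tabulate {a = a} e (f ∘ suc) (g ∘ suc) (h ∘ suc))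

enc-entry : ∀ c → encodeMaybe encodeColour c ≡ enc (list bool) (entryOf c)
enc-entry nothing     = refl
enc-entry (just blue) = refl
enc-entry (just red)  = refl

enc-matrix : ∀ {n} (G : BicolouredGraph n) → encodeGraph G ≡ enc matrixᵗ (matrix G)
enc-matrix G = enc-tabulate {a = list (list bool)} _ _ _ λ u → enc-tabulate {a = list bool} _ _ _ λ v → enc-entry
    (colour G u v)

enc-subset : ∀ n (h : ℕ → Bool) f → enc (list bool) (map h (applyUpTo f n)) ≡ encodeVec encodeBool
    (Vec.tabulate {n = n} λ i → h (f (toℕ i)))
enc-subset zero    h f = refl
enc-subset (suc n) h f = cong (cons (encodeBool (h (f 0)))) (enc-subset n h (f ∘ suc))

enc-answer : ∀ {n} (G : BicolouredGraph n) k pool →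
             enc (list (list bool)) (answer (matrix G) k pool) ≡ encodeAnswer
                 (toAnswer n (solve (matrix G) k pool (downFrom n)))
enc-answer {n} G k pool = trans (cong (λ l → enc (list (list bool)) (result l))
    (length-tabulate (λ u → tabulate λ v → entryOf (colour G u v))))
                                (go (solve (matrix G) k pool (downFrom n)))
  where
  report : ℕ → List (List ℕ) → List (List Bool)
  report l r = caseList r [] (λ S _ → map (λ v → mem v S) (upTo l) ∷ [])
  result : ℕ → List (List Bool)
  result l = report l (solve (matrix G) k pool (downFrom l))
  go : ∀ r → enc (list (list bool)) (report n r) ≡ encodeAnswer (toAnswer n r)
  go []      = refl
  go (S ∷ _) = cong (λ t → cons t nil) (enc-subset n (λ v → mem v S) id)

-- The degree d moves into the base: (D^k)^d = (D^d)^k. Thus D^d is a constant of the algorithm, and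
-- the exponential factor depends on k alone.
fpt-bound : ∀ D a d k s E → suc E ≤ (D * 3 + 4) * (D ^ k * s) →
            a * suc E ^ d ≤ a * (D * 3 + 4) ^ d * (D ^ d) ^ k * s ^ d
fpt-bound D a d k s E h = begin
  a * suc E ^ d                                  ≤⟨ *-monoʳ-≤ a (^-monoˡ-≤ d h) ⟩
  a * (B * (D ^ k * s)) ^ d                      ≡⟨ cong (a *_)
      (trans (*-^-distrib B (D ^ k * s) d) (cong (B ^ d *_) (*-^-distrib (D ^ k) s d))) ⟩
  a * (B ^ d * ((D ^ k) ^ d * s ^ d))            ≡⟨ cong (λ z → a * (B ^ d * (z * s ^ d)))
      (trans (^-*-assoc D k d) (trans (cong (D ^_) (*-comm k d)) (sym (^-*-assoc D d k)))) ⟩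
  a * (B ^ d * ((D ^ d) ^ k * s ^ d))            ≡⟨ lemma a (B ^ d) ((D ^ d) ^ k) (s ^ d) ⟩
  a * B ^ d * (D ^ d) ^ k * s ^ d                ∎
  where
  open ≤-Reasoning
  B = D * 3 + 4
  lemma : ∀ a b c e → a * (b * (c * e)) ≡ a * b * c * e
  lemma = solve-∀

DFVS-in-FPT : Set
DFVS-in-FPT = ∃[ c ] Σ[ P ∈ Program ] ∃[ a ] ∃[ d ]
    (∀ {n : ℕ} (G : BicolouredGraph n) (k : ℕ) →
    Σ[ answer ∈ Maybe (Subset n) ] ∃[ time ]
    ( Runs P (encodeInstance G k) (encodeAnswer answer) time
    × Answers G k answer
    × time ≤ a * c ^ k * size (encodeGraph G) ^ d ))

solves-dfvs : ∀ w → (∀ k → w * suc k ≡ guesses k) → 2 ≤ 10 ^ w →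
  Bits → Seed w → Grow w → Solver → DFVS-in-FPT
solves-dfvs w enough big pl pz ps pa = go (eval-bound (con 1 ⊕ (poolBound (bound pl) (bound pz) (bound ps) ⊕ bound pa)))
  where
  D = 10 ^ w
  main = mainCode w pl pz ps pa
  go : ∃[ a ] ∃[ d ] (∀ n → eval (con 1 ⊕ (poolBound (bound pl) (bound pz) (bound ps) ⊕ bound pa)) n ≤ a * suc n ^
      d) → DFVS-in-FPT
  go (a , d , bounded) = D ^ d , program main , a * (D * 3 + 4) ^ d , d , correct
    where
    correct : ∀ {n : ℕ} (G : BicolouredGraph n) (k : ℕ) → Σ[ answer ∈ Maybe (Subset n) ] ∃[ time ]
      ( Runs (program main) (encodeInstance G k) (encodeAnswer answer) time
      × Answers G k answer
      × time ≤ a * (D * 3 + 4) ^ d * (D ^ d) ^ k * size (encodeGraph G) ^ d )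
    correct {n} G k = toAnswer n (solve (matrix G) k pool (downFrom n)) , t ,
      subst₂ (λ i o → Runs (program main) i o t) (cong (λ g → cons g (encodeℕ k)) (sym (enc-matrix G)))
          (enc-answer G k pool) runs ,
      answers G k pool (subst (λ L → Full L pool) (trans (cong (λ l → w * suc l) (length-replicate k)) (enough k))
          (full-pool w (units k))) ,
      ≤-trans t≤ (≤-trans (main-cost w (≤-trans (s≤s z≤n) big) pl pz ps pa x) (≤-trans (bounded (extent w x))
        (fpt-bound D a d k (size (encodeGraph G)) (extent w x)
          (≤-trans (≤-reflexive (cong (λ z → suc (D * D ^ k * 3 + z))
              (cong suc (cong₂ _+_ (cong size (sym (enc-matrix G))) (sz-nat k)))))
            (extent-bound D (D ^ k) k (size (encodeGraph G)) (k≤D^k big k) (1≤size (encodeGraph G)))))))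
      where
      pool = poolFrom w (units k)
      x = matrix G , k
      outcome = program-runs main x
      t = proj₁ outcome
      runs = proj₁ (proj₂ outcome)
      t≤ = proj₂ (proj₂ outcome)

theorem1 : ∃[ c ] Σ[ P ∈ Program ] ∃[ a ] ∃[ d ]
    (∀ {n : ℕ} (G : BicolouredGraph n) (k : ℕ) →
    Σ[ answer ∈ Maybe (Subset n) ] ∃[ time ]
    ( Runs P (encodeInstance G k) (encodeAnswer answer) time
    × Answers G k answer
    × time ≤ a * c ^ k * size (encodeGraph G) ^ d ))
-- Ten doublings for each of the k + 1 rounds write down all strings of length `guesses k`.
theorem1 = solves-dfvs 10 (λ _ → refl) (s≤s (s≤s z≤n)) (unitsP (sndP (varP here))) (doublesP 10 (consP nilP nilP))
    (doublesP 10 (varP here)) answerP
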